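{- Let $d\geq 3$ and let $\Delta$ be a balanced minimal $(d-1)$-cycle complex with proper coloring $\kappa:V(\Delta)\to[d]$. Then for every $T\subseteq[d]$ with $|T|\geq 3$, the graph $G(\Delta_T)$ of the $T$-rank selected subcomplex $\Delta_T=\Delta[\kappa^{ -1}(T)]$ is rigid in $\mathbb{R}^{|T|}$.
   Context: Simplicial complexes are finite; $[d]=\{1,\dots,d\}$. $V(\Delta)$, $E(\Delta)$ are the sets of $0$-faces and $1$-faces of $\Delta$, and $G(\Delta)=(V(\Delta),E(\Delta))$ is its graph (1-skeleton). For $W\subseteq V(\Delta)$, $\Delta[W]=\{F\in\Delta: F\subseteq W\}$. For a collection $\mathcal S$ of finite sets, $\langle\mathcal S\rangle=\{G: G\subseteq F \text{ for some } F\in\mathcal S\}$. Minimal cycle complexes. Let $\Gamma$ be an abelian group. On a totally ordered vertex set, an $i$-chain is a formal sum $c=\sum_F a_F F$ of $i$-faces with $a_F\in\Gamma$; $\partial c=\sum_F a_F\,\partial F$, where for $F=\{x_1<\dots<x_{i+1}\}$, $\partial F=\sum_{j=1}^{i+1}(-1)^jF\setminus\{x_j\}$. An $i$-cycle is an $i$-chain $c$ with $\partial c=0$. A chain $c'=\sum b_FF$ is a subchain of $c=\sum a_FF$ if $b_F\in\{0,a_F\}$ for every $F$. An $i$-cycle $c$ is minimal if its only subchains that are $i$-cycles are $c$ and $0$. $\operatorname{supp} c=\{F:a_F\neq0\}$. A $(d-1)$-dimensional simplicial complex $\Delta$ is a minimal $(d-1)$-cycle complex (over $\Gamma$) if either (i)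 $\Delta=\langle\{F\}\rangle$ for a $d$-set $F$, or (ii) $\Delta=\langle\operatorname{supp}c\rangle$ for some nonzero minimal $(d-1)$-cycle $c$ with coefficients in $\Gamma$. Here $\Gamma$ is an arbitrary abelian group. A $(d-1)$-dimensional complex $\Delta$ is balanced if there is a map $\kappa:V(\Delta)\to[d]$ with $|F\cap\kappa^{ -1}(i)|\leq1$ for all $F\in\Delta$, $i\in[d]$ (equivalently $G(\Delta)$ is $d$-colorable); $\kappa$ is called a proper coloring. For minimal cycle complexes it is unique up to permutation of colors. Rigidity. A framework $(G,p)$ in $\mathbb{R}^k$ is a finite simple graph $G$ with a map $p:V(G)\to\mathbb{R}^k$. An infinitesimal motion is a map $\dot p:V(G)\to\mathbb{R}^k$ with $(p(i)-p(j))\cdot(\dot p(i)-\dot p(j))=0$ for all $ij\in E(G)$; it is trivial if $\dot p(i)=Sp(i)+t$ for all $i$, for some skew-symmetric $S$ and some $t\in\mathbb{R}^k$. $(G,p)$ is infinitesimally rigid if all its infinitesimal motions are trivial. $G$ is rigid in $\mathbb{R}^k$ if $(G,p)$ is infinitesimally rigid in $\mathbb{R}^k$ for some $p$. -}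

module Defs where

open import Algebra.Bundles using (AbelianGroup)
open import Algebra.Bundles.Raw using (RawMonoid)
import Algebra.Definitions.RawMonoid as RawMonoidDefinitions
import Algebra.Properties.Monoid.Sum as MonoidSum
open import Data.Bool.Base using (if_then_else_)
open import Data.Fin.Base using (Fin)
import Data.Fin.Properties as Fin
open import Data.Fin.Subset
  using (Side; Subset; _∈_; _⊆_; ⁅_⁆; _∩_; _∪_; ∣_∣; outside)
open import Data.Fin.Subset.Properties
  using (_∈?_; _⊆?_; ⊆-trans; x∈⁅y⁆⇒x≡y)
open import Data.Nat.Base using (ℕ; zero; suc; _≤_; _⊔_)
import Data.Nat.Properties as ℕ
open import Data.Product.Base using (Σ; ∃-syntax; _×_; _,_)
open import Data.Rational.Base as ℚ using (ℚ; 0ℚ; 1ℚ; ½)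
import Data.Rational.Properties as ℚ
open import Data.Rational.Solver using (module +-*-Solver)
open import Data.Sum.Base using (_⊎_)
open import Data.Vec.Base using (tabulate; lookup)
open import Data.Vec.Properties using (lookup∘tabulate; lookup⇒[]=)
open import Level using (0ℓ) renaming (_⊔_ to _⊔ˡ_)
open import Relation.Binary.PropositionalEquality
  using (_≡_; _≢_; refl; sym; trans; cong; subst)
open import Relation.Nullary using (¬_; Dec; yes; no; does)
open import Relation.Nullary.Decidable using (_×-dec_; dec-true)
open import Relation.Unary using (Pred; Decidable; _≐_; ｛_｝)

-- Real numbers are Cauchy sequences of rationals, identified by _≈ℝ_ when
-- their difference is a null sequence.

IsCauchy : (ℕ → ℚ) → Set
IsCauchy x = ∀ ε → 0ℚ ℚ.< ε →
  ∃[ N ] (∀ m n → N ≤ m → N ≤ n → ℚ.∣ x m ℚ.- x n ∣ ℚ.< ε)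

record ℝ : Set where
  constructor mkℝ
  field
    seq    : ℕ → ℚ
    cauchy : IsCauchy seq

open ℝ public

infix  4 _≈ℝ_
infixl 6 _+ℝ_ _-ℝ_
infixl 7 _*ℝ_
infix  8 -ℝ_
infixl 6 _-ᵛ_
infix  7 _·_

_≈ℝ_ : ℝ → ℝ → Set
x ≈ℝ y = ∀ ε → 0ℚ ℚ.< ε →
  ∃[ N ] (∀ n → N ≤ n → ℚ.∣ seq x n ℚ.- seq y n ∣ ℚ.< ε)

private
  open +-*-Solver

  ε/2 : ∀ {ε} → 0ℚ ℚ.< ε → 0ℚ ℚ.< ½ ℚ.* ε
  ε/2 {ε} 0<ε =
    subst (ℚ._< ½ ℚ.* ε) (ℚ.*-zeroʳ ½) (ℚ.*-monoʳ-<-pos ½ 0<ε)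

  halves : ∀ ε → ½ ℚ.* ε ℚ.+ ½ ℚ.* ε ≡ ε
  halves ε = trans (sym (ℚ.*-distribʳ-+ ε ½ ½)) (ℚ.*-identityˡ ε)

  +-cauchy : ∀ x y → IsCauchy x → IsCauchy y →
             IsCauchy (λ n → x n ℚ.+ y n)
  +-cauchy x y cx cy ε 0<ε =
    let N₁ , h₁ = cx (½ ℚ.* ε) (ε/2 0<ε)
        N₂ , h₂ = cy (½ ℚ.* ε) (ε/2 0<ε)
    in N₁ ⊔ N₂ , λ m n N≤m N≤n → begin-strict
      ℚ.∣ (x m ℚ.+ y m) ℚ.- (x n ℚ.+ y n) ∣
        ≡⟨ cong ℚ.∣_∣ (solve 4 (λ a b c d →
             (a :+ b) :- (c :+ d) := (a :- c) :+ (b :- d))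
             refl (x m) (y m) (x n) (y n)) ⟩
      ℚ.∣ (x m ℚ.- x n) ℚ.+ (y m ℚ.- y n) ∣
        ≤⟨ ℚ.∣p+q∣≤∣p∣+∣q∣ (x m ℚ.- x n) (y m ℚ.- y n) ⟩
      ℚ.∣ x m ℚ.- x n ∣ ℚ.+ ℚ.∣ y m ℚ.- y n ∣
        <⟨ ℚ.+-mono-<
             (h₁ m n (ℕ.m⊔n≤o⇒m≤o N₁ N₂ N≤m) (ℕ.m⊔n≤o⇒m≤o N₁ N₂ N≤n))
             (h₂ m n (ℕ.m⊔n≤o⇒n≤o N₁ N₂ N≤m) (ℕ.m⊔n≤o⇒n≤o N₁ N₂ N≤n)) ⟩
      ½ ℚ.* ε ℚ.+ ½ ℚ.* ε
        ≡⟨ halves ε ⟩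
      ε ∎
    where open ℚ.≤-Reasoning

  neg-cauchy : ∀ x → IsCauchy x → IsCauchy (λ n → ℚ.- x n)
  neg-cauchy x cx ε 0<ε =
    let N , h = cx ε 0<ε
    in N , λ m n N≤m N≤n → subst (ℚ._< ε)
         (trans (sym (ℚ.∣-p∣≡∣p∣ (x m ℚ.- x n)))
           (cong ℚ.∣_∣ (solve 2 (λ a b → :- (a :- b) := :- a :- :- b)
             refl (x m) (x n))))
         (h m n N≤m N≤n)

  const-cauchy : ∀ q → IsCauchy (λ _ → q)
  const-cauchy q ε 0<ε = 0 , λ _ _ _ _ →
    subst (ℚ._< ε) (cong ℚ.∣_∣ (sym (ℚ.+-inverseʳ q))) 0<ε

  eventually-bounded : ∀ {x} → IsCauchy x →
    ∃[ N ] ∃[ B ] 0ℚ ℚ.≤ B × (∀ n → N ≤ n → ℚ.∣ x n ∣ ℚ.≤ B)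
  eventually-bounded {x} cx =
    let N , h = cx 1ℚ (ℚ.positive⁻¹ 1ℚ)
    in N , 1ℚ ℚ.+ ℚ.∣ x N ∣
     , ℚ.+-mono-≤ {0ℚ} {1ℚ} (ℚ.<⇒≤ (ℚ.positive⁻¹ 1ℚ)) (ℚ.0≤∣p∣ (x N))
     , λ n N≤n → begin
      ℚ.∣ x n ∣
        ≡⟨ cong ℚ.∣_∣ (solve 2 (λ a b → a := (a :- b) :+ b)
             refl (x n) (x N)) ⟩
      ℚ.∣ (x n ℚ.- x N) ℚ.+ x N ∣
        ≤⟨ ℚ.∣p+q∣≤∣p∣+∣q∣ (x n ℚ.- x N) (x N) ⟩
      ℚ.∣ x n ℚ.- x N ∣ ℚ.+ ℚ.∣ x N ∣
        ≤⟨ ℚ.+-monoˡ-≤ ℚ.∣ x N ∣ (ℚ.<⇒≤ (h n N N≤n ℕ.≤-refl)) ⟩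
      1ℚ ℚ.+ ℚ.∣ x N ∣ ∎
    where open ℚ.≤-Reasoning

  divide : ∀ B {ε} → 0ℚ ℚ.≤ B → 0ℚ ℚ.< ε →
    ∃[ δ ] 0ℚ ℚ.< δ × B ℚ.* δ ℚ.< ε
  divide B {ε} 0≤B 0<ε = δ , 0<δ , (begin-strict
      B ℚ.* δ                ≡⟨ ℚ.+-identityˡ (B ℚ.* δ) ⟨
      0ℚ ℚ.+ B ℚ.* δ         <⟨ ℚ.+-monoˡ-< (B ℚ.* δ) 0<δ ⟩
      δ ℚ.+ B ℚ.* δ          ≡⟨ solve 2 (λ d b →
                                  d :+ b :* d := (con 1ℚ :+ b) :* d)
                                  refl δ B ⟩
      C ℚ.* (ℚ.1/ C ℚ.* ε)   ≡⟨ ℚ.*-assoc C (ℚ.1/ C) ε ⟨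
      C ℚ.* ℚ.1/ C ℚ.* ε     ≡⟨ cong (ℚ._* ε) (ℚ.*-inverseʳ C) ⟩
      1ℚ ℚ.* ε               ≡⟨ ℚ.*-identityˡ ε ⟩
      ε                      ∎)
    where
    open ℚ.≤-Reasoning
    C : ℚ
    C = 1ℚ ℚ.+ B
    instance
      posC : ℚ.Positive C
      posC = ℚ.positive (ℚ.+-mono-<-≤ {0ℚ} {1ℚ} (ℚ.positive⁻¹ 1ℚ) 0≤B)
      nonZeroC : ℚ.NonZero C
      nonZeroC = ℚ.pos⇒nonZero C
      pos1/C : ℚ.Positive (ℚ.1/ C)
      pos1/C = ℚ.1/pos⇒pos C
    δ : ℚ
    δ = ℚ.1/ C ℚ.* ε
    0<δ : 0ℚ ℚ.< δ
    0<δ = subst (ℚ._< δ) (ℚ.*-zeroʳ (ℚ.1/ C))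
            (ℚ.*-monoʳ-<-pos (ℚ.1/ C) 0<ε)

  *-bound : ∀ {a b B δ} → 0ℚ ℚ.≤ B → ℚ.∣ a ∣ ℚ.≤ B → ℚ.∣ b ∣ ℚ.< δ →
            ℚ.∣ a ℚ.* b ∣ ℚ.≤ B ℚ.* δ
  *-bound {a} {b} {B} {δ} 0≤B a≤B b<δ = begin
      ℚ.∣ a ℚ.* b ∣         ≡⟨ ℚ.∣p*q∣≡∣p∣*∣q∣ a b ⟩
      ℚ.∣ a ∣ ℚ.* ℚ.∣ b ∣   ≤⟨ ℚ.*-monoʳ-≤-nonNeg ℚ.∣ b ∣
                                 {{ℚ.∣-∣-nonNeg b}} a≤B ⟩
      B ℚ.* ℚ.∣ b ∣         ≤⟨ ℚ.*-monoˡ-≤-nonNeg B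
                                 {{ℚ.nonNegative 0≤B}} (ℚ.<⇒≤ b<δ) ⟩
      B ℚ.* δ               ∎
    where open ℚ.≤-Reasoning

  *-cauchy : ∀ x y → IsCauchy x → IsCauchy y →
             IsCauchy (λ n → x n ℚ.* y n)
  *-cauchy x y cx cy ε 0<ε =
    let M₁ , A , 0≤A , bx = eventually-bounded cx
        M₂ , B , 0≤B , by = eventually-bounded cy
        δ₁ , 0<δ₁ , Aδ₁<  = divide A 0≤A (ε/2 0<ε)
        δ₂ , 0<δ₂ , Bδ₂<  = divide B 0≤B (ε/2 0<ε)
        N₁ , hy           = cy δ₁ 0<δ₁
        N₂ , hx           = cx δ₂ 0<δ₂
        M = M₁ ⊔ M₂
        N = N₁ ⊔ N₂
        M≤ : ∀ {k} → M ⊔ N ≤ k → M ≤ k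
        M≤ = ℕ.m⊔n≤o⇒m≤o M N
        N≤ : ∀ {k} → M ⊔ N ≤ k → N ≤ k
        N≤ = ℕ.m⊔n≤o⇒n≤o M N
    in M ⊔ N , λ m n K≤m K≤n → begin-strict
      ℚ.∣ x m ℚ.* y m ℚ.- x n ℚ.* y n ∣
        ≡⟨ cong ℚ.∣_∣ (solve 4 (λ a b c d →
             a :* b :- c :* d := a :* (b :- d) :+ d :* (a :- c))
             refl (x m) (y m) (x n) (y n)) ⟩
      ℚ.∣ x m ℚ.* (y m ℚ.- y n) ℚ.+ y n ℚ.* (x m ℚ.- x n) ∣
        ≤⟨ ℚ.∣p+q∣≤∣p∣+∣q∣ (x m ℚ.* (y m ℚ.- y n))
                           (y n ℚ.* (x m ℚ.- x n)) ⟩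
      ℚ.∣ x m ℚ.* (y m ℚ.- y n) ∣ ℚ.+ ℚ.∣ y n ℚ.* (x m ℚ.- x n) ∣
        ≤⟨ ℚ.+-mono-≤
             (*-bound {x m} {y m ℚ.- y n} 0≤A
               (bx m (ℕ.m⊔n≤o⇒m≤o M₁ M₂ (M≤ K≤m)))
               (hy m n (ℕ.m⊔n≤o⇒m≤o N₁ N₂ (N≤ K≤m))
                       (ℕ.m⊔n≤o⇒m≤o N₁ N₂ (N≤ K≤n))))
             (*-bound {y n} {x m ℚ.- x n} 0≤B
               (by n (ℕ.m⊔n≤o⇒n≤o M₁ M₂ (M≤ K≤n)))
               (hx m n (ℕ.m⊔n≤o⇒n≤o N₁ N₂ (N≤ K≤m))
                       (ℕ.m⊔n≤o⇒n≤o N₁ N₂ (N≤ K≤n)))) ⟩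
      A ℚ.* δ₁ ℚ.+ B ℚ.* δ₂
        <⟨ ℚ.+-mono-< Aδ₁< Bδ₂< ⟩
      ½ ℚ.* ε ℚ.+ ½ ℚ.* ε
        ≡⟨ halves ε ⟩
      ε ∎
    where open ℚ.≤-Reasoning

fromℚ : ℚ → ℝ
fromℚ q = mkℝ (λ _ → q) (const-cauchy q)

0ℝ : ℝ
0ℝ = fromℚ 0ℚ

_+ℝ_ : ℝ → ℝ → ℝ
x +ℝ y = mkℝ (λ n → seq x n ℚ.+ seq y n)
             (+-cauchy (seq x) (seq y) (cauchy x) (cauchy y))

-ℝ_ : ℝ → ℝ
-ℝ x = mkℝ (λ n → ℚ.- seq x n) (neg-cauchy (seq x) (cauchy x))

_-ℝ_ : ℝ → ℝ → ℝ
x -ℝ y = x +ℝ (-ℝ y)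

_*ℝ_ : ℝ → ℝ → ℝ
x *ℝ y = mkℝ (λ n → seq x n ℚ.* seq y n)
             (*-cauchy (seq x) (seq y) (cauchy x) (cauchy y))

+ℝ-rawMonoid : RawMonoid 0ℓ 0ℓ
+ℝ-rawMonoid = record { Carrier = ℝ ; _≈_ = _≈ℝ_ ; _∙_ = _+ℝ_ ; ε = 0ℝ }

open RawMonoidDefinitions +ℝ-rawMonoid public using () renaming (sum to sumℝ)

ℝ^_ : ℕ → Set
ℝ^ k = Fin k → ℝ

_-ᵛ_ : ∀ {k} → ℝ^ k → ℝ^ k → ℝ^ k
(x -ᵛ y) a = x a -ℝ y a

_·_ : ∀ {k} → ℝ^ k → ℝ^ k → ℝ
x · y = sumℝ (λ a → x a *ℝ y a)

SkewSymmetric : ∀ {k} → (Fin k → Fin k → ℝ) → Set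
SkewSymmetric S = ∀ a b → S a b ≈ℝ -ℝ (S b a)

record Graph (n : ℕ) : Set₁ where
  field
    V   : Subset n
    E   : Pred (Subset n) 0ℓ
    E⊆V : ∀ {e} → E e → ∣ e ∣ ≡ 2 × e ⊆ V

  -- Since v ∈ V is a proposition, functions on Vertex are exactly
  -- functions on the set V.
  Vertex : Set
  Vertex = Σ (Fin n) (_∈ V)

  Adjacent : Vertex → Vertex → Set
  Adjacent (i , _) (j , _) = E (⁅ i ⁆ ∪ ⁅ j ⁆)

module _ {n} (G : Graph n) {k : ℕ} where
  open Graph G

  InfinitesimalMotion : (p ṗ : Vertex → ℝ^ k) → Set
  InfinitesimalMotion p ṗ = ∀ i j → Adjacent i j →
    (p i -ᵛ p j) · (ṗ i -ᵛ ṗ j) ≈ℝ 0ℝ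

  Trivial : (p ṗ : Vertex → ℝ^ k) → Set
  Trivial p ṗ =
    Σ (Fin k → Fin k → ℝ) λ S → Σ (ℝ^ k) λ t → SkewSymmetric S ×
    (∀ i a → ṗ i a ≈ℝ (S a · p i) +ℝ t a)

  InfinitesimallyRigid : (p : Vertex → ℝ^ k) → Set
  InfinitesimallyRigid p = ∀ ṗ → InfinitesimalMotion p ṗ → Trivial p ṗ

Rigid : ∀ {n} → Graph n → ℕ → Set
Rigid G k = ∃[ p ] InfinitesimallyRigid G {k} p

-- The vertices form a subset of the totally ordered set Fin n; elements of
-- Fin n need not be vertices.  The void complex is allowed.

record SimplicialComplex (n : ℕ) : Set₁ where
  field
    Face        : Pred (Subset n) 0ℓ
    face?       : Decidable Face
    down-closed : ∀ {F G} → G ⊆ F → Face F → Face G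

  vertices : Subset n
  vertices = tabulate (λ v → does (face? ⁅ v ⁆))

  Vertex : Set
  Vertex = Σ (Fin n) (_∈ vertices)

  face⊆vertices : ∀ {F} → Face F → F ⊆ vertices
  face⊆vertices {F} f {v} v∈F = lookup⇒[]= v vertices
    (trans (lookup∘tabulate (λ u → does (face? ⁅ u ⁆)) v)
      (dec-true (face? ⁅ v ⁆) (down-closed
        (λ u∈⁅v⁆ → subst (_∈ F) (sym (x∈⁅y⁆⇒x≡y v u∈⁅v⁆)) v∈F) f)))

open SimplicialComplex using (Face; vertices)

-- Dimension d - 1: a face F has dimension ∣ F ∣ - 1.
HasDimensionPred : ∀ {n} → SimplicialComplex n → ℕ → Set
HasDimensionPred Δ d =
  (∃[ F ] Face Δ F × ∣ F ∣ ≡ d) × (∀ F → Face Δ F → ∣ F ∣ ≤ d)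

_[_] : ∀ {n} → SimplicialComplex n → Subset n → SimplicialComplex n
Δ [ W ] = record
  { Face        = λ F → Face Δ F × F ⊆ W
  ; face?       = λ F → SimplicialComplex.face? Δ F ×-dec (F ⊆? W)
  ; down-closed = λ G⊆F (f , F⊆W) →
      SimplicialComplex.down-closed Δ G⊆F f , ⊆-trans G⊆F F⊆W
  }

graph : ∀ {n} → SimplicialComplex n → Graph n
graph Δ = record
  { V   = vertices Δ
  ; E   = λ e → Face Δ e × ∣ e ∣ ≡ 2
  ; E⊆V = λ (f , ∣e∣≡2) → ∣e∣≡2 , SimplicialComplex.face⊆vertices Δ f
  }

⟨_⟩ : ∀ {n ℓ} → Pred (Subset n) ℓ → Pred (Subset n) ℓ
⟨ 𝒮 ⟩ G = ∃[ F ] 𝒮 F × G ⊆ F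

below : ∀ {n} → Fin n → Subset n
below v = tabulate (λ u → does (u Fin.<? v))

-- The j for which v is the j-th smallest element of F ∋ v.
position : ∀ {n} → Fin n → Subset n → ℕ
position v F = suc ∣ F ∩ below v ∣

module _ {c ℓ} (Γ : AbelianGroup c ℓ) where
  open AbelianGroup Γ
  open MonoidSum monoid using (sum)

  -- A (d - 1)-chain, extended by zero to sets that do not have size d.
  record Chain (n d : ℕ) : Set (c ⊔ˡ ℓ) where
    field
      coeff  : Subset n → Carrier
      vanish : ∀ F → ∣ F ∣ ≢ d → coeff F ≈ ε

  open Chain

  -1^_•_ : ℕ → Carrier → Carrier
  -1^ zero  • a = a
  -1^ suc j • a = (-1^ j • a) ⁻¹

  module _ {n d : ℕ} where

    -- The coefficient of G in Σ_F a_F ∂F: the faces F having G as some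
    -- F \ {v} are the sets G ∪ {v} with v ∉ G.
    ∂ : Chain n d → Subset n → Carrier
    ∂ x G = sum (λ v → if does (v ∈? G) then ε
      else (-1^ position v (G ∪ ⁅ v ⁆) • coeff x (G ∪ ⁅ v ⁆)))

    IsCycle : Chain n d → Set ℓ
    IsCycle x = ∀ G → ∂ x G ≈ ε

    IsZero : Chain n d → Set ℓ
    IsZero x = ∀ F → coeff x F ≈ ε

    _≋_ : Chain n d → Chain n d → Set ℓ
    x ≋ y = ∀ F → coeff x F ≈ coeff y F

    _SubchainOf_ : Chain n d → Chain n d → Set ℓ
    y SubchainOf x = ∀ F → coeff y F ≈ ε ⊎ coeff y F ≈ coeff x F

    IsMinimalCycle : Chain n d → Set (c ⊔ˡ ℓ)
    IsMinimalCycle x = IsCycle x ×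
      (∀ y → y SubchainOf x → IsCycle y → y ≋ x ⊎ IsZero y)

    supp : Chain n d → Pred (Subset n) ℓ
    supp x F = ¬ (coeff x F ≈ ε)

  -- The argument d is the number of vertices of a facet, so these are the
  -- minimal (d - 1)-cycle complexes.
  IsMinimalCycleComplex : ∀ {n} → ℕ → SimplicialComplex n → Set (c ⊔ˡ ℓ)
  IsMinimalCycleComplex {n} d Δ = HasDimensionPred Δ d ×
    ( (∃[ F ] ∣ F ∣ ≡ d × Face Δ ≐ ⟨ ｛ F ｝ ⟩)
    ⊎ (∃[ x ] ¬ IsZero {n} {d} x × IsMinimalCycle x × Face Δ ≐ ⟨ supp x ⟩))

module _ {n} (Δ : SimplicialComplex n) {d : ℕ}
         (κ : SimplicialComplex.Vertex Δ → Fin d) where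

  -- κ⁻¹(T), which consists of vertices only.
  preimage : Subset d → Subset n
  preimage T = tabulate (λ v → member v (v ∈? vertices Δ))
    module Preimage where
    member : ∀ v → Dec (v ∈ vertices Δ) → Side
    member v (yes v∈V) = lookup T (κ (v , v∈V))
    member v (no  _)   = outside

  IsProperColoring : Set
  IsProperColoring = ∀ F → Face Δ F → ∀ i → ∣ F ∩ preimage ⁅ i ⁆ ∣ ≤ 1

  rankSelected : Subset d → SimplicialComplex n
  rankSelected T = Δ [ preimage T ]

{-# OPTIONS --safe #-}

-- Let k = |T|.  Call a vertex set derivable if it arises from k-cliques by gluing
-- along k common vertices and by splitting a vertex into an edge uv whose ends
-- have k - 1 common neighbours.  Derivable sets induce rigid graphs: rigidity of a
-- pinned framework is triviality of the kernel of a rational matrix, an open and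
-- generic condition on the placement, and elimination carries it from ℚ to ℝ.
--
-- The combinatorial core is Fogelsanger's contraction argument.  For a cycle of
-- (k-1)-simplices and a family of facets that is a union of classes of the
-- relation "contained in a common derivable set", the part of the cycle in the
-- family is again a cycle.  Splitting into minimal cycles, it suffices that a
-- minimal cycle lies in one derivable set.  This follows by contracting an edge
-- uv: by induction the facets over a maximal derivable set of the contraction
-- form a cycle there, which lifts to a proper subcycle unless u and v have enough
-- common neighbours to undo the contraction on that set.
--
-- For general T, fix the vertices of a ridge whose colours are not in T; the
-- remaining slice of the cycle is a cycle of (k-1)-simplices.  Hence the facets
-- whose T-part lies in a given maximal derivable set form a cycle, which by
-- minimality is the whole one.
--
-- Equality in Γ is undecidable, so the argument on cycles yields derivability only
-- up to double negation; since derivability is decidable, this is enough.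

module Submission where

open import Defs
open import Algebra.Bundles using (AbelianGroup)
import Algebra.Module.Construct.TensorUnit as TensorUnit
open import Algebra.Module.Bundles using (LeftModule)
import Algebra.Properties.AbelianGroup as AbelianGroupProperties
import Algebra.Properties.CommutativeMonoid.Sum as CommutativeMonoidSum
open import Data.Bool.Base using (Bool; true; false; if_then_else_; _∧_; not)
import Data.Bool.Properties as Bool
open import Data.Empty as Empty using (⊥-elim)
open import Data.Fin.Base as Fin using (Fin; zero; suc; _↑ˡ_; _↑ʳ_; punchIn; punchOut; combine; remQuot; inject≤)
import Data.Fin.Properties as Fin
open import Data.Fin.Subset
  using (Subset; _∈_; _∉_; _⊆_; ⁅_⁆; _∩_; _∪_; ∁; ∣_∣; inside; outside) renaming (⊥ to ∅)
import Data.Fin.Subset.Properties as Sub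
open Sub using (_∈?_; _⊆?_; anySubset?)
open import Data.Integer.Base as ℤ using (+_)
import Data.Integer.Properties as ℤ
open import Data.List.Base using (List; []; _∷_)
open import Data.Nat.Base as ℕ using (ℕ; zero; suc; _≤_; _<_; z≤n; s≤s; _⊔_)
import Data.Nat.Properties as ℕ
open import Data.Product.Base using (Σ; ∃; ∃-syntax; _×_; _,_; proj₁; proj₂)
open import Data.Rational.Base as ℚ using (ℚ; 0ℚ; 1ℚ; ½)
import Data.Rational.Properties as ℚ
import Data.Rational.Unnormalised.Base as ℚᵘ
import Data.Rational.Unnormalised.Properties as ℚᵘ
open import Data.Rational.Solver using (module +-*-Solver)
open import Data.Sum.Base using (_⊎_; inj₁; inj₂; [_,_]′)
import Data.Unit.Polymorphic.Base as Unit
open import Data.Vec.Base as Vec using (Vec; []; _∷_; lookup; tabulate; here; there)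
import Data.Vec.Properties as Vec
open import Function.Base using (_∘_; id)
open import Level as Level using (Level; 0ℓ)
open import Relation.Binary.PropositionalEquality
  using (_≡_; _≢_; refl; sym; trans; cong; cong₂; subst; module ≡-Reasoning)
open import Relation.Binary.Definitions using (Tri; tri<; tri≈; tri>)
open import Relation.Nullary using (¬_; Dec; yes; no; does)
open import Relation.Nullary.Decidable
  using (_×-dec_; _⊎-dec_; _→-dec_; ¬?; dec-true; dec-false; map′; decidable-stable; ¬¬-excluded-middle)
open import Relation.Nullary.Negation using (contradiction)
open import Relation.Unary using (_≐_; ｛_｝)

-- The induction runs on the size of the vertex set W. Contracting an edge of a minimal cycle
-- destroys minimality, and facets may cancel in the contraction. Hence the induction hypothesis
-- concerns arbitrary cycles and saturated families, and the graph E is carried along independently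
-- of the chain.
--
-- The bound |T| ≥ 3 and the k - 1 of vertex splitting come from one count. The lift of a cycle from
-- the contraction can fail to be a cycle only at ridges uK and vK, with opposite values there, and
-- as a function of K this defect is itself a cycle of (k-2)-sets supported on the common neighbours
-- of u and v. For k - 2 ≥ 1 such a cycle is zero or has at least k - 1 vertices.
--
-- Chains are alternating functions of tuples because a contraction respects no order of the
-- vertices; boundary and pushforward become plain sums without signs.
--
-- The steps of a derivation produce different placements. Generic conditions survive finite
-- intersection, so one placement in general position can always be chosen that serves all sets at
-- hand.

-- Linear algebra over ℚ

Matrix : Set → ℕ → Set
Matrix I K = I → Fin K → ℚ

-- Fraction-free: rows are cross-multiplied instead of divided by the pivot, so a matrix with
-- polynomial entries stays polynomial. The pivot row itself turns into zero.
eliminate : ∀ {I K} → Matrix I (suc K) → I → Matrix I K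
eliminate A r i j = A r zero ℚ.* A i (suc j) ℚ.- A i zero ℚ.* A r (suc j)

-- A run of Gaussian elimination that finds a pivot in every column; it
-- transports triviality of the kernel from ℚ to every ℚ-module.
data Eliminable {I : Set} : ∀ {K} → Matrix I K → Set where
  done  : {A : Matrix I 0} → Eliminable A
  pivot : ∀ {K} {A : Matrix I (suc K)} r → A r zero ≢ 0ℚ →
          Eliminable (eliminate A r) → Eliminable A

recip : ∀ q → q ≢ 0ℚ → ∃[ r ] r ℚ.* q ≡ 1ℚ
recip q q≢0 = ℚ.1/ q , ℚ.*-inverseˡ q
  where instance nz = ℚ.≢-nonZero q≢0

-- Coefficients are rational and unknowns lie in any ℚ-module, so that one development serves
-- rational and real velocities. Pivots are sought only among rationals, where equality is
-- decidable.
module Linear (M : LeftModule ℚ.+-*-ring 0ℓ 0ℓ) where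
  open LeftModule M public
  open CommutativeMonoidSum +ᴹ-commutativeMonoid public
  open AbelianGroupProperties +ᴹ-abelianGroup public
    using () renaming (⁻¹-∙-comm to -ᴹ-+ᴹ-comm; ε⁻¹≈ε to -0ᴹ≈0ᴹ; ⁻¹-involutive to -ᴹ-involutive)
  open import Relation.Binary.Reasoning.Setoid ≈ᴹ-setoid public

  infixl 6 _-ᴹ_
  _-ᴹ_ : Carrierᴹ → Carrierᴹ → Carrierᴹ
  x -ᴹ y = x +ᴹ -ᴹ y

  ⟪_,_⟫ : ∀ {K} → (Fin K → ℚ) → (Fin K → Carrierᴹ) → Carrierᴹ
  ⟪ a , x ⟫ = sum (λ j → a j *ₗ x j)

  Kernel : ∀ {I K} → Matrix I K → (Fin K → Carrierᴹ) → Set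
  Kernel A x = ∀ i → ⟪ A i , x ⟫ ≈ᴹ 0ᴹ

  TrivialKernel : ∀ {I K} → Matrix I K → Set
  TrivialKernel A = ∀ x → Kernel A x → ∀ j → x j ≈ᴹ 0ᴹ

  sum-zero : ∀ {K} {f : Fin K → Carrierᴹ} → (∀ j → f j ≈ᴹ 0ᴹ) → sum f ≈ᴹ 0ᴹ
  sum-zero {K} f≈0 = ≈ᴹ-trans (sum-cong-≋ f≈0) (sum-replicate-zero K)

  *ₗ-sum : ∀ {K} q (f : Fin K → Carrierᴹ) → q *ₗ sum f ≈ᴹ sum (λ j → q *ₗ f j)
  *ₗ-sum {zero}  q f = *ₗ-zeroʳ q
  *ₗ-sum {suc K} q f =
    ≈ᴹ-trans (*ₗ-distribˡ q _ _) (+ᴹ-congˡ (*ₗ-sum q (f ∘ suc)))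

  sum-*ₗ : ∀ {K} (a : Fin K → ℚ) x →
           sum (λ j → a j *ₗ x) ≈ᴹ CommutativeMonoidSum.sum ℚ.+-0-commutativeMonoid a *ₗ x
  sum-*ₗ {zero}  a x = ≈ᴹ-sym (*ₗ-zeroˡ x)
  sum-*ₗ {suc K} a x =
    ≈ᴹ-trans (+ᴹ-congˡ (sum-*ₗ (a ∘ suc) x)) (≈ᴹ-sym (*ₗ-distribʳ x _ _))

  inverse-unique : ∀ {x y} → x +ᴹ y ≈ᴹ 0ᴹ → x ≈ᴹ -ᴹ y
  inverse-unique {x} {y} = AbelianGroupProperties.inverseˡ-unique +ᴹ-abelianGroup x y

  -ᴹ≈-1*ₗ : ∀ x → -ᴹ x ≈ᴹ (ℚ.- 1ℚ) *ₗ x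
  -ᴹ≈-1*ₗ x = ≈ᴹ-sym (inverse-unique (begin
    (ℚ.- 1ℚ) *ₗ x +ᴹ x        ≈⟨ +ᴹ-congˡ (*ₗ-identityˡ x) ⟨
    (ℚ.- 1ℚ) *ₗ x +ᴹ 1ℚ *ₗ x  ≈⟨ *ₗ-distribʳ x _ _ ⟨
    0ℚ *ₗ x                   ≈⟨ *ₗ-zeroˡ x ⟩
    0ᴹ                        ∎))

  *ₗ-≡ : ∀ {q r} x → q ≡ r → q *ₗ x ≈ᴹ r *ₗ x
  *ₗ-≡ x refl = ≈ᴹ-refl

  *ₗ-negˡ : ∀ q x → -ᴹ (q *ₗ x) ≈ᴹ (ℚ.- q) *ₗ x
  *ₗ-negˡ q x = begin
    -ᴹ (q *ₗ x)           ≈⟨ -ᴹ≈-1*ₗ _ ⟩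
    (ℚ.- 1ℚ) *ₗ q *ₗ x    ≈⟨ *ₗ-assoc _ _ _ ⟨
    (ℚ.- 1ℚ ℚ.* q) *ₗ x   ≈⟨ *ₗ-≡ x (solve 1 (λ q → :- con 1ℚ :* q := :- q) refl q) ⟩
    (ℚ.- q) *ₗ x          ∎
    where open +-*-Solver

  *ₗ-negʳ : ∀ q x → q *ₗ (-ᴹ x) ≈ᴹ -ᴹ (q *ₗ x)
  *ₗ-negʳ q x = inverse-unique (begin
    q *ₗ (-ᴹ x) +ᴹ q *ₗ x  ≈⟨ *ₗ-distribˡ q _ _ ⟨
    q *ₗ (-ᴹ x +ᴹ x)       ≈⟨ *ₗ-congˡ (-ᴹ‿inverseˡ x) ⟩
    q *ₗ 0ᴹ                ≈⟨ *ₗ-zeroʳ q ⟩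
    0ᴹ                     ∎)

  *ₗ-comm : ∀ q r x → q *ₗ r *ₗ x ≈ᴹ r *ₗ q *ₗ x
  *ₗ-comm q r x = begin
    q *ₗ r *ₗ x     ≈⟨ *ₗ-assoc _ _ _ ⟨
    (q ℚ.* r) *ₗ x  ≈⟨ *ₗ-≡ x (ℚ.*-comm q r) ⟩
    (r ℚ.* q) *ₗ x  ≈⟨ *ₗ-assoc _ _ _ ⟩
    r *ₗ q *ₗ x     ∎

  x-x≈0 : ∀ {x y} → x ≈ᴹ y → x -ᴹ y ≈ᴹ 0ᴹ
  x-x≈0 {x} {y} x≈y = ≈ᴹ-trans (+ᴹ-congʳ x≈y) (-ᴹ‿inverseʳ y)

  x-y≈0⇒x≈y : ∀ {x y} → x -ᴹ y ≈ᴹ 0ᴹ → x ≈ᴹ y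
  x-y≈0⇒x≈y {x} {y} h = ≈ᴹ-trans (inverse-unique h) (-ᴹ-involutive y)

  +ᴹ-interchange : ∀ w x y z → (w +ᴹ x) +ᴹ (y +ᴹ z) ≈ᴹ (w +ᴹ y) +ᴹ (x +ᴹ z)
  +ᴹ-interchange w x y z = begin
    (w +ᴹ x) +ᴹ (y +ᴹ z)  ≈⟨ +ᴹ-assoc w x _ ⟩
    w +ᴹ (x +ᴹ (y +ᴹ z))  ≈⟨ +ᴹ-congˡ (+ᴹ-assoc x y z) ⟨
    w +ᴹ ((x +ᴹ y) +ᴹ z)  ≈⟨ +ᴹ-congˡ (+ᴹ-congʳ (+ᴹ-comm x y)) ⟩
    w +ᴹ ((y +ᴹ x) +ᴹ z)  ≈⟨ +ᴹ-congˡ (+ᴹ-assoc y x z) ⟩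
    w +ᴹ (y +ᴹ (x +ᴹ z))  ≈⟨ +ᴹ-assoc w y _ ⟨
    (w +ᴹ y) +ᴹ (x +ᴹ z)  ∎

  *ₗ-cancel : ∀ {q x} → q ≢ 0ℚ → q *ₗ x ≈ᴹ 0ᴹ → x ≈ᴹ 0ᴹ
  *ₗ-cancel {q} {x} q≢0 qx≈0 with r , rq≡1 ← recip q q≢0 = begin
    x               ≈⟨ *ₗ-identityˡ x ⟨
    1ℚ *ₗ x         ≈⟨ *ₗ-≡ x rq≡1 ⟨
    (r ℚ.* q) *ₗ x  ≈⟨ *ₗ-assoc r q x ⟩
    r *ₗ q *ₗ x     ≈⟨ *ₗ-congˡ qx≈0 ⟩
    r *ₗ 0ᴹ         ≈⟨ *ₗ-zeroʳ r ⟩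
    0ᴹ              ∎

  x≈-x⇒x≈0 : ∀ {x} → x ≈ᴹ -ᴹ x → x ≈ᴹ 0ᴹ
  x≈-x⇒x≈0 {x} h = *ₗ-cancel {1ℚ ℚ.+ 1ℚ} (λ ()) (begin
    (1ℚ ℚ.+ 1ℚ) *ₗ x      ≈⟨ *ₗ-distribʳ x 1ℚ 1ℚ ⟩
    1ℚ *ₗ x +ᴹ 1ℚ *ₗ x    ≈⟨ +ᴹ-cong (*ₗ-identityˡ x) (*ₗ-identityˡ x) ⟩
    x +ᴹ x                ≈⟨ +ᴹ-congˡ h ⟩
    x -ᴹ x                ≈⟨ -ᴹ‿inverseʳ x ⟩
    0ᴹ                    ∎)

  sum-neg : ∀ {K} (f : Fin K → Carrierᴹ) → sum (λ j → -ᴹ f j) ≈ᴹ -ᴹ sum f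
  sum-neg f = begin
    sum (λ j → -ᴹ f j)            ≈⟨ sum-cong-≋ (λ j → -ᴹ≈-1*ₗ (f j)) ⟩
    sum (λ j → (ℚ.- 1ℚ) *ₗ f j)   ≈⟨ *ₗ-sum _ f ⟨
    (ℚ.- 1ℚ) *ₗ sum f             ≈⟨ -ᴹ≈-1*ₗ _ ⟨
    -ᴹ sum f                      ∎

  module _ {K : ℕ} where
    ⟪⟫-cong : {a b : Fin K → ℚ} {x y : Fin K → Carrierᴹ} →
              (∀ j → a j ≡ b j) → (∀ j → x j ≈ᴹ y j) → ⟪ a , x ⟫ ≈ᴹ ⟪ b , y ⟫
    ⟪⟫-cong a≡b x≈y = sum-cong-≋ (λ j → *ₗ-cong (a≡b j) (x≈y j))

    ⟪⟫-zeroʳ : (a : Fin K → ℚ) {x : Fin K → Carrierᴹ} → (∀ j → x j ≈ᴹ 0ᴹ) → ⟪ a , x ⟫ ≈ᴹ 0ᴹ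
    ⟪⟫-zeroʳ a x≈0 = sum-zero (λ j → ≈ᴹ-trans (*ₗ-congˡ (x≈0 j)) (*ₗ-zeroʳ (a j)))

    ⟪⟫-+ʳ : (a : Fin K → ℚ) (x y : Fin K → Carrierᴹ) →
            ⟪ a , (λ j → x j +ᴹ y j) ⟫ ≈ᴹ ⟪ a , x ⟫ +ᴹ ⟪ a , y ⟫
    ⟪⟫-+ʳ a x y = ≈ᴹ-trans (sum-cong-≋ (λ j → *ₗ-distribˡ (a j) (x j) (y j)))
                           (∑-distrib-+ (λ j → a j *ₗ x j) (λ j → a j *ₗ y j))

    ⟪⟫-negʳ : (a : Fin K → ℚ) (x : Fin K → Carrierᴹ) →
              ⟪ a , (λ j → -ᴹ x j) ⟫ ≈ᴹ -ᴹ ⟪ a , x ⟫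
    ⟪⟫-negʳ a x = ≈ᴹ-trans (sum-cong-≋ (λ j → *ₗ-negʳ (a j) (x j))) (sum-neg (λ j → a j *ₗ x j))

    ⟪⟫-minusʳ : (a : Fin K → ℚ) (x y : Fin K → Carrierᴹ) →
            ⟪ a , (λ j → x j -ᴹ y j) ⟫ ≈ᴹ ⟪ a , x ⟫ -ᴹ ⟪ a , y ⟫
    ⟪⟫-minusʳ a x y = ≈ᴹ-trans (⟪⟫-+ʳ a x (λ j → -ᴹ y j)) (+ᴹ-congˡ (⟪⟫-negʳ a y))

    ⟪⟫-+ˡ : (a b : Fin K → ℚ) (x : Fin K → Carrierᴹ) →
            ⟪ (λ j → a j ℚ.+ b j) , x ⟫ ≈ᴹ ⟪ a , x ⟫ +ᴹ ⟪ b , x ⟫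
    ⟪⟫-+ˡ a b x = ≈ᴹ-trans (sum-cong-≋ (λ j → *ₗ-distribʳ (x j) (a j) (b j)))
                           (∑-distrib-+ (λ j → a j *ₗ x j) (λ j → b j *ₗ x j))

    ⟪⟫-*ˡ : ∀ q (a : Fin K → ℚ) (x : Fin K → Carrierᴹ) →
            ⟪ (λ j → q ℚ.* a j) , x ⟫ ≈ᴹ q *ₗ ⟪ a , x ⟫
    ⟪⟫-*ˡ q a x = ≈ᴹ-trans (sum-cong-≋ (λ j → *ₗ-assoc q (a j) (x j))) (≈ᴹ-sym (*ₗ-sum q (λ j → a j *ₗ x j)))

    ⟪⟫-*ʳ : ∀ q (a : Fin K → ℚ) (x : Fin K → Carrierᴹ) →
            ⟪ a , (λ j → q *ₗ x j) ⟫ ≈ᴹ q *ₗ ⟪ a , x ⟫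
    ⟪⟫-*ʳ q a x = ≈ᴹ-trans (sum-cong-≋ (λ j → *ₗ-comm (a j) q (x j))) (≈ᴹ-sym (*ₗ-sum q (λ j → a j *ₗ x j)))

    ⟪⟫-negˡ : (a : Fin K → ℚ) (x : Fin K → Carrierᴹ) →
              ⟪ (λ j → ℚ.- a j) , x ⟫ ≈ᴹ -ᴹ ⟪ a , x ⟫
    ⟪⟫-negˡ a x = ≈ᴹ-trans (sum-cong-≋ (λ j → ≈ᴹ-sym (*ₗ-negˡ (a j) (x j)))) (sum-neg (λ j → a j *ₗ x j))

    ⟪⟫-minusˡ : (a b : Fin K → ℚ) (x : Fin K → Carrierᴹ) →
            ⟪ (λ j → a j ℚ.- b j) , x ⟫ ≈ᴹ ⟪ a , x ⟫ -ᴹ ⟪ b , x ⟫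
    ⟪⟫-minusˡ a b x = ≈ᴹ-trans (⟪⟫-+ˡ a (λ j → ℚ.- b j) x) (+ᴹ-congˡ (⟪⟫-negˡ b x))

  ⟪⟫-eliminate : ∀ {I K} (A : Matrix I (suc K)) r i (x : Fin K → Carrierᴹ) →
    ⟪ eliminate A r i , x ⟫ ≈ᴹ A r zero *ₗ ⟪ A i ∘ suc , x ⟫ -ᴹ A i zero *ₗ ⟪ A r ∘ suc , x ⟫
  ⟪⟫-eliminate A r i x = ≈ᴹ-trans
    (⟪⟫-minusˡ (λ j → A r zero ℚ.* A i (suc j)) (λ j → A i zero ℚ.* A r (suc j)) x)
    (+ᴹ-cong (⟪⟫-*ˡ _ (A i ∘ suc) x) (-ᴹ‿cong (⟪⟫-*ˡ _ (A r ∘ suc) x)))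

  eliminable⇒trivialKernel : ∀ {I K} {A : Matrix I K} → Eliminable A → TrivialKernel A
  eliminable⇒trivialKernel done _ _ ()
  eliminable⇒trivialKernel {K = suc K} {A} (pivot r Ar≢0 e) x Ax≈0 = λ
    { zero    → x₀≈0
    ; (suc j) → x′≈0 j }
    where
    tail≈ : ∀ i → ⟪ A i ∘ suc , x ∘ suc ⟫ ≈ᴹ -ᴹ (A i zero *ₗ x zero)
    tail≈ i = inverse-unique (≈ᴹ-trans (+ᴹ-comm _ _) (Ax≈0 i))
    x′≈0 : ∀ j → x (suc j) ≈ᴹ 0ᴹ
    x′≈0 = eliminable⇒trivialKernel e (x ∘ suc) λ i →
      ≈ᴹ-trans (⟪⟫-eliminate A r i (x ∘ suc)) (x-x≈0 (begin
        A r zero *ₗ ⟪ A i ∘ suc , x ∘ suc ⟫     ≈⟨ *ₗ-congˡ (tail≈ i) ⟩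
        A r zero *ₗ -ᴹ (A i zero *ₗ x zero)     ≈⟨ *ₗ-negʳ _ _ ⟩
        -ᴹ (A r zero *ₗ A i zero *ₗ x zero)     ≈⟨ -ᴹ‿cong (*ₗ-comm _ _ _) ⟩
        -ᴹ (A i zero *ₗ A r zero *ₗ x zero)     ≈⟨ *ₗ-negʳ _ _ ⟨
        A i zero *ₗ -ᴹ (A r zero *ₗ x zero)     ≈⟨ *ₗ-congˡ (tail≈ r) ⟨
        A i zero *ₗ ⟪ A r ∘ suc , x ∘ suc ⟫     ∎))
    x₀≈0 : x zero ≈ᴹ 0ᴹ
    x₀≈0 = *ₗ-cancel Ar≢0 (begin
      A r zero *ₗ x zero                                      ≈⟨ +ᴹ-identityʳ _ ⟨
      A r zero *ₗ x zero +ᴹ 0ᴹ                                ≈⟨ +ᴹ-congˡ (⟪⟫-zeroʳ (A r ∘ suc) x′≈0) ⟨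
      A r zero *ₗ x zero +ᴹ ⟪ A r ∘ suc , x ∘ suc ⟫           ≈⟨ Ax≈0 r ⟩
      0ᴹ                                                      ∎)

ℚ-module : LeftModule ℚ.+-*-ring 0ℓ 0ℓ
ℚ-module = TensorUnit.leftModule

module Lℚ = Linear ℚ-module

Searchable : Set → Set₁
Searchable I = ∀ {P : I → Set} → (∀ i → Dec (P i)) → Dec (∃ P)

searchFin : ∀ {n} → Searchable (Fin n)
searchFin = Fin.any?

search× : ∀ {I J} → Searchable I → Searchable J → Searchable (I × J)
search× sI sJ P? = map′ (λ (i , j , p) → (i , j) , p) (λ ((i , j) , p) → i , j , p)
  (sI (λ i → sJ (λ j → P? (i , j))))

search⊎ : ∀ {I J} → Searchable I → Searchable J → Searchable (I ⊎ J)
search⊎ sI sJ P? = map′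
  [ (λ (i , p) → inj₁ i , p) , (λ (j , p) → inj₂ j , p) ]′
  (λ { (inj₁ i , p) → inj₁ (i , p) ; (inj₂ j , p) → inj₂ (j , p) })
  (sI (P? ∘ inj₁) ⊎-dec sJ (P? ∘ inj₂))

trivialKernel⇒eliminable : ∀ {I K} → Searchable I → (A : Matrix I K) →
                           Lℚ.TrivialKernel A → Eliminable A
trivialKernel⇒eliminable {K = zero}  s A triv = done
trivialKernel⇒eliminable {K = suc K} s A triv with s (λ i → ¬? (A i zero ℚ.≟ 0ℚ))
-- Without a pivot the first unit vector lies in the kernel.
... | no none = contradiction (triv e₀ in-kernel zero) (λ ())
  where
  e₀ : Fin (suc K) → ℚ
  e₀ zero    = 1ℚ
  e₀ (suc _) = 0ℚ
  in-kernel : Lℚ.Kernel A e₀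
  in-kernel i = cong₂ ℚ._+_
    (cong (ℚ._* 1ℚ) (decidable-stable (A i zero ℚ.≟ 0ℚ) (λ h → none (i , h))))
    (Lℚ.⟪⟫-zeroʳ (A i ∘ suc) (λ _ → refl))
... | yes (r , Ar≢0) = pivot r Ar≢0 (trivialKernel⇒eliminable s (eliminate A r) triv′)
  where
  triv′ : Lℚ.TrivialKernel (eliminate A r)
  triv′ x′ h j = triv x in-kernel (suc j)
    where
    x : Fin (suc K) → ℚ
    -- The value that makes the pivot row vanish.
    x zero    = ℚ.- (proj₁ (recip _ Ar≢0) ℚ.* Lℚ.⟪ A r ∘ suc , x′ ⟫)
    x (suc j) = x′ j
    in-kernel : Lℚ.Kernel A x
    in-kernel i = Lℚ.*ₗ-cancel Ar≢0 (begin
      a ℚ.* (b ℚ.* ℚ.- (1/a ℚ.* c) ℚ.+ d)          ≡⟨ solve 5 (λ a b 1/a c d →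
                                                         a :* (b :* :- (1/a :* c) :+ d)
                                                       := a :* d :- (1/a :* a) :* (b :* c)) refl a b 1/a c d ⟩
      a ℚ.* d ℚ.- (1/a ℚ.* a) ℚ.* (b ℚ.* c)        ≡⟨ cong (λ z → a ℚ.* d ℚ.- z ℚ.* (b ℚ.* c)) (proj₂ (recip _ Ar≢0)) ⟩
      a ℚ.* d ℚ.- 1ℚ ℚ.* (b ℚ.* c)                 ≡⟨ cong (λ z → a ℚ.* d ℚ.- z) (ℚ.*-identityˡ _) ⟩
      a ℚ.* d ℚ.- b ℚ.* c                          ≡⟨ Lℚ.⟪⟫-eliminate A r i x′ ⟨
      Lℚ.⟪ eliminate A r i , x′ ⟫                  ≡⟨ h i ⟩
      0ℚ                                           ∎)
      where
      open ≡-Reasoning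
      open +-*-Solver
      a b c d 1/a : ℚ
      a = A r zero
      b = A i zero
      c = Lℚ.⟪ A r ∘ suc , x′ ⟫
      d = Lℚ.⟪ A i ∘ suc , x′ ⟫
      1/a = proj₁ (recip _ Ar≢0)

-- Polynomial families of matrices and generic points

ι : ℕ → ℚ
ι zero    = 0ℚ
ι (suc t) = 1ℚ ℚ.+ ι t

0≤ι : ∀ t → 0ℚ ℚ.≤ ι t
0≤ι zero    = ℚ.≤-refl
0≤ι (suc t) = ℚ.+-mono-≤ {0ℚ} {1ℚ} (ℚ.<⇒≤ (ℚ.positive⁻¹ 1ℚ)) (0≤ι t)

ι-mono : ∀ {s t} → s ≤ t → ι s ℚ.≤ ι t
ι-mono {t = t} z≤n = 0≤ι t
ι-mono (s≤s s≤t)   = ℚ.+-monoʳ-≤ 1ℚ (ι-mono s≤t)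

ι≡ : ∀ t → ι t ≡ ℚ.fromℚᵘ (ℚᵘ.mkℚᵘ (+ t) 0)
ι≡ zero    = refl
ι≡ (suc t) = trans (cong (1ℚ ℚ.+_) (ι≡ t)) (ℚ.toℚᵘ-injective
  (ℚᵘ.≃-trans (ℚ.toℚᵘ-homo-+ 1ℚ q)
  (ℚᵘ.≃-trans (ℚᵘ.+-congʳ ℚᵘ.1ℚᵘ (ℚ.toℚᵘ-fromℚᵘ (ℚᵘ.mkℚᵘ (+ t) 0)))
  (ℚᵘ.≃-trans (ℚᵘ.*≡* (cong (ℤ._* + 1) (cong (λ z → + 1 ℤ.+ z) (ℤ.*-identityʳ (+ t)))))
  (ℚᵘ.≃-sym (ℚ.toℚᵘ-fromℚᵘ (ℚᵘ.mkℚᵘ (+ suc t) 0)))))))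
  where q = ℚ.fromℚᵘ (ℚᵘ.mkℚᵘ (+ t) 0)

archimedean : ∀ q → ∃[ N ] q ℚ.≤ ι N
archimedean q@record{} = N , subst (q ℚ.≤_) (sym (ι≡ N)) (ℚ.toℚᵘ-cancel-≤
  (ℚᵘ.≤-trans (ℚᵘ.*≤* bound) (ℚᵘ.≤-reflexive (ℚᵘ.≃-sym (ℚ.toℚᵘ-fromℚᵘ (ℚᵘ.mkℚᵘ (+ N) 0))))))
  where
  N = ℤ.∣ ℚ.↥ q ∣
  bound : ℚ.↥ q ℤ.* + 1 ℤ.≤ + N ℤ.* ℚ.↧ q
  bound = ℤ.≤-trans (ℤ.≤-reflexive (ℤ.*-identityʳ (ℚ.↥ q)))
    (ℤ.≤-trans (i≤∣i∣ (ℚ.↥ q)) (subst (+ N ℤ.≤_) (ℤ.pos-* N (ℚ.↧ₙ q)) (ℤ.+≤+ (ℕ.m≤m*n N (ℚ.↧ₙ q)))))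
    where
    i≤∣i∣ : ∀ i → i ℤ.≤ + ℤ.∣ i ∣
    i≤∣i∣ (+ n)        = ℤ.≤-refl
    i≤∣i∣ (ℤ.-[1+ n ]) = ℤ.-≤+

Eventually : (ℕ → Set) → Set
Eventually P = ∃[ T ] (∀ t → T ≤ t → P t)

eventually-× : ∀ {P Q} → Eventually P → Eventually Q → Eventually (λ t → P t × Q t)
eventually-× (S , p) (T , q) = S ⊔ T , λ t h →
  p t (ℕ.m⊔n≤o⇒m≤o S T h) , q t (ℕ.m⊔n≤o⇒n≤o S T h)

eventually-map : ∀ {P Q : ℕ → Set} → (∀ t → P t → Q t) → Eventually P → Eventually Q
eventually-map f (T , p) = T , λ t h → f t (p t h)

eval : List ℚ → ℕ → ℚ
eval []       t = 0ℚ
eval (a ∷ as) t = a ℚ.+ ι t ℚ.* eval as t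

Polynomial : (ℕ → ℚ) → Set
Polynomial f = ∃[ as ] (∀ t → f t ≡ eval as t)

private module Coefficients where
  open +-*-Solver

  add : List ℚ → List ℚ → List ℚ
  add []       bs       = bs
  add (a ∷ as) []       = a ∷ as
  add (a ∷ as) (b ∷ bs) = a ℚ.+ b ∷ add as bs

  scale : ℚ → List ℚ → List ℚ
  scale c []       = []
  scale c (a ∷ as) = c ℚ.* a ∷ scale c as

  mul : List ℚ → List ℚ → List ℚ
  mul []       bs = []
  mul (a ∷ as) bs = add (scale a bs) (0ℚ ∷ mul as bs)

  eval-add : ∀ as bs t → eval (add as bs) t ≡ eval as t ℚ.+ eval bs t
  eval-add []       bs       t = sym (ℚ.+-identityˡ _)
  eval-add (a ∷ as) []       t = sym (ℚ.+-identityʳ _)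
  eval-add (a ∷ as) (b ∷ bs) t = trans
    (cong (λ z → a ℚ.+ b ℚ.+ ι t ℚ.* z) (eval-add as bs t))
    (solve 5 (λ a b t x y → a :+ b :+ t :* (x :+ y) := (a :+ t :* x) :+ (b :+ t :* y))
      refl a b (ι t) (eval as t) (eval bs t))

  eval-scale : ∀ c as t → eval (scale c as) t ≡ c ℚ.* eval as t
  eval-scale c []       t = sym (ℚ.*-zeroʳ c)
  eval-scale c (a ∷ as) t = trans
    (cong (λ z → c ℚ.* a ℚ.+ ι t ℚ.* z) (eval-scale c as t))
    (solve 4 (λ c a t x → c :* a :+ t :* (c :* x) := c :* (a :+ t :* x))
      refl c a (ι t) (eval as t))

  eval-mul : ∀ as bs t → eval (mul as bs) t ≡ eval as t ℚ.* eval bs t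
  eval-mul []       bs t = sym (ℚ.*-zeroˡ (eval bs t))
  eval-mul (a ∷ as) bs t = trans (eval-add (scale a bs) (0ℚ ∷ mul as bs) t) (trans
    (cong₂ (λ y z → y ℚ.+ (0ℚ ℚ.+ ι t ℚ.* z)) (eval-scale a bs t) (eval-mul as bs t))
    (solve 4 (λ a t x y → a :* y :+ (con 0ℚ :+ t :* (x :* y)) := (a :+ t :* x) :* y)
      refl a (ι t) (eval as t) (eval bs t)))

open Coefficients

polynomial-const : ∀ c → Polynomial (λ _ → c)
polynomial-const c = c ∷ [] , λ t →
  sym (trans (cong (c ℚ.+_) (ℚ.*-zeroʳ (ι t))) (ℚ.+-identityʳ c))

polynomial-+ : ∀ {f g} → Polynomial f → Polynomial g → Polynomial (λ t → f t ℚ.+ g t)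
polynomial-+ (as , f≡) (bs , g≡) = add as bs , λ t →
  trans (cong₂ ℚ._+_ (f≡ t) (g≡ t)) (sym (eval-add as bs t))

polynomial-* : ∀ {f g} → Polynomial f → Polynomial g → Polynomial (λ t → f t ℚ.* g t)
polynomial-* (as , f≡) (bs , g≡) = mul as bs , λ t →
  trans (cong₂ ℚ._*_ (f≡ t) (g≡ t)) (sym (eval-mul as bs t))

polynomial-neg : ∀ {f} → Polynomial f → Polynomial (λ t → ℚ.- f t)
polynomial-neg (as , f≡) = scale (ℚ.- 1ℚ) as , λ t →
  trans (cong ℚ.-_ (f≡ t)) (trans
    (solve 1 (λ x → :- x := :- con 1ℚ :* x) refl (eval as t))
    (sym (eval-scale (ℚ.- 1ℚ) as t)))
  where open +-*-Solver

polynomial-minus : ∀ {f g} → Polynomial f → Polynomial g → Polynomial (λ t → f t ℚ.- g t)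
polynomial-minus pf pg = polynomial-+ pf (polynomial-neg pg)

polynomial-line : ∀ a b → Polynomial (λ t → a ℚ.+ ι t ℚ.* b)
polynomial-line a b = a ∷ b ∷ [] , λ t →
  solve 3 (λ a b t → a :+ t :* b := a :+ t :* (b :+ t :* con 0ℚ)) refl a b (ι t)
  where open +-*-Solver

polynomial-if : ∀ b {f g} → Polynomial f → Polynomial g →
                Polynomial (λ t → if b then f t else g t)
polynomial-if true  pf pg = pf
polynomial-if false pf pg = pg

-- A lower bound, unlike mere nonvanishing, passes through Horner's scheme: once the tail has size
-- at least ε, the value `a + t * tail` has size at least 1 for all t beyond `(1 + |a|) / ε`.
bounded-away : ∀ as → (∀ t → eval as t ≡ 0ℚ) ⊎
  (∃[ ε ] 0ℚ ℚ.< ε × Eventually (λ t → ε ℚ.≤ ℚ.∣ eval as t ∣))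
bounded-away []       = inj₁ (λ _ → refl)
bounded-away (a ∷ as) with bounded-away as
... | inj₁ as≡0 with a ℚ.≟ 0ℚ
...   | yes a≡0 = inj₁ λ t → trans (cong₂ (λ y z → y ℚ.+ ι t ℚ.* z) a≡0 (as≡0 t))
                   (trans (ℚ.+-identityˡ _) (ℚ.*-zeroʳ (ι t)))
...   | no  a≢0 = inj₂ (ℚ.∣ a ∣ , ℚ.≰⇒> (λ ∣a∣≤0 →
                     a≢0 (ℚ.∣p∣≡0⇒p≡0 a (ℚ.≤-antisym ∣a∣≤0 (ℚ.0≤∣p∣ a)))) ,
                   0 , λ t _ → ℚ.≤-reflexive (cong ℚ.∣_∣ (sym (trans
                     (cong (λ z → a ℚ.+ ι t ℚ.* z) (as≡0 t))
                     (trans (cong (a ℚ.+_) (ℚ.*-zeroʳ (ι t))) (ℚ.+-identityʳ a))))))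
bounded-away (a ∷ as) | inj₂ (ε , 0<ε , T , h) =
  inj₂ (1ℚ , ℚ.positive⁻¹ 1ℚ , T ⊔ N , λ t T⊔N≤t →
    let e = eval as t in
    ≤-cancelʳ ℚ.∣ a ∣ (begin
      1ℚ ℚ.+ ℚ.∣ a ∣                             ≡⟨ ℚ.*-identityʳ _ ⟨
      (1ℚ ℚ.+ ℚ.∣ a ∣) ℚ.* 1ℚ                    ≡⟨ cong ((1ℚ ℚ.+ ℚ.∣ a ∣) ℚ.*_) 1/ε*ε ⟨
      (1ℚ ℚ.+ ℚ.∣ a ∣) ℚ.* (1/ε ℚ.* ε)           ≡⟨ ℚ.*-assoc (1ℚ ℚ.+ ℚ.∣ a ∣) 1/ε ε ⟨
      (1ℚ ℚ.+ ℚ.∣ a ∣) ℚ.* 1/ε ℚ.* ε             ≤⟨ ℚ.*-monoʳ-≤-nonNeg ε N≥ ⟩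
      ι N ℚ.* ε                                  ≤⟨ ℚ.*-monoʳ-≤-nonNeg ε (ι-mono (ℕ.m⊔n≤o⇒n≤o T N T⊔N≤t)) ⟩
      ι t ℚ.* ε                                  ≤⟨ ℚ.*-monoˡ-≤-nonNeg (ι t) {{ℚ.nonNegative (0≤ι t)}} (h t (ℕ.m⊔n≤o⇒m≤o T N T⊔N≤t)) ⟩
      ι t ℚ.* ℚ.∣ e ∣                            ≡⟨ cong (ℚ._* ℚ.∣ e ∣) (ℚ.0≤p⇒∣p∣≡p (0≤ι t)) ⟨
      ℚ.∣ ι t ∣ ℚ.* ℚ.∣ e ∣                      ≡⟨ ℚ.∣p*q∣≡∣p∣*∣q∣ (ι t) e ⟨
      ℚ.∣ ι t ℚ.* e ∣                            ≡⟨ cong ℚ.∣_∣ (solve 2 (λ a b → b := (a :+ b) :+ :- a) refl a (ι t ℚ.* e)) ⟩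
      ℚ.∣ (a ℚ.+ ι t ℚ.* e) ℚ.+ ℚ.- a ∣          ≤⟨ ℚ.∣p+q∣≤∣p∣+∣q∣ (a ℚ.+ ι t ℚ.* e) (ℚ.- a) ⟩
      ℚ.∣ a ℚ.+ ι t ℚ.* e ∣ ℚ.+ ℚ.∣ ℚ.- a ∣      ≡⟨ cong (ℚ.∣ a ℚ.+ ι t ℚ.* e ∣ ℚ.+_) (ℚ.∣-p∣≡∣p∣ a) ⟩
      ℚ.∣ a ℚ.+ ι t ℚ.* e ∣ ℚ.+ ℚ.∣ a ∣          ∎))
  where
  open ℚ.≤-Reasoning
  open +-*-Solver
  instance
    ε-nonNeg = ℚ.nonNegative (ℚ.<⇒≤ 0<ε)
  1/ε = proj₁ (recip ε (λ ε≡0 → ℚ.<-irrefl (sym ε≡0) 0<ε))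
  1/ε*ε = proj₂ (recip ε (λ ε≡0 → ℚ.<-irrefl (sym ε≡0) 0<ε))
  N = proj₁ (archimedean ((1ℚ ℚ.+ ℚ.∣ a ∣) ℚ.* 1/ε))
  N≥ = proj₂ (archimedean ((1ℚ ℚ.+ ℚ.∣ a ∣) ℚ.* 1/ε))
  ≤-cancelʳ : ∀ {p q} r → p ℚ.+ r ℚ.≤ q ℚ.+ r → p ℚ.≤ q
  ≤-cancelʳ {p} {q} r h = begin
    p                      ≡⟨ solve 2 (λ p r → p := p :+ r :+ :- r) refl p r ⟩
    p ℚ.+ r ℚ.+ ℚ.- r      ≤⟨ ℚ.+-monoˡ-≤ (ℚ.- r) h ⟩
    q ℚ.+ r ℚ.+ ℚ.- r      ≡⟨ solve 2 (λ p r → p := p :+ r :+ :- r) refl q r ⟨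
    q                      ∎

polynomial-eventually-≢0 : ∀ {f} → Polynomial f → f 0 ≢ 0ℚ → Eventually (λ t → f t ≢ 0ℚ)
polynomial-eventually-≢0 (as , f≡) f0≢0 with bounded-away as
... | inj₁ as≡0 = contradiction (trans (f≡ 0) (as≡0 0)) f0≢0
... | inj₂ (ε , 0<ε , T , h) = T , λ t T≤t ft≡0 →
  ℚ.<-irrefl refl (ℚ.<-≤-trans 0<ε (subst (ε ℚ.≤_) (cong ℚ.∣_∣ (trans (sym (f≡ t)) ft≡0)) (h t T≤t)))

eliminable-eventually : ∀ {I K} (A : ℕ → Matrix I K) → (∀ i j → Polynomial (λ t → A t i j)) →
  Eliminable (A 0) → Eventually (λ t → Eliminable (A t))
eliminable-eventually A poly done = 0 , λ _ _ → done
eliminable-eventually A poly (pivot r Ar≢0 e) =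
  eventually-map (λ t (p , e) → pivot r p e) (eventually-×
    (polynomial-eventually-≢0 (poly r zero) Ar≢0)
    (eliminable-eventually (λ t → eliminate (A t) r)
      (λ i j → polynomial-minus (polynomial-* (poly r zero) (poly i (suc j)))
                            (polynomial-* (poly i zero) (poly r (suc j)))) e))

trivialKernel-eventually : ∀ {I K} → Searchable I → (A : ℕ → Matrix I K) →
  (∀ i j → Polynomial (λ t → A t i j)) →
  Lℚ.TrivialKernel (A 0) → Eventually (λ t → Lℚ.TrivialKernel (A t))
trivialKernel-eventually s A poly triv = eventually-map (λ t → Lℚ.eliminable⇒trivialKernel)
  (eliminable-eventually A poly (trivialKernel⇒eliminable s (A 0) triv))

Placement : ℕ → ℕ → Set
Placement n k = Fin n → Fin k → ℚ

_≐ₚ_ : ∀ {n k} → Placement n k → Placement n k → Set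
p ≐ₚ q = ∀ i a → p i a ≡ q i a

line : ∀ {n k} → Placement n k → Placement n k → ℕ → Placement n k
line p w t i a = p i a ℚ.+ ι t ℚ.* w i a

-- Stands in for a nonempty Zariski-open set and keeps only what intersections need: on every line
-- through a member of U, all large natural parameters stay in U.
record Generic {n k} (U : Placement n k → Set) : Set where
  field
    point : ∃ U
    resp  : ∀ {p q} → p ≐ₚ q → U p → U q
    open′ : ∀ p w → U p → Eventually (λ t → U (line p w t))

open Generic

-- The line through a point x of U and a point y of V, run from x in one
-- direction and from y in the other, is eventually in both.
generic-× : ∀ {n k} {U V : Placement n k → Set} → Generic U → Generic V → Generic (λ p → U p × V p)
generic-× {U = U} {V} gU gV = record
  { point = line x w (suc T) , hT (suc T) (ℕ.n≤1+n T) .proj₁ , resp gV shift (hT T ℕ.≤-refl .proj₂)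
  ; resp  = λ p≐q (u , v) → resp gU p≐q u , resp gV p≐q v
  ; open′ = λ p w (u , v) → eventually-× (open′ gU p w u) (open′ gV p w v)
  }
  where
  open +-*-Solver
  x = proj₁ (point gU)
  y = proj₁ (point gV)
  w : Placement _ _
  w i a = y i a ℚ.- x i a
  both = eventually-× (open′ gU x w (proj₂ (point gU))) (open′ gV y w (proj₂ (point gV)))
  T = proj₁ both
  hT = proj₂ both
  shift : line y w T ≐ₚ line x w (suc T)
  shift i a = solve 3 (λ x y t → y :+ t :* (y :- x) := x :+ (con 1ℚ :+ t) :* (y :- x))
    refl (x i a) (y i a) (ι T)

generic-⊤ : ∀ {n k} {U : Placement n k → Set} → (∀ p → U p) → Generic U
generic-⊤ u = record
  { point = (λ _ _ → 0ℚ) , u _ ; resp = λ _ _ → u _ ; open′ = λ _ _ _ → 0 , λ _ _ → u _ }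

generic-map : ∀ {n k} {U V : Placement n k → Set} → (∀ p → U p → V p) → (∀ p → V p → U p) →
              Generic U → Generic V
generic-map f g gU = record
  { point = _ , f _ (proj₂ (point gU))
  ; resp  = λ p≐q v → f _ (resp gU p≐q (g _ v))
  ; open′ = λ p w v → eventually-map (λ _ → f _) (open′ gU p w (g _ v))
  }

generic-Fin : ∀ {n k m} {U : Fin m → Placement n k → Set} → (∀ i → Generic (U i)) →
              Generic (λ p → ∀ i → U i p)
generic-Fin {m = zero}  gU = generic-⊤ (λ _ ())
generic-Fin {m = suc m} gU = generic-map
  (λ p (u , us) → λ { zero → u ; (suc i) → us i })
  (λ p us → us zero , us ∘ suc)
  (generic-× (gU zero) (generic-Fin (gU ∘ suc)))

generic-Vec : ∀ {n k m} l {U : Vec (Fin m) l → Placement n k → Set} → (∀ v → Generic (U v)) →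
              Generic (λ p → ∀ v → U v p)
generic-Vec zero    gU = generic-map (λ p u → λ { [] → u }) (λ p u → u []) (gU [])
generic-Vec (suc l) gU = generic-map (λ p u → λ { (x ∷ v) → u x v }) (λ p u x v → u (x ∷ v))
  (generic-Fin (λ x → generic-Vec l (λ v → gU (x ∷ v))))

generic-kernel : ∀ {n k I K} → Searchable I → (A : Placement n k → Matrix I K) →
  (∀ {p q} → p ≐ₚ q → ∀ i j → A p i j ≡ A q i j) →
  (∀ p w i j → Polynomial (λ t → A (line p w t) i j)) →
  (∃[ p ] Lℚ.TrivialKernel (A p)) → Generic (λ p → Lℚ.TrivialKernel (A p))
generic-kernel {n} {k} s A A-resp poly pt = record
  { point = pt
  ; resp  = resp′
  ; open′ = λ p w h → trivialKernel-eventually s (λ t → A (line p w t)) (poly p w)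
      (resp′ (λ i a → sym (trans (cong (p i a ℚ.+_) (ℚ.*-zeroˡ (w i a))) (ℚ.+-identityʳ (p i a)))) h)
  }
  where
  resp′ : ∀ {p q} → p ≐ₚ q → Lℚ.TrivialKernel (A p) → Lℚ.TrivialKernel (A q)
  resp′ p≐q h x ker = h x (λ i → trans (Lℚ.⟪⟫-cong (A-resp p≐q i) (λ _ → refl)) (ker i))

-- Points in general position

δ : ∀ {n} → Fin n → Fin n → ℚ
δ i j = if does (i Fin.≟ j) then 1ℚ else 0ℚ

δ-≡ : ∀ {n} {i j : Fin n} → i ≡ j → δ i j ≡ 1ℚ
δ-≡ {i = i} {j} i≡j = cong (if_then 1ℚ else 0ℚ) (dec-true (i Fin.≟ j) i≡j)

δ-≢ : ∀ {n} {i j : Fin n} → i ≢ j → δ i j ≡ 0ℚ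
δ-≢ {i = i} {j} i≢j = cong (if_then 1ℚ else 0ℚ) (dec-false (i Fin.≟ j) i≢j)

δ-cong : ∀ {m n} {i j : Fin m} {i′ j′ : Fin n} → (i ≡ j → i′ ≡ j′) → (i′ ≡ j′ → i ≡ j) → δ i j ≡ δ i′ j′
δ-cong {i = i} {j} f g with i Fin.≟ j
... | yes i≡j = sym (δ-≡ (f i≡j))
... | no  i≢j = sym (δ-≢ (i≢j ∘ g))

Injectiveᵛ : ∀ {n k} → Vec (Fin n) k → Set
Injectiveᵛ v = ∀ f g → lookup v f ≡ lookup v g → f ≡ g

injectiveᵛ? : ∀ {n k} (v : Vec (Fin n) k) → Dec (Injectiveᵛ v)
injectiveᵛ? v =
  Fin.all? (λ f → Fin.all? (λ g → (lookup v f Fin.≟ lookup v g) →-dec (f Fin.≟ g)))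

_∉ᵛ_ : ∀ {n k} → Fin n → Vec (Fin n) k → Set
i ∉ᵛ v = ∀ f → i ≢ lookup v f

∉ᵛ? : ∀ {n k} i (v : Vec (Fin n) k) → Dec (i ∉ᵛ v)
∉ᵛ? i v = Fin.all? (λ f → ¬? (i Fin.≟ lookup v f))

module LinearDelta (M : LeftModule ℚ.+-*-ring 0ℓ 0ℓ) where
  open Linear M

  ⟪δ⟫ : ∀ {K} i (x : Fin K → Carrierᴹ) → ⟪ δ i , x ⟫ ≈ᴹ x i
  ⟪δ⟫ {suc K} zero x = begin
    1ℚ *ₗ x zero +ᴹ ⟪ (λ _ → 0ℚ) , x ∘ suc ⟫  ≈⟨ +ᴹ-cong (*ₗ-identityˡ _) (sum-zero (λ j → *ₗ-zeroˡ (x (suc j)))) ⟩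
    x zero +ᴹ 0ᴹ                              ≈⟨ +ᴹ-identityʳ _ ⟩
    x zero                                    ∎
  ⟪δ⟫ {suc K} (suc i) x = begin
    0ℚ *ₗ x zero +ᴹ ⟪ δ (suc i) ∘ suc , x ∘ suc ⟫  ≈⟨ +ᴹ-cong (*ₗ-zeroˡ _) (⟪⟫-cong {x = x ∘ suc} (λ j → δ-cong {i = suc i} {suc j} Fin.suc-injective (cong suc)) (λ _ → ≈ᴹ-refl)) ⟩
    0ᴹ +ᴹ ⟪ δ i , x ∘ suc ⟫                        ≈⟨ +ᴹ-identityˡ _ ⟩
    ⟪ δ i , x ∘ suc ⟫                              ≈⟨ ⟪δ⟫ i (x ∘ suc) ⟩
    x (suc i)                                      ∎

trivialKernel-δ : ∀ {K} (A : Matrix (Fin K) K) → (∀ i j → A i j ≡ δ i j) → Lℚ.TrivialKernel A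
trivialKernel-δ A A≡δ x ker j = trans (sym (LinearDelta.⟪δ⟫ ℚ-module j x))
  (trans (Lℚ.⟪⟫-cong (λ i → sym (A≡δ j i)) (λ _ → refl)) (ker j))

-- Any k points are linearly independent, which says that they and the
-- origin are in general position; the origin serves as a spare point.
record GeneralPosition {n k} (p : Placement n k) : Set where
  field
    independent : ∀ (v : Vec (Fin n) k) → Injectiveᵛ v →
      Lℚ.TrivialKernel (λ f → p (lookup v f))
    affinely-independent : ∀ (v : Vec (Fin n) k) → Injectiveᵛ v → ∀ i → i ∉ᵛ v →
      Lℚ.TrivialKernel (λ f a → p i a ℚ.- p (lookup v f) a)

generic-→ : ∀ {n k} {H : Set} {U : Placement n k → Set} → Dec H → (H → Generic U) → Generic (λ p → H → U p)
generic-→ (yes h) g = generic-map (λ _ u _ → u) (λ _ u → u h) (g h)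
generic-→ (no ¬h) g = generic-⊤ (λ _ h → contradiction h ¬h)

-- The conditions are finitely many, so each needs only a witness of its own: the chosen points go
-- to the unit vectors and all others to the origin. For affine independence the unit vectors are
-- negated, which makes the differences from the point at the origin equal to the unit vectors.
generalPosition-generic : ∀ {n k} → Generic (GeneralPosition {n} {k})
generalPosition-generic {n} {k} = generic-map
  (λ p (g , h) → record { independent = g ; affinely-independent = h })
  (λ p gp → GeneralPosition.independent gp , GeneralPosition.affinely-independent gp)
  (generic-×
    (generic-Vec k λ v → generic-→ (injectiveᵛ? v) λ inj → generic-kernel searchFin _
      (λ p≐q f a → p≐q _ a)
      (λ p w f a → polynomial-line (p _ a) (w _ a))
      (δᵥ v , trivialKernel-δ _ (λ f a → δᵥ-lookup v inj f a)))
    (generic-Vec k λ v → generic-→ (injectiveᵛ? v) λ inj → generic-Fin λ i →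
      generic-→ (∉ᵛ? i v) λ i∉v → generic-kernel searchFin _
        (λ p≐q f a → cong₂ ℚ._-_ (p≐q _ a) (p≐q _ a))
        (λ p w f a → polynomial-minus (polynomial-line (p _ a) (w _ a)) (polynomial-line (p _ a) (w _ a)))
        ((λ x a → ℚ.- δᵥ v x a) , trivialKernel-δ _ λ f a → trans
          (cong₂ (λ y z → ℚ.- y ℚ.- ℚ.- z) (δ-≢ (i∉v a ∘ sym)) (δᵥ-lookup v inj f a))
          (trans (ℚ.+-identityˡ _) (solve 1 (λ x → :- :- x := x) refl (δ f a))))))
  where
  open +-*-Solver
  δᵥ : Vec (Fin n) k → Placement n k
  δᵥ v x a = δ (lookup v a) x
  δᵥ-lookup : ∀ v → Injectiveᵛ v → ∀ f a → δᵥ v (lookup v f) a ≡ δ f a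
  δᵥ-lookup v inj f a = δ-cong (λ e → sym (inj a f e)) (cong (lookup v) ∘ sym)

-- Infinitesimal motions with velocities in a ℚ-module

-- Elimination turns the pivot row into zero, so deleting it leaves a smaller square matrix whose
-- kernel is still trivial; the remaining unknown is read off the pivot row.
solvable : ∀ {K} (A : Matrix (Fin K) K) → Lℚ.TrivialKernel A →
           (b : Fin K → ℚ) → Σ (Fin K → ℚ) λ z → ∀ f → Lℚ.⟪ A f , z ⟫ ≡ b f
solvable {zero}  A triv b = (λ ()) , λ ()
solvable {suc K} A triv b with trivialKernel⇒eliminable searchFin A triv
... | pivot r Ar≢0 e = z , λ i → Lℚ.x-y≈0⇒x≈y (Lℚ.*ₗ-cancel Ar≢0 (row i))
  where
  open +-*-Solver
  reduced : Matrix (Fin K) K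
  reduced i = eliminate A r (punchIn r i)
  reduced-triv : Lℚ.TrivialKernel reduced
  reduced-triv x ker = Lℚ.eliminable⇒trivialKernel e x λ i → case-r i (r Fin.≟ i)
    where
    case-r : ∀ i → Dec (r ≡ i) → Lℚ.⟪ eliminate A r i , x ⟫ ≡ 0ℚ
    case-r i (yes refl) = trans (Lℚ.⟪⟫-eliminate A r r x) (ℚ.+-inverseʳ (A r zero ℚ.* Lℚ.⟪ A r ∘ suc , x ⟫))
    case-r i (no r≢i)   = subst (λ i → Lℚ.⟪ eliminate A r i , x ⟫ ≡ 0ℚ) (Fin.punchIn-punchOut r≢i) (ker (punchOut r≢i))
  a = A r zero
  1/a = proj₁ (recip a Ar≢0)
  IH = solvable reduced reduced-triv (λ i → a ℚ.* b (punchIn r i) ℚ.- A (punchIn r i) zero ℚ.* b r)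
  z′ = proj₁ IH
  c = Lℚ.⟪ A r ∘ suc , z′ ⟫
  z : Fin (suc K) → ℚ
  z zero    = 1/a ℚ.* (b r ℚ.- c)
  z (suc j) = z′ j
  elim-eq : ∀ i → Lℚ.⟪ eliminate A r i , z′ ⟫ ≡ a ℚ.* b i ℚ.- A i zero ℚ.* b r
  elim-eq i with r Fin.≟ i
  ... | yes refl = trans (Lℚ.⟪⟫-eliminate A r r z′) (trans (ℚ.+-inverseʳ (a ℚ.* c)) (sym (ℚ.+-inverseʳ (a ℚ.* b r))))
  ... | no r≢i   = subst (λ i → Lℚ.⟪ eliminate A r i , z′ ⟫ ≡ a ℚ.* b i ℚ.- A i zero ℚ.* b r)
                         (Fin.punchIn-punchOut r≢i) (proj₂ IH (punchOut r≢i))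
  row : ∀ i → a ℚ.* (Lℚ.⟪ A i , z ⟫ ℚ.- b i) ≡ 0ℚ
  row i = begin
    a ℚ.* (A i zero ℚ.* (1/a ℚ.* (b r ℚ.- c)) ℚ.+ d ℚ.- b i)
      ≡⟨ solve 7 (λ a e 1/a f c d g → a :* (e :* (1/a :* (f :- c)) :+ d :- g)
                := (1/a :* a) :* (e :* (f :- c)) :+ a :* d :- a :* g) refl a (A i zero) 1/a (b r) c d (b i) ⟩
    (1/a ℚ.* a) ℚ.* (A i zero ℚ.* (b r ℚ.- c)) ℚ.+ a ℚ.* d ℚ.- a ℚ.* b i
      ≡⟨ cong (λ u → u ℚ.* (A i zero ℚ.* (b r ℚ.- c)) ℚ.+ a ℚ.* d ℚ.- a ℚ.* b i) (proj₂ (recip a Ar≢0)) ⟩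
    1ℚ ℚ.* (A i zero ℚ.* (b r ℚ.- c)) ℚ.+ a ℚ.* d ℚ.- a ℚ.* b i
      ≡⟨ solve 6 (λ a e f c d g → con 1ℚ :* (e :* (f :- c)) :+ a :* d :- a :* g
                := (a :* d :- e :* c) :- (a :* g :- e :* f)) refl a (A i zero) (b r) c d (b i) ⟩
    (a ℚ.* d ℚ.- A i zero ℚ.* c) ℚ.- (a ℚ.* b i ℚ.- A i zero ℚ.* b r)
      ≡⟨ cong (ℚ._- (a ℚ.* b i ℚ.- A i zero ℚ.* b r)) (trans (sym (Lℚ.⟪⟫-eliminate A r i z′)) (elim-eq i)) ⟩
    (a ℚ.* b i ℚ.- A i zero ℚ.* b r) ℚ.- (a ℚ.* b i ℚ.- A i zero ℚ.* b r)
      ≡⟨ ℚ.+-inverseʳ (a ℚ.* b i ℚ.- A i zero ℚ.* b r) ⟩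
    0ℚ ∎
    where
    open ≡-Reasoning
    d = Lℚ.⟪ A i ∘ suc , z′ ⟫

module Bilinear (M : LeftModule ℚ.+-*-ring 0ℓ 0ℓ) where
  open Linear M

  ⟪⟫-exchange : ∀ {K L} (x : Fin K → ℚ) (y : Fin L → ℚ) (T : Fin K → Fin L → Carrierᴹ) →
    ⟪ x , (λ a → ⟪ y , T a ⟫) ⟫ ≈ᴹ ⟪ y , (λ b → ⟪ x , (λ a → T a b) ⟫) ⟫
  ⟪⟫-exchange {K} {L} x y T = begin
    sum (λ a → x a *ₗ sum (λ b → y b *ₗ T a b))   ≈⟨ sum-cong-≋ (λ a → *ₗ-sum (x a) (λ b → y b *ₗ T a b)) ⟩
    sum (λ a → sum (λ b → x a *ₗ y b *ₗ T a b))   ≈⟨ ∑-comm (λ a b → x a *ₗ y b *ₗ T a b) ⟩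
    sum (λ b → sum (λ a → x a *ₗ y b *ₗ T a b))   ≈⟨ sum-cong-≋ (λ b → ⟪⟫-*ʳ (y b) x (λ a → T a b)) ⟩
    sum (λ b → y b *ₗ sum (λ a → x a *ₗ T a b))   ∎

  ⟪⟫-assoc : ∀ {K L} (x : Fin K → ℚ) (T : Fin K → Fin L → ℚ) (c : Fin L → Carrierᴹ) →
    ⟪ x , (λ a → ⟪ T a , c ⟫) ⟫ ≈ᴹ ⟪ (λ f → Lℚ.⟪ x , (λ a → T a f) ⟫) , c ⟫
  ⟪⟫-assoc x T c = begin
    sum (λ a → x a *ₗ sum (λ f → T a f *ₗ c f))   ≈⟨ sum-cong-≋ (λ a → *ₗ-sum (x a) (λ f → T a f *ₗ c f)) ⟩
    sum (λ a → sum (λ f → x a *ₗ T a f *ₗ c f))   ≈⟨ ∑-comm (λ a f → x a *ₗ T a f *ₗ c f) ⟩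
    sum (λ f → sum (λ a → x a *ₗ T a f *ₗ c f))   ≈⟨ sum-cong-≋ (λ f → ≈ᴹ-trans
                                                       (sum-cong-≋ (λ a → ≈ᴹ-sym (*ₗ-assoc (x a) (T a f) (c f))))
                                                       (sum-*ₗ (λ a → x a ℚ.* T a f) (c f))) ⟩
    ⟪ (λ f → Lℚ.⟪ x , (λ a → T a f) ⟫) , c ⟫      ∎

  Skew : ∀ {k} → (Fin k → Fin k → Carrierᴹ) → Set
  Skew S = ∀ a b → S a b ≈ᴹ -ᴹ S b a

  skew-quadratic : ∀ {k} {S : Fin k → Fin k → Carrierᴹ} → Skew S → ∀ x →
                   ⟪ x , (λ a → ⟪ x , S a ⟫) ⟫ ≈ᴹ 0ᴹ
  skew-quadratic {S = S} skew x = x≈-x⇒x≈0 (begin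
    ⟪ x , (λ a → ⟪ x , S a ⟫) ⟫                    ≈⟨ ⟪⟫-exchange x x S ⟩
    ⟪ x , (λ b → ⟪ x , (λ a → S a b) ⟫) ⟫          ≈⟨ ⟪⟫-cong {a = x} (λ _ → refl) (λ b → ≈ᴹ-trans
                                                       (⟪⟫-cong {a = x} (λ _ → refl) (λ a → skew a b))
                                                       (⟪⟫-negʳ x (S b))) ⟩
    ⟪ x , (λ b → -ᴹ ⟪ x , S b ⟫) ⟫                 ≈⟨ ⟪⟫-negʳ x (λ b → ⟪ x , S b ⟫) ⟩
    -ᴹ ⟪ x , (λ a → ⟪ x , S a ⟫) ⟫                 ∎)

  module _ {K : ℕ} (X Y : Matrix (Fin K) K) where
    dual-left : (∀ f g → Lℚ.⟪ X f , Y g ⟫ ≡ δ f g) → ∀ g (c : Fin K → Carrierᴹ) →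
      ⟪ X g , (λ a → ⟪ (λ f → Y f a) , c ⟫) ⟫ ≈ᴹ c g
    dual-left XY g c = ≈ᴹ-trans (⟪⟫-assoc (X g) (λ a f → Y f a) c)
      (≈ᴹ-trans (⟪⟫-cong {x = c} (XY g) (λ _ → ≈ᴹ-refl)) (LinearDelta.⟪δ⟫ M g c))

    dual-right : (∀ a b → Lℚ.⟪ (λ f → Y f a) , (λ f → X f b) ⟫ ≡ δ a b) → ∀ a (z : Fin K → Carrierᴹ) →
      ⟪ (λ f → Y f a) , (λ f → ⟪ X f , z ⟫) ⟫ ≈ᴹ z a
    dual-right YX a z = ≈ᴹ-trans (⟪⟫-assoc (λ f → Y f a) X z)
      (≈ᴹ-trans (⟪⟫-cong {x = z} (YX a) (λ _ → ≈ᴹ-refl)) (LinearDelta.⟪δ⟫ M a z))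

δ-sym : ∀ {n} (i j : Fin n) → δ i j ≡ δ j i
δ-sym i j = δ-cong {i = i} {j} sym sym

-- Solving for each unit vector gives a right inverse Y of X. It is a left inverse as well, because
-- X(YX - 1) = 0 and X has trivial kernel.
dual-basis : ∀ {K} (X : Matrix (Fin K) K) → Lℚ.TrivialKernel X → Σ (Matrix (Fin K) K) λ Y →
  (∀ f g → Lℚ.⟪ X f , Y g ⟫ ≡ δ f g) × (∀ a b → Lℚ.⟪ (λ f → Y f a) , (λ f → X f b) ⟫ ≡ δ a b)
dual-basis {K} X triv = Y , XY , λ a b → Lℚ.x-y≈0⇒x≈y (triv (λ a → YX a b ℚ.- δ a b) (ker b) a)
  where
  Y : Matrix (Fin K) K
  Y g = proj₁ (solvable X triv (δ g))
  XY : ∀ f g → Lℚ.⟪ X f , Y g ⟫ ≡ δ f g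
  XY f g = trans (proj₂ (solvable X triv (δ g)) f) (δ-sym g f)
  YX : Fin K → Fin K → ℚ
  YX a b = Lℚ.⟪ (λ f → Y f a) , (λ f → X f b) ⟫
  ker : ∀ b → Lℚ.Kernel X (λ a → YX a b ℚ.- δ a b)
  ker b g = begin
    Lℚ.⟪ X g , (λ a → YX a b ℚ.- δ a b) ⟫                      ≡⟨ Lℚ.⟪⟫-minusʳ (X g) (λ a → YX a b) (λ a → δ a b) ⟩
    Lℚ.⟪ X g , (λ a → YX a b) ⟫ ℚ.- Lℚ.⟪ X g , (λ a → δ a b) ⟫  ≡⟨ cong₂ ℚ._-_ (Bilinear.dual-left ℚ-module X Y XY g (λ f → X f b))
         (trans (Lℚ.sum-cong-≋ (λ a → trans (ℚ.*-comm (X g a) _) (cong (ℚ._* X g a) (δ-sym a b)))) (LinearDelta.⟪δ⟫ ℚ-module b (X g))) ⟩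
    X g b ℚ.- X g b                                            ≡⟨ ℚ.+-inverseʳ (X g b) ⟩
    0ℚ                                                         ∎
    where open ≡-Reasoning

module Motions (M : LeftModule ℚ.+-*-ring 0ℓ 0ℓ) {n k : ℕ} where
  open Linear M
  open Bilinear M

  Velocities : Set
  Velocities = Fin n → Fin k → Carrierᴹ

  Preserves : Placement n k → Velocities → Fin n → Fin n → Set
  Preserves p m i j = ⟪ (λ a → p i a ℚ.- p j a) , (λ a → m i a -ᴹ m j a) ⟫ ≈ᴹ 0ᴹ

  Motion : (Fin n → Fin n → Set) → Subset n → Placement n k → Velocities → Set
  Motion E B p m = ∀ i j → i ∈ B → j ∈ B → E i j → Preserves p m i j

  affine : (Fin k → Fin k → Carrierᴹ) → (Fin k → Carrierᴹ) → Placement n k → Velocities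
  affine S t p i a = ⟪ p i , S a ⟫ +ᴹ t a

  TrivialOn : Subset n → Placement n k → Velocities → Set
  TrivialOn B p m = ∃[ S ] ∃[ t ] Skew S × (∀ i → i ∈ B → ∀ a → m i a ≈ᴹ affine S t p i a)

  RigidOn : (Fin n → Fin n → Set) → Subset n → Placement n k → Set
  RigidOn E B p = ∀ m → Motion E B p m → TrivialOn B p m

  PinnedAt : Vec (Fin n) k → Velocities → Set
  PinnedAt v m = ∀ f a → m (lookup v f) a ≈ᴹ 0ᴹ

  -- Pinning k vertices removes the trivial motions, and prescribing zero off B removes the vertices
  -- that do not matter. What remains is triviality of the kernel of one finite matrix.
  PinRigid : (Fin n → Fin n → Set) → Subset n → Vec (Fin n) k → Placement n k → Set
  PinRigid E B v p = ∀ m → Motion E B p m → PinnedAt v m →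
    (∀ i → i ∉ B → ∀ a → m i a ≈ᴹ 0ᴹ) → ∀ i a → m i a ≈ᴹ 0ᴹ

  preserves-cong : ∀ p {m m′} i j → (∀ a → m i a ≈ᴹ m′ i a) → (∀ a → m j a ≈ᴹ m′ j a) →
                   Preserves p m i j → Preserves p m′ i j
  preserves-cong p i j mi mj h = ≈ᴹ-trans (⟪⟫-cong {a = λ a → p i a ℚ.- p j a} (λ _ → refl)
    (λ a → +ᴹ-cong (≈ᴹ-sym (mi a)) (-ᴹ‿cong (≈ᴹ-sym (mj a))))) h

  -ᴹ-interchange : ∀ w x y z → (w -ᴹ x) -ᴹ (y -ᴹ z) ≈ᴹ (w -ᴹ y) -ᴹ (x -ᴹ z)
  -ᴹ-interchange w x y z = begin
    (w -ᴹ x) +ᴹ -ᴹ (y -ᴹ z)          ≈⟨ +ᴹ-congˡ (-ᴹ-+ᴹ-comm y (-ᴹ z)) ⟨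
    (w -ᴹ x) +ᴹ (-ᴹ y -ᴹ (-ᴹ z))     ≈⟨ +ᴹ-interchange w (-ᴹ x) (-ᴹ y) (-ᴹ (-ᴹ z)) ⟩
    (w -ᴹ y) +ᴹ (-ᴹ x -ᴹ (-ᴹ z))     ≈⟨ +ᴹ-congˡ (-ᴹ-+ᴹ-comm x (-ᴹ z)) ⟩
    (w -ᴹ y) -ᴹ (x -ᴹ z)             ∎

  preserves-minus : ∀ p m m′ i j → Preserves p m i j → Preserves p m′ i j →
                Preserves p (λ i a → m i a -ᴹ m′ i a) i j
  preserves-minus p m m′ i j h h′ = begin
    ⟪ x , (λ a → (m i a -ᴹ m′ i a) -ᴹ (m j a -ᴹ m′ j a)) ⟫
      ≈⟨ ⟪⟫-cong {a = x} (λ _ → refl) (λ a → -ᴹ-interchange _ _ _ _) ⟩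
    ⟪ x , (λ a → (m i a -ᴹ m j a) -ᴹ (m′ i a -ᴹ m′ j a)) ⟫
      ≈⟨ ⟪⟫-minusʳ x (λ a → m i a -ᴹ m j a) (λ a → m′ i a -ᴹ m′ j a) ⟩
    ⟪ x , (λ a → m i a -ᴹ m j a) ⟫ -ᴹ ⟪ x , (λ a → m′ i a -ᴹ m′ j a) ⟫
      ≈⟨ x-x≈0 (≈ᴹ-trans h (≈ᴹ-sym h′)) ⟩
    0ᴹ ∎
    where
    x : Fin k → ℚ
    x a = p i a ℚ.- p j a

  affine-preserves : ∀ {S} t p → Skew S → ∀ i j → Preserves p (affine S t p) i j
  affine-preserves {S} t p skew i j = begin
    ⟪ x , (λ a → (⟪ p i , S a ⟫ +ᴹ t a) -ᴹ (⟪ p j , S a ⟫ +ᴹ t a)) ⟫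
      ≈⟨ ⟪⟫-cong {a = x} (λ _ → refl) (λ a → begin
           (⟪ p i , S a ⟫ +ᴹ t a) -ᴹ (⟪ p j , S a ⟫ +ᴹ t a)     ≈⟨ +ᴹ-congˡ (-ᴹ-+ᴹ-comm _ _) ⟨
           (⟪ p i , S a ⟫ +ᴹ t a) +ᴹ (-ᴹ ⟪ p j , S a ⟫ -ᴹ t a)  ≈⟨ +ᴹ-interchange _ _ _ _ ⟩
           (⟪ p i , S a ⟫ -ᴹ ⟪ p j , S a ⟫) +ᴹ (t a -ᴹ t a)     ≈⟨ +ᴹ-congˡ (-ᴹ‿inverseʳ (t a)) ⟩
           (⟪ p i , S a ⟫ -ᴹ ⟪ p j , S a ⟫) +ᴹ 0ᴹ               ≈⟨ +ᴹ-identityʳ _ ⟩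
           ⟪ p i , S a ⟫ -ᴹ ⟪ p j , S a ⟫                       ≈⟨ ⟪⟫-minusˡ (p i) (p j) (S a) ⟨
           ⟪ x , S a ⟫                                          ∎) ⟩
    ⟪ x , (λ a → ⟪ x , S a ⟫) ⟫
      ≈⟨ skew-quadratic skew x ⟩
    0ᴹ ∎
    where
    x : Fin k → ℚ
    x a = p i a ℚ.- p j a

  -- The velocity t of the origin is determined by the distances to the k
  -- points; relative to it, a dual basis Y gives S = Σ_f (m_f - t) ⊗ Y_f.
  clique-affine : ∀ p (v : Vec (Fin n) k) → Lℚ.TrivialKernel (λ f → p (lookup v f)) → ∀ m →
    (∀ f g → Preserves p m (lookup v f) (lookup v g)) →
    ∃[ S ] ∃[ t ] Skew S × (∀ f a → m (lookup v f) a ≈ᴹ affine S t p (lookup v f) a)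
  clique-affine p v triv m pres = S , t , skew , λ f a → ≈ᴹ-sym (begin
      ⟪ X f , S a ⟫ +ᴹ t a         ≈⟨ +ᴹ-congʳ (dual-left X Y XY f (λ f → y f a)) ⟩
      (m (lookup v f) a -ᴹ t a) +ᴹ t a ≈⟨ +ᴹ-assoc _ _ _ ⟩
      m (lookup v f) a +ᴹ (-ᴹ t a +ᴹ t a) ≈⟨ +ᴹ-congˡ (-ᴹ‿inverseˡ (t a)) ⟩
      m (lookup v f) a +ᴹ 0ᴹ       ≈⟨ +ᴹ-identityʳ _ ⟩
      m (lookup v f) a             ∎)
    where
    X : Matrix (Fin k) k
    X f = p (lookup v f)
    Y = proj₁ (dual-basis X triv)
    XY = proj₁ (proj₂ (dual-basis X triv))
    YX = proj₂ (proj₂ (dual-basis X triv))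
    t : Fin k → Carrierᴹ
    t a = ⟪ (λ f → Y f a) , (λ f → ⟪ X f , m (lookup v f) ⟫) ⟫
    y : Fin k → Fin k → Carrierᴹ
    y f a = m (lookup v f) a -ᴹ t a
    W : Fin k → Fin k → Carrierᴹ
    W f g = ⟪ X f , y g ⟫
    S : Fin k → Fin k → Carrierᴹ
    S a b = ⟪ (λ f → Y f b) , (λ f → y f a) ⟫
    W-diag : ∀ f → W f f ≈ᴹ 0ᴹ
    W-diag f = ≈ᴹ-trans (⟪⟫-minusʳ (X f) (m (lookup v f)) t)
      (x-x≈0 (≈ᴹ-sym (dual-left X Y XY f (λ f → ⟪ X f , m (lookup v f) ⟫))))
    W-skew : ∀ f g → W f g ≈ᴹ -ᴹ W g f
    W-skew f g = inverse-unique (begin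
      W f g +ᴹ W g f                                     ≈⟨ -ᴹ-involutive _ ⟨
      -ᴹ (-ᴹ (W f g +ᴹ W g f))                           ≈⟨ -ᴹ‿cong (-ᴹ-+ᴹ-comm (W f g) (W g f)) ⟨
      -ᴹ (-ᴹ W f g -ᴹ W g f)                             ≈⟨ -ᴹ‿cong (+ᴹ-cong (+ᴹ-identityˡ _) (-ᴹ‿cong (≈ᴹ-trans (+ᴹ-congˡ -0ᴹ≈0ᴹ) (+ᴹ-identityʳ _)))) ⟨
      -ᴹ ((0ᴹ -ᴹ W f g) -ᴹ (W g f -ᴹ 0ᴹ))                ≈⟨ -ᴹ‿cong (+ᴹ-cong (+ᴹ-congʳ (W-diag f)) (-ᴹ‿cong (+ᴹ-congˡ (-ᴹ‿cong (W-diag g))))) ⟨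
      -ᴹ ((W f f -ᴹ W f g) -ᴹ (W g f -ᴹ W g g))          ≈⟨ -ᴹ‿cong (+ᴹ-cong (⟪⟫-minusʳ (X f) (y f) (y g)) (-ᴹ‿cong (⟪⟫-minusʳ (X g) (y f) (y g)))) ⟨
      -ᴹ (⟪ X f , (λ a → y f a -ᴹ y g a) ⟫ -ᴹ ⟪ X g , (λ a → y f a -ᴹ y g a) ⟫) ≈⟨ -ᴹ‿cong (⟪⟫-minusˡ (X f) (X g) (λ a → y f a -ᴹ y g a)) ⟨
      -ᴹ ⟪ (λ a → X f a ℚ.- X g a) , (λ a → y f a -ᴹ y g a) ⟫ ≈⟨ -ᴹ‿cong (⟪⟫-cong {a = λ a → X f a ℚ.- X g a} (λ _ → refl) (λ a → ≈ᴹ-trans (-ᴹ-interchange _ _ _ _) (≈ᴹ-trans (+ᴹ-congˡ (≈ᴹ-trans (-ᴹ‿cong (-ᴹ‿inverseʳ (t a))) -0ᴹ≈0ᴹ)) (+ᴹ-identityʳ _)))) ⟩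
      -ᴹ ⟪ (λ a → X f a ℚ.- X g a) , (λ a → m (lookup v f) a -ᴹ m (lookup v g) a) ⟫ ≈⟨ -ᴹ‿cong (pres f g) ⟩
      -ᴹ 0ᴹ                                              ≈⟨ -0ᴹ≈0ᴹ ⟩
      0ᴹ                                                 ∎)
    skew : Skew S
    skew a b = begin
      ⟪ (λ f → Y f b) , (λ f → y f a) ⟫
        ≈⟨ ⟪⟫-cong {a = λ f → Y f b} (λ _ → refl) (λ f → ≈ᴹ-sym (dual-right X Y YX a (y f))) ⟩
      ⟪ (λ f → Y f b) , (λ f → ⟪ (λ h → Y h a) , (λ h → W h f) ⟫) ⟫
        ≈⟨ ⟪⟫-exchange (λ f → Y f b) (λ h → Y h a) (λ f h → W h f) ⟩
      ⟪ (λ h → Y h a) , (λ h → ⟪ (λ f → Y f b) , (λ f → W h f) ⟫) ⟫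
        ≈⟨ ⟪⟫-cong {a = λ h → Y h a} (λ _ → refl) (λ h → ≈ᴹ-trans
             (⟪⟫-cong {a = λ f → Y f b} (λ _ → refl) (λ f → W-skew h f)) (⟪⟫-negʳ (λ f → Y f b) (λ f → W f h))) ⟩
      ⟪ (λ h → Y h a) , (λ h → -ᴹ ⟪ (λ f → Y f b) , (λ f → W f h) ⟫) ⟫
        ≈⟨ ⟪⟫-negʳ (λ h → Y h a) (λ h → ⟪ (λ f → Y f b) , (λ f → W f h) ⟫) ⟩
      -ᴹ ⟪ (λ h → Y h a) , (λ h → ⟪ (λ f → Y f b) , (λ f → W f h) ⟫) ⟫
        ≈⟨ -ᴹ‿cong (⟪⟫-cong {a = λ h → Y h a} (λ _ → refl) (λ h → dual-right X Y YX b (y h))) ⟩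
      -ᴹ ⟪ (λ h → Y h a) , (λ h → y h b) ⟫ ∎

  module _ (p : Placement n k) (gp : GeneralPosition p) (v : Vec (Fin n) k) (inj : Injectiveᵛ v) where
    open GeneralPosition gp

    -- A vertex outside `v` sees the k pinned points in linearly independent directions, and its
    -- velocity is orthogonal to all of them.
    pin-down : ∀ m i → PinnedAt v m → (∀ f → Preserves p m i (lookup v f)) → ∀ a → m i a ≈ᴹ 0ᴹ
    pin-down m i pinned pres with Fin.any? (λ f → i Fin.≟ lookup v f)
    ... | yes (f , refl) = pinned f
    ... | no  i∉v = eliminable⇒trivialKernel
      (trivialKernel⇒eliminable searchFin _ (affinely-independent v inj i (λ f e → i∉v (f , e))))
      (m i) λ f → ≈ᴹ-trans (⟪⟫-cong {a = λ a → p i a ℚ.- p (lookup v f) a} (λ _ → refl)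
        (λ a → ≈ᴹ-sym (≈ᴹ-trans (+ᴹ-congˡ (≈ᴹ-trans (-ᴹ‿cong (pinned f a)) -0ᴹ≈0ᴹ)) (+ᴹ-identityʳ _)))) (pres f)

    -- An affine motion preserves the distances between all pairs, adjacent or not, so every vertex
    -- is subject to `pin-down`.
    pin-on : ∀ {B m} → (∀ f → lookup v f ∈ B) → TrivialOn B p m → PinnedAt v m →
             ∀ i → i ∈ B → ∀ a → m i a ≈ᴹ 0ᴹ
    pin-on {m = m} v⊆B (S , t , skew , m≈) pinned i i∈B = pin-down m i pinned λ f →
      preserves-cong p i (lookup v f) (λ a → ≈ᴹ-sym (m≈ i i∈B a)) (λ a → ≈ᴹ-sym (m≈ _ (v⊆B f) a))
        (affine-preserves t p skew i (lookup v f))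

    pin : ∀ {E B} → (∀ f → lookup v f ∈ B) → RigidOn E B p → PinRigid E B v p
    pin {B = B} v⊆B rigid m mot pinned out i with i ∈? B
    ... | no  i∉B = out i i∉B
    ... | yes i∈B = pin-on v⊆B (rigid m mot) pinned i i∈B

    -- Subtract from the motion its affine form on B₁. On B₂ the rest is a difference of two affine
    -- motions, so it preserves all distances to the k common vertices, where it vanishes.
    glue : ∀ {E B₁ B₂} → (∀ f → lookup v f ∈ B₁ ∩ B₂) →
           RigidOn E B₁ p → RigidOn E B₂ p → RigidOn E (B₁ ∪ B₂) p
    glue {B₁ = B₁} {B₂} v⊆ rigid₁ rigid₂ m mot
      with S , t , skew , m≈ ← rigid₁ m (λ i j i∈ j∈ → mot i j (Sub.p⊆p∪q B₂ i∈) (Sub.p⊆p∪q B₂ j∈))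
         | S′ , t′ , skew′ , m≈′ ← rigid₂ m (λ i j i∈ j∈ → mot i j (Sub.q⊆p∪q B₁ B₂ i∈) (Sub.q⊆p∪q B₁ B₂ j∈))
      = S , t , skew , λ i i∈ → [ m≈ i , on-B₂ i ]′ (Sub.x∈p∪q⁻ B₁ B₂ i∈)
      where
      v∈₁ : ∀ f → lookup v f ∈ B₁
      v∈₁ f = proj₁ (Sub.x∈p∩q⁻ B₁ B₂ (v⊆ f))
      v∈₂ : ∀ f → lookup v f ∈ B₂
      v∈₂ f = proj₂ (Sub.x∈p∩q⁻ B₁ B₂ (v⊆ f))
      on-B₂ : ∀ i → i ∈ B₂ → ∀ a → m i a ≈ᴹ affine S t p i a
      on-B₂ i i∈B₂ a = x-y≈0⇒x≈y (pin-down (λ i a → m i a -ᴹ affine S t p i a) i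
        (λ f a → x-x≈0 (m≈ _ (v∈₁ f) a))
        (λ f → preserves-minus p m (affine S t p) i (lookup v f)
          (preserves-cong p i (lookup v f) (λ a → ≈ᴹ-sym (m≈′ i i∈B₂ a)) (λ a → ≈ᴹ-sym (m≈′ _ (v∈₂ f) a))
            (affine-preserves t′ p skew′ i (lookup v f)))
          (affine-preserves t p skew i (lookup v f))) a)

    -- On the clique the motion is affine. Subtracting this affine motion and cutting off outside B
    -- leaves a pinned motion, which is zero.
    unpin : ∀ {E B} → (∀ f → lookup v f ∈ B) → (∀ f g → f ≢ g → E (lookup v f) (lookup v g)) →
            PinRigid E B v p → RigidOn E B p
    unpin {E} {B} v⊆B clique rigid m mot =
      let S , t , skew , m≈ = clique-affine p v (independent v inj) m v-pres
      in S , t , skew , λ i i∈B a → x-y≈0⇒x≈y (≈ᴹ-trans (≈ᴹ-sym (cut-∈ S t i i∈B a)) (rigid (cut S t)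
          (λ i j i∈B j∈B e → preserves-cong p i j (λ a → ≈ᴹ-sym (cut-∈ S t i i∈B a)) (λ a → ≈ᴹ-sym (cut-∈ S t j j∈B a))
            (preserves-minus p m (affine S t p) i j (mot i j i∈B j∈B e) (affine-preserves t p skew i j)))
          (λ f a → ≈ᴹ-trans (cut-∈ S t _ (v⊆B f) a) (x-x≈0 (m≈ f a)))
          (λ i i∉B a → ≈ᴹ-reflexive (cong (λ d → if d then m i a -ᴹ affine S t p i a else 0ᴹ) (dec-false (i ∈? B) i∉B)))
          i a))
      where
      v-pres : ∀ f g → Preserves p m (lookup v f) (lookup v g)
      v-pres f g with f Fin.≟ g
      ... | yes refl = ⟪⟫-zeroʳ (λ a → p (lookup v f) a ℚ.- p (lookup v f) a) (λ a → -ᴹ‿inverseʳ (m (lookup v f) a))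
      ... | no  f≢g  = mot _ _ (v⊆B f) (v⊆B g) (clique f g f≢g)
      cut : (Fin k → Fin k → Carrierᴹ) → (Fin k → Carrierᴹ) → Velocities
      cut S t i a = if does (i ∈? B) then m i a -ᴹ affine S t p i a else 0ᴹ
      cut-∈ : ∀ S t i → i ∈ B → ∀ a → cut S t i a ≈ᴹ m i a -ᴹ affine S t p i a
      cut-∈ S t i i∈B a = ≈ᴹ-reflexive (cong (λ d → if d then m i a -ᴹ affine S t p i a else 0ᴹ) (dec-true (i ∈? B) i∈B))

-- Pinned frameworks as linear systems

module Flatten (M : LeftModule ℚ.+-*-ring 0ℓ 0ℓ) where
  open Linear M

  sum-split : ∀ m {n} (f : Fin (m ℕ.+ n) → Carrierᴹ) →
              sum f ≈ᴹ sum (λ i → f (i ↑ˡ n)) +ᴹ sum (λ j → f (m ↑ʳ j))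
  sum-split zero    f = ≈ᴹ-sym (+ᴹ-identityˡ _)
  sum-split (suc m) f = ≈ᴹ-trans (+ᴹ-congˡ (sum-split m (f ∘ suc))) (≈ᴹ-sym (+ᴹ-assoc _ _ _))

  sum-combine : ∀ n k (f : Fin (n ℕ.* k) → Carrierᴹ) →
                sum f ≈ᴹ sum {n} (λ i → sum {k} (λ a → f (combine i a)))
  sum-combine zero    k f = ≈ᴹ-refl
  sum-combine (suc n) k f = ≈ᴹ-trans (sum-split k f) (+ᴹ-congˡ (sum-combine n k (λ c → f (k ↑ʳ c))))

module _ {A : Set} {n k : ℕ} where
  flatten : (Fin n → Fin k → A) → Fin (n ℕ.* k) → A
  flatten x c = x (proj₁ (remQuot {n} k c)) (proj₂ (remQuot {n} k c))

  flatten-combine : ∀ (x : Fin n → Fin k → A) i a → flatten x (combine i a) ≡ x i a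
  flatten-combine x i a = cong (λ (i , a) → x i a) (Fin.remQuot-combine i a)

module PinnedSystem {n k : ℕ} {C : Fin n → Fin n → Set} (C? : ∀ i j → Dec (C i j))
                    (B : Subset n) (v : Vec (Fin n) k) where

  -- Edge directions are data of their own, not differences of positions, so that vertex splitting
  -- can prescribe a direction for an edge of length zero.
  Directions : Set
  Directions = Fin n → Fin n → Fin k → ℚ

  Index : Set
  Index = (Fin n × Fin n) ⊎ (Fin k × Fin k) ⊎ (Fin n × Fin k)

  searchIndex : Searchable Index
  searchIndex = search⊎ (search× searchFin searchFin)
    (search⊎ (search× searchFin searchFin) (search× searchFin searchFin))

  row : Directions → Index → Fin n → Fin k → ℚ
  row D (inj₁ (i , j))        l b = if does (C? i j) then (δ i l ℚ.- δ j l) ℚ.* D i j b else 0ℚ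
  row D (inj₂ (inj₁ (f , a))) l b = δ (lookup v f) l ℚ.* δ a b
  row D (inj₂ (inj₂ (i , a))) l b = if does (i ∈? B) then 0ℚ else δ i l ℚ.* δ a b

  matrix : Directions → Matrix Index (n ℕ.* k)
  matrix D = flatten ∘ row D

  module Over (M : LeftModule ℚ.+-*-ring 0ℓ 0ℓ) where
    open Linear M
    open LinearDelta M
    open Motions M {n} {k}

    Unique : Directions → Set
    Unique D = ∀ m → (∀ i j → C i j → ⟪ D i j , (λ a → m i a -ᴹ m j a) ⟫ ≈ᴹ 0ᴹ) →
      PinnedAt v m → (∀ i → i ∉ B → ∀ a → m i a ≈ᴹ 0ᴹ) → ∀ i a → m i a ≈ᴹ 0ᴹ

    unflatten : (Fin (n ℕ.* k) → Carrierᴹ) → Velocities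
    unflatten y i a = y (combine i a)

    ⟪flatten⟫ : ∀ R y → ⟪ flatten R , y ⟫ ≈ᴹ sum (λ l → ⟪ R l , unflatten y l ⟫)
    ⟪flatten⟫ R y = ≈ᴹ-trans (Flatten.sum-combine M n k (λ c → flatten R c *ₗ y c))
      (sum-cong-≋ {n} (λ l → sum-cong-≋ {k} (λ a → *ₗ-≡ _ (flatten-combine R l a))))

    ⟪scaled⟫ : ∀ (c : Fin n → ℚ) (x : Fin k → ℚ) (m : Velocities) →
      sum (λ l → ⟪ (λ b → c l ℚ.* x b) , m l ⟫) ≈ᴹ ⟪ c , (λ l → ⟪ x , m l ⟫) ⟫
    ⟪scaled⟫ c x m = sum-cong-≋ (λ l → ⟪⟫-*ˡ (c l) x (m l))

    unit-row : ∀ i a (m : Velocities) → sum (λ l → ⟪ (λ b → δ i l ℚ.* δ a b) , m l ⟫) ≈ᴹ m i a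
    unit-row i a m = begin
      sum (λ l → ⟪ (λ b → δ i l ℚ.* δ a b) , m l ⟫)  ≈⟨ ⟪scaled⟫ (δ i) (δ a) m ⟩
      ⟪ δ i , (λ l → ⟪ δ a , m l ⟫) ⟫                ≈⟨ ⟪δ⟫ i (λ l → ⟪ δ a , m l ⟫) ⟩
      ⟪ δ a , m i ⟫                                  ≈⟨ ⟪δ⟫ a (m i) ⟩
      m i a                                          ∎

    edge-row : ∀ i j (x : Fin k → ℚ) (m : Velocities) →
      sum (λ l → ⟪ (λ b → (δ i l ℚ.- δ j l) ℚ.* x b) , m l ⟫) ≈ᴹ ⟪ x , (λ a → m i a -ᴹ m j a) ⟫
    edge-row i j x m = begin
      sum (λ l → ⟪ (λ b → (δ i l ℚ.- δ j l) ℚ.* x b) , m l ⟫)  ≈⟨ ⟪scaled⟫ (λ l → δ i l ℚ.- δ j l) x m ⟩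
      ⟪ (λ l → δ i l ℚ.- δ j l) , c ⟫                          ≈⟨ ⟪⟫-minusˡ (δ i) (δ j) c ⟩
      ⟪ δ i , c ⟫ -ᴹ ⟪ δ j , c ⟫                               ≈⟨ +ᴹ-cong (⟪δ⟫ i c) (-ᴹ‿cong (⟪δ⟫ j c)) ⟩
      ⟪ x , m i ⟫ -ᴹ ⟪ x , m j ⟫                               ≈⟨ ⟪⟫-minusʳ x (m i) (m j) ⟨
      ⟪ x , (λ a → m i a -ᴹ m j a) ⟫                           ∎
      where
      c : Fin n → Carrierᴹ
      c l = ⟪ x , m l ⟫

    zero-row : ∀ (m : Velocities) → sum (λ l → ⟪ (λ _ → 0ℚ) , m l ⟫) ≈ᴹ 0ᴹ
    zero-row m = sum-zero (λ l → sum-zero (λ a → *ₗ-zeroˡ (m l a)))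

    unique⇒trivialKernel : ∀ D → Unique D → TrivialKernel (matrix D)
    unique⇒trivialKernel D unique y ker c = subst (λ c → y c ≈ᴹ 0ᴹ) (Fin.combine-remQuot {n} k c)
      (unique m edges
        (λ f a → ≈ᴹ-trans (≈ᴹ-sym (unit-row (lookup v f) a m)) (rows (inj₂ (inj₁ (f , a)))))
        outs _ _)
      where
      m = unflatten y
      rows : ∀ r → sum (λ l → ⟪ row D r l , m l ⟫) ≈ᴹ 0ᴹ
      rows r = ≈ᴹ-trans (≈ᴹ-sym (⟪flatten⟫ (row D r) y)) (ker r)
      edges : ∀ i j → C i j → ⟪ D i j , (λ a → m i a -ᴹ m j a) ⟫ ≈ᴹ 0ᴹ
      edges i j cij with C? i j | rows (inj₁ (i , j))
      ... | yes _ | h = ≈ᴹ-trans (≈ᴹ-sym (edge-row i j (D i j) m)) h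
      ... | no ¬c | _ = contradiction cij ¬c
      outs : ∀ i → i ∉ B → ∀ a → m i a ≈ᴹ 0ᴹ
      outs i i∉B a with i ∈? B | rows (inj₂ (inj₂ (i , a)))
      ... | yes i∈B | _ = contradiction i∈B i∉B
      ... | no  _   | h = ≈ᴹ-trans (≈ᴹ-sym (unit-row i a m)) h

    trivialKernel⇒unique : ∀ D → TrivialKernel (matrix D) → Unique D
    trivialKernel⇒unique D triv m edges pinned out i a =
      ≈ᴹ-trans (≈ᴹ-reflexive (sym (flatten-combine m i a)))
        (triv (flatten m) (λ r → ≈ᴹ-trans (⟪flatten⟫ (row D r) (flatten m)) (≈ᴹ-trans
          (sum-cong-≋ (λ l → ⟪⟫-cong {a = row D r l} (λ _ → refl) (λ a → ≈ᴹ-reflexive (flatten-combine m l a))))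
          (rows r))) (combine i a))
      where
      rows : ∀ r → sum (λ l → ⟪ row D r l , m l ⟫) ≈ᴹ 0ᴹ
      rows (inj₁ (i , j)) with C? i j
      ... | yes c = ≈ᴹ-trans (edge-row i j (D i j) m) (edges i j c)
      ... | no  _ = zero-row m
      rows (inj₂ (inj₁ (f , a))) = ≈ᴹ-trans (unit-row (lookup v f) a m) (pinned f a)
      rows (inj₂ (inj₂ (i , a))) with i ∈? B
      ... | yes _   = zero-row m
      ... | no  i∉B = ≈ᴹ-trans (unit-row i a m) (out i i∉B a)

  open Over

  unique-ℚ⇒M : ∀ M D → Unique ℚ-module D → Unique M D
  unique-ℚ⇒M M D h = trivialKernel⇒unique M D (Linear.eliminable⇒trivialKernel M
    (trivialKernel⇒eliminable searchIndex (matrix D) (unique⇒trivialKernel ℚ-module D h)))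

  matrix-cong : ∀ {D D′} → (∀ i j a → D i j a ≡ D′ i j a) → ∀ r c → matrix D r c ≡ matrix D′ r c
  matrix-cong eq (inj₁ (i , j)) c = cong (λ z → if does (C? i j) then (δ i l ℚ.- δ j l) ℚ.* z else 0ℚ)
    (eq i j (proj₂ (remQuot {n} k c)))
    where l = proj₁ (remQuot {n} k c)
  matrix-cong eq (inj₂ (inj₁ _)) c = refl
  matrix-cong eq (inj₂ (inj₂ _)) c = refl

  matrix-polynomial : ∀ (D : ℕ → Directions) → (∀ i j a → Polynomial (λ t → D t i j a)) →
    ∀ r c → Polynomial (λ t → matrix (D t) r c)
  matrix-polynomial D poly (inj₁ (i , j)) c =
    polynomial-if (does (C? i j)) (polynomial-* (polynomial-const (δ i l ℚ.- δ j l))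
      (poly i j (proj₂ (remQuot {n} k c)))) (polynomial-const 0ℚ)
    where l = proj₁ (remQuot {n} k c)
  matrix-polynomial D poly (inj₂ (inj₁ _)) c = polynomial-const _
  matrix-polynomial D poly (inj₂ (inj₂ _)) c = polynomial-const _

  unique-eventually : ∀ (D : ℕ → Directions) → (∀ i j a → Polynomial (λ t → D t i j a)) →
    Unique ℚ-module (D 0) → Eventually (λ t → Unique ℚ-module (D t))
  unique-eventually D poly h = eventually-map (λ t → trivialKernel⇒unique ℚ-module (D t))
    (trivialKernel-eventually searchIndex (λ t → matrix (D t)) (matrix-polynomial D poly)
      (unique⇒trivialKernel ℚ-module (D 0) h))

module _ {n k : ℕ} {E : Fin n → Fin n → Set} (E? : ∀ i j → Dec (E i j)) (B : Subset n) (v : Vec (Fin n) k) where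

  Constrained : Fin n → Fin n → Set
  Constrained i j = i ∈ B × j ∈ B × E i j

  constrained? : ∀ i j → Dec (Constrained i j)
  constrained? i j = (i ∈? B) ×-dec (j ∈? B) ×-dec E? i j

  open PinnedSystem constrained? B v
  open Over

  differences : Placement n k → Directions
  differences p i j a = p i a ℚ.- p j a

  pinRigid⇒unique : ∀ M p → Motions.PinRigid M E B v p → Unique M (differences p)
  pinRigid⇒unique M p h m edges = h m (λ i j i∈B j∈B e → edges i j (i∈B , j∈B , e))

  unique⇒pinRigid : ∀ M p → Unique M (differences p) → Motions.PinRigid M E B v p
  unique⇒pinRigid M p h m mot = h m (λ i j (i∈B , j∈B , e) → mot i j i∈B j∈B e)

  pinRigid-ℚ⇒M : ∀ M p → Motions.PinRigid ℚ-module E B v p → Motions.PinRigid M E B v p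
  pinRigid-ℚ⇒M M p h = unique⇒pinRigid M p (unique-ℚ⇒M M _ (pinRigid⇒unique ℚ-module p h))

  pinRigid-generic : ∃ (Motions.PinRigid ℚ-module E B v) → Generic (Motions.PinRigid ℚ-module E B v)
  pinRigid-generic (p , h) = generic-map
    (λ p h → unique⇒pinRigid ℚ-module p (trivialKernel⇒unique ℚ-module (differences p) h))
    (λ p h → unique⇒trivialKernel ℚ-module (differences p) (pinRigid⇒unique ℚ-module p h))
    (generic-kernel searchIndex (matrix ∘ differences)
      (λ p≐q → matrix-cong (λ i j a → cong₂ ℚ._-_ (p≐q i a) (p≐q j a)))
      (λ p w → matrix-polynomial (λ t → differences (line p w t)) (λ i j a →
        polynomial-minus (polynomial-line (p i a) (w i a)) (polynomial-line (p j a) (w j a))))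
      (p , unique⇒trivialKernel ℚ-module (differences p) (pinRigid⇒unique ℚ-module p h)))

-- Deriving rigidity by gluing and vertex splitting

enumerate : ∀ {n} (S : Subset n) → Σ (Vec (Fin n) ∣ S ∣) λ v →
  Injectiveᵛ v × (∀ f → lookup v f ∈ S) × (∀ i → i ∈ S → ∃[ f ] lookup v f ≡ i)
enumerate []            = [] , (λ ()) , (λ ()) , λ ()
enumerate (outside ∷ S) with v , inj , v∈ , onto ← enumerate S =
  Vec.map suc v ,
  (λ f g e → inj f g (Fin.suc-injective (trans (sym (Vec.lookup-map f suc v)) (trans e (Vec.lookup-map g suc v))))) ,
  (λ f → subst (_∈ outside ∷ S) (sym (Vec.lookup-map f suc v)) (there (v∈ f))) ,
  λ { zero () ; (suc i) (there i∈S) → let f , e = onto i i∈S in f , trans (Vec.lookup-map f suc v) (cong suc e) }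
enumerate (inside ∷ S) with v , inj , v∈ , onto ← enumerate S =
  zero ∷ Vec.map suc v ,
  (λ { zero    zero    e → refl
     ; zero    (suc g) e → contradiction (trans e (Vec.lookup-map g suc v)) Fin.0≢1+n
     ; (suc f) zero    e → contradiction (trans (sym e) (Vec.lookup-map f suc v)) Fin.0≢1+n
     ; (suc f) (suc g) e → cong suc (inj f g (Fin.suc-injective
         (trans (sym (Vec.lookup-map f suc v)) (trans e (Vec.lookup-map g suc v))))) }) ,
  (λ { zero    → here
     ; (suc f) → subst (_∈ inside ∷ S) (sym (Vec.lookup-map f suc v)) (there (v∈ f)) }) ,
  λ { zero    here        → zero , refl
    ; (suc i) (there i∈S) → let f , e = onto i i∈S in suc f , trans (Vec.lookup-map f suc v) (cong suc e) }

choose : ∀ {n k} (S : Subset n) → k ≤ ∣ S ∣ → Σ (Vec (Fin n) k) λ v → Injectiveᵛ v × (∀ f → lookup v f ∈ S)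
choose S k≤ with v , inj , v∈ , _ ← enumerate S =
  tabulate (lookup v ∘ λ f → inject≤ f k≤) ,
  (λ f g e → Fin.inject≤-injective k≤ k≤ f g (inj _ _
    (trans (sym (Vec.lookup∘tabulate _ f)) (trans e (Vec.lookup∘tabulate _ g))))) ,
  λ f → subst (_∈ S) (sym (Vec.lookup∘tabulate _ f)) (v∈ _)

Edges : ℕ → Set₁
Edges n = Fin n → Fin n → Set

-- The edges at v are left in place; the contraction is only used on vertex
-- sets that avoid v.
contract : ∀ {n} → Fin n → Fin n → Edges n → Edges n
contract u v E i j = E i j ⊎ (i ≡ u × E v j) ⊎ (j ≡ u × E i v)

contract? : ∀ {n u v} {E : Edges n} → (∀ i j → Dec (E i j)) → ∀ i j → Dec (contract u v E i j)
contract? {u = u} {v} E? i j = E? i j ⊎-dec ((i Fin.≟ u) ×-dec E? v j) ⊎-dec ((j Fin.≟ u) ×-dec E? i v)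

Clique : ∀ {n} → Edges n → Subset n → Set
Clique E S = ∀ i j → i ∈ S → j ∈ S → i ≢ j → E i j

-- N is a set of common neighbours.  The clique F serves to pin B ∪ {v}; it may
-- not contain both u and v because these coincide at the degenerate placement.
Splittable : ∀ {n} → ℕ → Edges n → Fin n → Fin n → Subset n → Set
Splittable k E u v B = u ∈ B ×
  (∃[ N ] N ⊆ B × k ≤ suc ∣ N ∣ × u ∉ N × (∀ x → x ∈ N → E u x × E v x)) ×
  (∃[ F ] ∣ F ∣ ≡ k × Clique E F × F ⊆ B ∪ ⁅ v ⁆ × ¬ (u ∈ F × v ∈ F))

-- The number m bounds the depth. A split is undone in the contracted graph, so E varies along a
-- derivation and is an arbitrary relation; loops created by contraction do no harm.
Derivable : ∀ {n} → ℕ → ℕ → Edges n → Subset n → Set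
Derivable k zero    E B = ∣ B ∣ ≡ k × Clique E B
Derivable k (suc m) E B = Derivable k m E B
  ⊎ (∃[ B₁ ] ∃[ B₂ ] B ≡ B₁ ∪ B₂ × k ≤ ∣ B₁ ∩ B₂ ∣ × Derivable k m E B₁ × Derivable k m E B₂)
  ⊎ (∃[ u ] ∃[ v ] ∃[ B′ ] B ≡ B′ ∪ ⁅ v ⁆ × v ∉ B′ × E u v × Splittable k E u v B′ ×
      Derivable k m (contract u v E) B′)

module _ {n : ℕ} where
  clique? : {E : Edges n} → (∀ i j → Dec (E i j)) → ∀ S → Dec (Clique E S)
  clique? E? S = Fin.all? λ i → Fin.all? λ j →
    (i ∈? S) →-dec (j ∈? S) →-dec (¬? (i Fin.≟ j)) →-dec E? i j

  splittable? : ∀ k {E : Edges n} → (∀ i j → Dec (E i j)) → ∀ u v B → Dec (Splittable k E u v B)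
  splittable? k E? u v B = (u ∈? B) ×-dec
    anySubset? (λ N → (N ⊆? B) ×-dec (k ℕ.≤? suc ∣ N ∣) ×-dec ¬? (u ∈? N) ×-dec
      Fin.all? (λ x → (x ∈? N) →-dec (E? u x ×-dec E? v x))) ×-dec
    anySubset? (λ F → (∣ F ∣ ℕ.≟ k) ×-dec clique? E? F ×-dec (F ⊆? B ∪ ⁅ v ⁆) ×-dec
      ¬? ((u ∈? F) ×-dec (v ∈? F)))

  infix 4 _≟ₛ_
  _≟ₛ_ : (S T : Subset n) → Dec (S ≡ T)
  _≟ₛ_ = Vec.≡-dec Bool._≟_

  derivable? : ∀ k m {E : Edges n} → (∀ i j → Dec (E i j)) → ∀ B → Dec (Derivable k m E B)
  derivable? k zero    E? B = (∣ B ∣ ℕ.≟ k) ×-dec clique? E? B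
  derivable? k (suc m) E? B = derivable? k m E? B
    ⊎-dec anySubset? (λ B₁ → anySubset? (λ B₂ → (B ≟ₛ B₁ ∪ B₂) ×-dec (k ℕ.≤? ∣ B₁ ∩ B₂ ∣)
      ×-dec derivable? k m E? B₁ ×-dec derivable? k m E? B₂))
    ⊎-dec Fin.any? (λ u → Fin.any? (λ v → anySubset? (λ B′ → (B ≟ₛ B′ ∪ ⁅ v ⁆) ×-dec ¬? (v ∈? B′)
      ×-dec E? u v ×-dec splittable? k E? u v B′ ×-dec derivable? k m (contract? E?) B′)))

-- The invariant of a derivation. One placement is enough, since pin-rigidity is generic; the pins
-- form a clique because `unpin` needs one to return to rigidity.
Anchored : ∀ {n} k → Edges n → Subset n → Set
Anchored {n} k E B = Σ (Vec (Fin n) k) λ a → Injectiveᵛ a × (∀ f → lookup a f ∈ B) ×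
  (∀ f g → f ≢ g → E (lookup a f) (lookup a g)) × ∃ (Motions.PinRigid ℚ-module E B a)

module _ {n k : ℕ} where
  open Motions ℚ-module {n} {k}
  open Generic

  enumerate-≡ : (S : Subset n) → ∣ S ∣ ≡ k → Σ (Vec (Fin n) k) λ v →
    Injectiveᵛ v × (∀ f → lookup v f ∈ S) × (∀ i → i ∈ S → ∃[ f ] lookup v f ≡ i)
  enumerate-≡ S refl = enumerate S

  clique-anchored : ∀ {E} B → ∣ B ∣ ≡ k → Clique E B → Anchored k E B
  clique-anchored {E} B ∣B∣≡k clique = anchored (enumerate-≡ B ∣B∣≡k)
    where
    anchored : (Σ (Vec (Fin n) k) λ v → Injectiveᵛ v × (∀ f → lookup v f ∈ B) ×
      (∀ i → i ∈ B → ∃[ f ] lookup v f ≡ i)) → Anchored k E B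
    anchored (a , inj , a∈ , onto) =
      a , inj , a∈ , (λ f g f≢g → clique _ _ (a∈ f) (a∈ g) (f≢g ∘ inj f g)) , (λ _ _ → 0ℚ) ,
      λ m mot pinned out i x → zero-at m pinned out i x (i ∈? B)
      where
      zero-at : ∀ m → PinnedAt a m → (∀ i → i ∉ B → ∀ x → m i x ≡ 0ℚ) → ∀ i x → Dec (i ∈ B) → m i x ≡ 0ℚ
      zero-at m pinned out i x (no i∉B)  = out i i∉B x
      zero-at m pinned out i x (yes i∈B) =
        let f , e = onto i i∈B in trans (cong (λ i → m i x) (sym e)) (pinned f x)

  -- The two sets come with different placements and different pins. A common generic placement
  -- replaces the former; unpinning both, gluing and pinning again at `a₁` takes care of the latter.
  glue-anchored : ∀ {E} → (∀ i j → Dec (E i j)) → ∀ B₁ B₂ → k ≤ ∣ B₁ ∩ B₂ ∣ →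
    Anchored k E B₁ → Anchored k E B₂ → Anchored k E (B₁ ∪ B₂)
  glue-anchored {E} E? B₁ B₂ k≤ (a₁ , i₁ , a₁∈ , clique₁ , pr₁) (a₂ , i₂ , a₂∈ , clique₂ , pr₂) =
    glued (point (generic-× generalPosition-generic
      (generic-× (pinRigid-generic E? B₁ a₁ pr₁) (pinRigid-generic E? B₂ a₂ pr₂)))) (choose (B₁ ∩ B₂) k≤)
    where
    glued : ∃ (λ p → GeneralPosition p × PinRigid E B₁ a₁ p × PinRigid E B₂ a₂ p) →
      (Σ (Vec (Fin n) k) λ c → Injectiveᵛ c × (∀ f → lookup c f ∈ B₁ ∩ B₂)) → Anchored k E (B₁ ∪ B₂)
    glued (p , gp , h₁ , h₂) (c , injc , c∈) =
      a₁ , i₁ , (λ f → Sub.p⊆p∪q B₂ (a₁∈ f)) , clique₁ , p ,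
      pin p gp a₁ i₁ (λ f → Sub.p⊆p∪q B₂ (a₁∈ f))
        (glue p gp c injc c∈ (unpin p gp a₁ i₁ a₁∈ clique₁ h₁) (unpin p gp a₂ i₂ a₂∈ clique₂ h₂))

-- At the degenerate placement with v on top of u, where the edge uv is
-- replaced by the direction p u - p v, the k - 1 common neighbours force
-- v to move like u; then v is moved off u along that direction.
module VertexSplit {n k : ℕ} {E : Edges n} (E? : ∀ i j → Dec (E i j)) {u v : Fin n} (B : Subset n)
  (v∉B : v ∉ B) (u∈B : u ∈ B) (Euv : E u v)
  (p : Placement n (suc k)) (gp : GeneralPosition p)
  (rigid : Motions.RigidOn ℚ-module (contract u v E) B p)
  (c : Vec (Fin n) k) (inj-c : Injectiveᵛ c) (c∈B : ∀ f → lookup c f ∈ B) (u∉c : u ∉ᵛ c)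
  (neighbour : ∀ f → E u (lookup c f) × E v (lookup c f))
  (b : Vec (Fin n) (suc k)) (inj-b : Injectiveᵛ b) (b∈ : ∀ f → lookup b f ∈ B ∪ ⁅ v ⁆)
  (b-apart : ∀ f g → lookup b f ≡ u → lookup b g ≡ v → Empty.⊥) where
  open Motions ℚ-module {n} {suc k}
  open ≡-Reasoning

  u≢v : u ≢ v
  u≢v u≡v = v∉B (subst (_∈ B) u≡v u∈B)

  isUV : Fin n → Fin n → Bool
  isUV i j = does (i Fin.≟ u) ∧ does (j Fin.≟ v)

  isUV-≢ˡ : ∀ {i} j → i ≢ u → isUV i j ≡ false
  isUV-≢ˡ {i} j i≢u = cong (_∧ does (j Fin.≟ v)) (dec-false (i Fin.≟ u) i≢u)

  isUV-≢ʳ : ∀ i {j} → j ≢ v → isUV i j ≡ false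
  isUV-≢ʳ i {j} j≢v = trans (cong (does (i Fin.≟ u) ∧_) (dec-false (j Fin.≟ v) j≢v)) (Bool.∧-zeroʳ _)

  B⁺ : Subset n
  B⁺ = B ∪ ⁅ v ⁆
  ∈B⁺ : ∀ {i} → i ∈ B → i ∈ B⁺
  ∈B⁺ = Sub.p⊆p∪q ⁅ v ⁆
  v∈B⁺ : v ∈ B⁺
  v∈B⁺ = Sub.q⊆p∪q B ⁅ v ⁆ (Sub.x∈⁅x⁆ v)
  ∉⇒≢v : ∀ {i} → i ∈ B → i ≢ v
  ∉⇒≢v i∈B i≡v = v∉B (subst (_∈ B) i≡v i∈B)

  p₀ w : Placement n (suc k)
  p₀ i a = if does (i Fin.≟ v) then p u a else p i a
  w i a = if does (i Fin.≟ v) then p v a ℚ.- p u a else 0ℚ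

  p₀-v : ∀ a → p₀ v a ≡ p u a
  p₀-v a = cong (if_then p u a else p v a) (dec-true (v Fin.≟ v) refl)
  p₀-≢ : ∀ {i} → i ≢ v → ∀ a → p₀ i a ≡ p i a
  p₀-≢ {i} i≢v a = cong (if_then p u a else p i a) (dec-false (i Fin.≟ v) i≢v)
  w-v : ∀ a → w v a ≡ p v a ℚ.- p u a
  w-v a = cong (if_then p v a ℚ.- p u a else 0ℚ) (dec-true (v Fin.≟ v) refl)
  w-≢ : ∀ {i} → i ≢ v → ∀ a → w i a ≡ 0ℚ
  w-≢ {i} i≢v a = cong (if_then p v a ℚ.- p u a else 0ℚ) (dec-false (i Fin.≟ v) i≢v)
  open PinnedSystem (constrained? E? B⁺ b) B⁺ b
  open Over ℚ-module using (Unique)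

  -- The edge uv keeps the direction `p u - p v` for every t; for t ≥ 1 its actual direction is a
  -- nonzero multiple of it. Thus D is polynomial in t and not degenerate at 0.
  D : ℕ → Directions
  D t i j a = if isUV i j then p u a ℚ.- p v a else line p₀ w t i a ℚ.- line p₀ w t j a

  D-uv : ∀ t a → D t u v a ≡ p u a ℚ.- p v a
  D-uv t a = cong (if_then p u a ℚ.- p v a else (line p₀ w t u a ℚ.- line p₀ w t v a))
    (cong₂ _∧_ (dec-true (u Fin.≟ u) refl) (dec-true (v Fin.≟ v) refl))

  at-0 : ∀ i a → line p₀ w 0 i a ≡ p₀ i a
  at-0 i a = trans (cong (p₀ i a ℚ.+_) (ℚ.*-zeroˡ (w i a))) (ℚ.+-identityʳ (p₀ i a))

  D₀ : ∀ i j → isUV i j ≡ false → ∀ a → D 0 i j a ≡ p₀ i a ℚ.- p₀ j a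
  D₀ i j e a = trans (cong (if_then p u a ℚ.- p v a else (line p₀ w 0 i a ℚ.- line p₀ w 0 j a)) e) (cong₂ ℚ._-_ (at-0 i a) (at-0 j a))

  D-polynomial : ∀ i j a → Polynomial (λ t → D t i j a)
  D-polynomial i j a = polynomial-if (isUV i j) (polynomial-const (p u a ℚ.- p v a))
    (polynomial-minus (polynomial-line (p₀ i a) (w i a)) (polynomial-line (p₀ j a) (w j a)))

  module Degenerate (m : Velocities)
    (edges : ∀ i j → Constrained E? B⁺ b i j → Lℚ.⟪ D 0 i j , (λ a → m i a ℚ.- m j a) ⟫ ≡ 0ℚ)
    (pinned : PinnedAt b m) where

    edge : ∀ {i j} → i ∈ B⁺ → j ∈ B⁺ → E i j → isUV i j ≡ false → ∀ {x y} →
      (∀ a → p₀ i a ≡ p x a) → (∀ a → p₀ j a ≡ p y a) →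
      Lℚ.⟪ (λ a → p x a ℚ.- p y a) , (λ a → m i a ℚ.- m j a) ⟫ ≡ 0ℚ
    edge {i} {j} i∈ j∈ e not-uv px py = trans
      (Lℚ.⟪⟫-cong {x = λ a → m i a ℚ.- m j a} (λ a → trans (cong₂ ℚ._-_ (sym (px a)) (sym (py a))) (sym (D₀ i j not-uv a))) (λ _ → refl))
      (edges i j (i∈ , j∈ , e))

    vc : Vec (Fin n) (suc k)
    vc = v ∷ c
    inj-vc : Injectiveᵛ vc
    inj-vc zero    zero    e = refl
    inj-vc zero    (suc g) e = contradiction (sym e) (∉⇒≢v (c∈B g))
    inj-vc (suc f) zero    e = contradiction e (∉⇒≢v (c∈B f))
    inj-vc (suc f) (suc g) e = cong suc (inj-c f g e)
    u∉vc : u ∉ᵛ vc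
    u∉vc zero    e = u≢v e
    u∉vc (suc f) e = u∉c f e

    -- The difference of the two velocities is orthogonal to the direction prescribed for uv.
    -- Comparing the edges from u and from v to a common neighbour, which have the same direction
    -- here, gives k more conditions; together they are independent in dimension `suc k`.
    mu≡mv : ∀ x → m u x ≡ m v x
    mu≡mv x = Lℚ.x-y≈0⇒x≈y (GeneralPosition.affinely-independent gp vc inj-vc u u∉vc
      (λ a → m u a ℚ.- m v a) (λ
        { zero → trans (Lℚ.⟪⟫-cong {x = λ a → m u a ℚ.- m v a} (λ a → sym (D-uv 0 a)) (λ _ → refl))
                       (edges u v (∈B⁺ u∈B , v∈B⁺ , Euv))
        ; (suc f) →
          let y = lookup c f
              q = λ a → p u a ℚ.- p y a
              Euy , Evy = neighbour f
              y≢v = ∉⇒≢v (c∈B f)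
          in begin
            Lℚ.⟪ q , (λ a → m u a ℚ.- m v a) ⟫
              ≡⟨ Lℚ.⟪⟫-cong {a = q} (λ _ → refl) (λ a → solve 3 (λ a b c → a :- b := (a :- c) :- (b :- c)) refl (m u a) (m v a) (m y a)) ⟩
            Lℚ.⟪ q , (λ a → (m u a ℚ.- m y a) ℚ.- (m v a ℚ.- m y a)) ⟫
              ≡⟨ Lℚ.⟪⟫-minusʳ q (λ a → m u a ℚ.- m y a) (λ a → m v a ℚ.- m y a) ⟩
            Lℚ.⟪ q , (λ a → m u a ℚ.- m y a) ⟫ ℚ.- Lℚ.⟪ q , (λ a → m v a ℚ.- m y a) ⟫
              ≡⟨ cong₂ ℚ._-_
                   (edge (∈B⁺ u∈B) (∈B⁺ (c∈B f)) Euy (isUV-≢ʳ u y≢v) (p₀-≢ u≢v) (p₀-≢ y≢v))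
                   (edge v∈B⁺ (∈B⁺ (c∈B f)) Evy (isUV-≢ˡ y (u≢v ∘ sym)) p₀-v (p₀-≢ y≢v)) ⟩
            0ℚ ∎ }) x)
      where open +-*-Solver

    motion-B : Motion (contract u v E) B p m
    motion-B i j i∈B j∈B (inj₁ e) = edge (∈B⁺ i∈B) (∈B⁺ j∈B) e (isUV-≢ʳ i (∉⇒≢v j∈B))
      (p₀-≢ (∉⇒≢v i∈B)) (p₀-≢ (∉⇒≢v j∈B))
    motion-B i j i∈B j∈B (inj₂ (inj₁ (refl , e))) = trans
      (Lℚ.⟪⟫-cong {a = λ a → p u a ℚ.- p j a} (λ _ → refl) (λ a → cong (λ z → z ℚ.- m j a) (mu≡mv a)))
      (edge v∈B⁺ (∈B⁺ j∈B) e (isUV-≢ˡ j (u≢v ∘ sym)) p₀-v (p₀-≢ (∉⇒≢v j∈B)))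
    motion-B i j i∈B j∈B (inj₂ (inj₂ (refl , e))) with i Fin.≟ u
    -- The edge uv has become a loop at u. It is treated apart because its direction in `D 0` is the
    -- prescribed one and not a difference of positions.
    ... | yes refl = Lℚ.⟪⟫-zeroʳ (λ a → p u a ℚ.- p u a) (λ a → ℚ.+-inverseʳ (m u a))
    ... | no  i≢u  = trans
      (Lℚ.⟪⟫-cong {a = λ a → p i a ℚ.- p u a} (λ _ → refl) (λ a → cong (λ z → m i a ℚ.- z) (mu≡mv a)))
      (edge (∈B⁺ i∈B) v∈B⁺ e (isUV-≢ˡ v i≢u) (p₀-≢ (∉⇒≢v i∈B)) p₀-v)

    -- Since u and v move alike, a pin at v may be replaced by one at u, which brings all pins into
    -- B; they stay distinct because not both u and v are pinned.
    push : Fin n → Fin n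
    push x = if does (x Fin.≟ v) then u else x
    b′ : Vec (Fin n) (suc k)
    b′ = Vec.map push b
    lookup-b′ : ∀ f → lookup b′ f ≡ push (lookup b f)
    lookup-b′ f = Vec.lookup-map f push b
    push-inj : ∀ f g → push (lookup b f) ≡ push (lookup b g) → f ≡ g
    push-inj f g e with lookup b f Fin.≟ v | lookup b g Fin.≟ v
    ... | yes f≡v | yes g≡v = inj-b f g (trans f≡v (sym g≡v))
    ... | yes f≡v | no  _   = ⊥-elim (b-apart g f (sym e) f≡v)
    ... | no  _   | yes g≡v = ⊥-elim (b-apart f g e g≡v)
    ... | no  _   | no  _   = inj-b f g e
    push-∈ : ∀ {x} → x ∈ B⁺ → push x ∈ B
    push-∈ {x} x∈ with x Fin.≟ v
    ... | yes _   = u∈B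
    ... | no  x≢v = [ id , (λ x∈v → contradiction (Sub.x∈⁅y⁆⇒x≡y v x∈v) x≢v) ]′ (Sub.x∈p∪q⁻ B ⁅ v ⁆ x∈)
    m-push : ∀ x a → m (push x) a ≡ m x a
    m-push x a with x Fin.≟ v
    ... | yes refl = mu≡mv a
    ... | no  _    = refl

    m-B : ∀ i → i ∈ B → ∀ x → m i x ≡ 0ℚ
    m-B = pin-on p gp b′
      (λ f g e → push-inj f g (trans (sym (lookup-b′ f)) (trans e (lookup-b′ g))))
      (λ f → subst (_∈ B) (sym (lookup-b′ f)) (push-∈ (b∈ f)))
      (rigid m motion-B)
      (λ f a → trans (cong (λ i → m i a) (lookup-b′ f)) (trans (m-push (lookup b f) a) (pinned f a)))

  degenerate : Unique (D 0)
  degenerate m edges pinned out i x = on-Dec (i ∈? B⁺)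
    where
    open Degenerate m edges pinned
    on-Dec : Dec (i ∈ B⁺) → m i x ≡ 0ℚ
    on-Dec (no  i∉) = out i i∉ x
    on-Dec (yes i∈) = [ (λ i∈B → m-B i i∈B x) ,
      (λ i∈v → trans (cong (λ i → m i x) (Sub.x∈⁅y⁆⇒x≡y v i∈v)) (trans (sym (mu≡mv x)) (m-B u u∈B x))) ]′
      (Sub.x∈p∪q⁻ B ⁅ v ⁆ i∈)

  pinRigid : ∀ T → Unique (D (suc T)) → PinRigid E B⁺ b (line p₀ w (suc T))
  pinRigid T unique m mot = unique m edges
    where
    edges : ∀ i j → Constrained E? B⁺ b i j → Lℚ.⟪ D (suc T) i j , (λ a → m i a ℚ.- m j a) ⟫ ≡ 0ℚ
    edges i j (i∈ , j∈ , e) = by-cases i j i∈ j∈ e (i Fin.≟ u) (j Fin.≟ v)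
      where
      other : ∀ i j → i ∈ B⁺ → j ∈ B⁺ → E i j → isUV i j ≡ false →
        Lℚ.⟪ D (suc T) i j , (λ a → m i a ℚ.- m j a) ⟫ ≡ 0ℚ
      other i j i∈ j∈ e not-uv = trans
        (Lℚ.⟪⟫-cong {x = λ a → m i a ℚ.- m j a} (λ a → cong (if_then p u a ℚ.- p v a else (line p₀ w (suc T) i a ℚ.- line p₀ w (suc T) j a)) not-uv) (λ _ → refl))
        (mot i j i∈ j∈ e)
      by-cases : ∀ i j → i ∈ B⁺ → j ∈ B⁺ → E i j → Dec (i ≡ u) → Dec (j ≡ v) →
        Lℚ.⟪ D (suc T) i j , (λ a → m i a ℚ.- m j a) ⟫ ≡ 0ℚ
      by-cases i j i∈ j∈ e (no i≢u) _         = other i j i∈ j∈ e (isUV-≢ˡ j i≢u)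
      by-cases i j i∈ j∈ e (yes _)  (no j≢v)  = other i j i∈ j∈ e (isUV-≢ʳ i j≢v)
      by-cases _ _ i∈ j∈ e (yes refl) (yes refl) = trans
        (Lℚ.⟪⟫-cong {x = λ a → m u a ℚ.- m v a} (D-uv (suc T)) (λ _ → refl)) (Lℚ.*ₗ-cancel ιT≢0 (trans
        (sym (Lℚ.⟪⟫-*ˡ (ι (suc T)) (λ a → p u a ℚ.- p v a) (λ a → m u a ℚ.- m v a)))
        (trans (Lℚ.⟪⟫-cong {x = λ a → m u a ℚ.- m v a} direction (λ _ → refl)) (mot u v i∈ j∈ e))))
        where
        open +-*-Solver
        ιT≢0 : ι (suc T) ≢ 0ℚ
        ιT≢0 ιT≡0 = ℚ.<-irrefl (sym ιT≡0) (ℚ.<-≤-trans (ℚ.positive⁻¹ 1ℚ)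
          (ℚ.≤-trans (ℚ.≤-reflexive (sym (ℚ.+-identityʳ 1ℚ))) (ℚ.+-monoʳ-≤ 1ℚ (0≤ι T))))
        direction : ∀ a → ι (suc T) ℚ.* (p u a ℚ.- p v a) ≡ line p₀ w (suc T) u a ℚ.- line p₀ w (suc T) v a
        direction a = trans
          (solve 3 (λ t x y → t :* (x :- y) := (x :+ t :* con 0ℚ) :- (x :+ t :* (y :- x))) refl (ι (suc T)) (p u a) (p v a))
          (sym (cong₂ ℚ._-_
            (cong₂ (λ x y → x ℚ.+ ι (suc T) ℚ.* y) (p₀-≢ u≢v a) (w-≢ u≢v a))
            (cong₂ (λ x y → x ℚ.+ ι (suc T) ℚ.* y) (p₀-v a) (w-v a))))

  moved : Eventually (λ t → Unique (D t)) → ∃ (PinRigid E B⁺ b)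
  -- The successor avoids the parameter 0, at which u and v coincide.
  moved (T , unique) = line p₀ w (suc T) , pinRigid T (unique (suc T) (ℕ.n≤1+n T))

  splits : ∃ (PinRigid E B⁺ b)
  splits = moved (unique-eventually D D-polynomial degenerate)

split-anchored : ∀ {n k} {E : Edges n} → (∀ i j → Dec (E i j)) → ∀ {u v} (B : Subset n) → v ∉ B → E u v →
  Splittable (suc k) E u v B → Anchored (suc k) (contract u v E) B → Anchored (suc k) E (B ∪ ⁅ v ⁆)
split-anchored {n} {k} {E} E? {u} {v} B v∉B Euv
    (u∈B , (N , N⊆B , s≤s k≤ , u∉N , nbr) , (F , ∣F∣≡k , F-clique , F⊆ , F-apart)) (a , inj-a , a∈ , clique-a , pr) =
  split (point (generic-× generalPosition-generic (pinRigid-generic (contract? E?) B a pr)))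
    (choose N k≤) (enumerate-≡ F ∣F∣≡k)
  where
  open Motions ℚ-module {n} {suc k}
  open Generic
  split : ∃ (λ p → GeneralPosition p × PinRigid (contract u v E) B a p) →
    (Σ (Vec (Fin n) k) λ c → Injectiveᵛ c × (∀ f → lookup c f ∈ N)) →
    (Σ (Vec (Fin n) (suc k)) λ b → Injectiveᵛ b × (∀ f → lookup b f ∈ F) ×
      (∀ i → i ∈ F → ∃[ f ] lookup b f ≡ i)) → Anchored (suc k) E (B ∪ ⁅ v ⁆)
  split (p , gp , h) (c , inj-c , c∈) (b , inj-b , b∈ , _) =
    b , inj-b , (λ f → F⊆ (b∈ f)) , (λ f g f≢g → F-clique _ _ (b∈ f) (b∈ g) (f≢g ∘ inj-b f g)) ,
    VertexSplit.splits E? B v∉B u∈B Euv p gp (unpin p gp a inj-a a∈ clique-a h) c inj-c (λ f → N⊆B (c∈ f))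
      (λ f u≡ → u∉N (subst (_∈ N) (sym u≡) (c∈ f))) (λ f → nbr _ (c∈ f)) b inj-b (λ f → F⊆ (b∈ f))
      (λ f g f≡u g≡v → F-apart (subst (_∈ F) f≡u (b∈ f) , subst (_∈ F) g≡v (b∈ g)))

derivable⇒anchored : ∀ {n k} m {E : Edges n} → (∀ i j → Dec (E i j)) → ∀ B →
  Derivable (suc k) m E B → Anchored (suc k) E B
derivable⇒anchored zero    E? B (∣B∣≡k , clique) = clique-anchored B ∣B∣≡k clique
derivable⇒anchored (suc m) E? B (inj₁ d) = derivable⇒anchored m E? B d
derivable⇒anchored (suc m) E? B (inj₂ (inj₁ (B₁ , B₂ , refl , k≤ , d₁ , d₂))) =
  glue-anchored E? B₁ B₂ k≤ (derivable⇒anchored m E? B₁ d₁) (derivable⇒anchored m E? B₂ d₂)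
derivable⇒anchored (suc m) E? B (inj₂ (inj₂ (u , v , B′ , refl , v∉B′ , Euv , sp , d))) =
  split-anchored E? B′ v∉B′ Euv sp (derivable⇒anchored m (contract? E?) B′ d)

-- Finite subsets and derivable sets

Stable : ∀ {ℓ} → Set ℓ → Set ℓ
Stable A = ¬ ¬ A → A

by-cases : ∀ {a b} {A : Set a} {B : Set b} → Stable B → (Dec A → B) → B
by-cases stable f = stable λ k → ¬¬-excluded-middle (λ d → k (f d))

-- Double negation commutes with a quantifier over finitely many subsets; the induction settles the
-- two halves of the power set in turn.
¬¬-∀Subset : ∀ {ℓ n} {P : Subset n → Set ℓ} → (∀ S → ¬ ¬ P S) → ¬ ¬ (∀ S → P S)
¬¬-∀Subset {n = zero}  h k = h [] λ p → k λ { [] → p }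
¬¬-∀Subset {n = suc n} h k = ¬¬-∀Subset (λ S → h (inside ∷ S)) λ p → ¬¬-∀Subset (λ S → h (outside ∷ S)) λ q →
  k λ { (inside ∷ S) → p S ; (outside ∷ S) → q S }

module _ {n : ℕ} where
  ∈-subset : ∀ {P : Fin n → Set} (P? : ∀ i → Dec (P i)) {i} → P i → i ∈ tabulate (λ i → does (P? i))
  ∈-subset P? {i} p = Vec.lookup⇒[]= i _ (trans (Vec.lookup∘tabulate (λ i → does (P? i)) i) (dec-true (P? i) p))

  ∈-subset⁻ : ∀ {P : Fin n → Set} (P? : ∀ i → Dec (P i)) {i} → i ∈ tabulate (λ i → does (P? i)) → P i
  ∈-subset⁻ P? {i} i∈ with P? i | trans (sym (Vec.lookup∘tabulate (λ i → does (P? i)) i)) (Vec.[]=⇒lookup i∈)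
  ... | yes p | _ = p
  ... | no  _ | ()

  ⊆∧≥⇒≡ : ∀ {S T : Subset n} → S ⊆ T → ∣ T ∣ ≤ ∣ S ∣ → S ≡ T
  ⊆∧≥⇒≡ {S} {T} S⊆T ∣T∣≤∣S∣ = Sub.⊆-antisym S⊆T λ {x} x∈T → decidable-stable (x ∈? S) λ x∉S →
    ℕ.<⇒≱ (Sub.p⊂q⇒∣p∣<∣q∣ (S⊆T , x , x∈T , x∉S)) ∣T∣≤∣S∣

  ∪-least : ∀ {S T U : Subset n} → S ⊆ U → T ⊆ U → S ∪ T ⊆ U
  ∪-least {S} {T} S⊆U T⊆U x∈ = [ S⊆U , T⊆U ]′ (Sub.x∈p∪q⁻ S T x∈)

  ∩-greatest : ∀ {S T U : Subset n} → U ⊆ S → U ⊆ T → U ⊆ S ∩ T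
  ∩-greatest U⊆S U⊆T x∈ = Sub.x∈p∩q⁺ (U⊆S x∈ , U⊆T x∈)

  ⁅⁆⊆ : ∀ {x} {S : Subset n} → x ∈ S → ⁅ x ⁆ ⊆ S
  ⁅⁆⊆ {x} {S} x∈S y∈ = subst (_∈ S) (sym (Sub.x∈⁅y⁆⇒x≡y x y∈)) x∈S

∣⁅x⁆∪S∣ : ∀ {n} (x : Fin n) (S : Subset n) → x ∉ S → ∣ ⁅ x ⁆ ∪ S ∣ ≡ suc ∣ S ∣
∣⁅x⁆∪S∣ zero    (inside  ∷ S) x∉S = contradiction here x∉S
∣⁅x⁆∪S∣ zero    (outside ∷ S) x∉S = cong (λ T → suc ∣ T ∣) (Sub.∪-identityˡ S)
∣⁅x⁆∪S∣ (suc x) (inside  ∷ S) x∉S = cong suc (∣⁅x⁆∪S∣ x S (x∉S ∘ there))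
∣⁅x⁆∪S∣ (suc x) (outside ∷ S) x∉S = ∣⁅x⁆∪S∣ x S (x∉S ∘ there)

derivable-mono : ∀ {n k m m′} {E : Edges n} {B} → m ≤ m′ → Derivable k m E B → Derivable k m′ E B
derivable-mono {n} {k} {m} {E = E} {B} m≤m′ = go (ℕ.≤⇒≤′ m≤m′)
  where
  go : ∀ {m′} → m ℕ.≤′ m′ → Derivable k m E B → Derivable k m′ E B
  go ℕ.≤′-refl       d = d
  go (ℕ.≤′-step m≤m′) d = inj₁ (go m≤m′ d)

-- Every step of a derivation enlarges the set, so ∣ B ∣ steps suffice; this
-- bound makes derivability decidable.
Derived : ∀ {n} → ℕ → Edges n → Subset n → Set
Derived k E B = Derivable k ∣ B ∣ E B

module _ {n k : ℕ} {E : Edges n} where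
  derived? : (∀ i j → Dec (E i j)) → ∀ B → Dec (Derived k E B)
  derived? E? B = derivable? k ∣ B ∣ E? B

  derived-clique : ∀ {B} → ∣ B ∣ ≡ k → Clique E B → Derived k E B
  derived-clique {B} ∣B∣≡k clique = derivable-mono z≤n (∣B∣≡k , clique)

  -- If the union is B₁ or B₂ there is nothing to glue. Otherwise both are strictly smaller than the
  -- union, and the step bound leaves room for one more step.
  derived-glue : ∀ {B₁ B₂} → k ≤ ∣ B₁ ∩ B₂ ∣ → Derived k E B₁ → Derived k E B₂ → Derived k E (B₁ ∪ B₂)
  derived-glue {B₁} {B₂} k≤ d₁ d₂ = glue-at (∣ U ∣ ℕ.≤? ∣ B₁ ∣) (∣ U ∣ ℕ.≤? ∣ B₂ ∣)
    where
    U = B₁ ∪ B₂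
    below-U : ∀ B → ¬ (∣ U ∣ ≤ ∣ B ∣) → ∀ {s} → ∣ U ∣ ≡ suc s → ∣ B ∣ ≤ s
    below-U B U≰B e = ℕ.≤-pred (subst (suc ∣ B ∣ ≤_) e (ℕ.≰⇒> U≰B))
    glue-step : ¬ (∣ U ∣ ≤ ∣ B₁ ∣) → ¬ (∣ U ∣ ≤ ∣ B₂ ∣) → ∀ s → ∣ U ∣ ≡ s → Derivable k s E U
    glue-step ≰₁ ≰₂ zero    e = contradiction (subst (_≤ ∣ B₁ ∣) (sym e) z≤n) ≰₁
    glue-step ≰₁ ≰₂ (suc s) e = inj₂ (inj₁ (B₁ , B₂ , refl , k≤ ,
      derivable-mono (below-U B₁ ≰₁ e) d₁ , derivable-mono (below-U B₂ ≰₂ e) d₂))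
    glue-at : Dec (∣ U ∣ ≤ ∣ B₁ ∣) → Dec (∣ U ∣ ≤ ∣ B₂ ∣) → Derived k E U
    glue-at (yes ≤₁) _        = subst (Derived k E) (⊆∧≥⇒≡ (Sub.p⊆p∪q B₂) ≤₁) d₁
    glue-at (no _)   (yes ≤₂) = subst (Derived k E) (⊆∧≥⇒≡ (Sub.q⊆p∪q B₁ B₂) ≤₂) d₂
    glue-at (no ≰₁)  (no ≰₂)  = glue-step ≰₁ ≰₂ ∣ U ∣ refl

  derived-split : ∀ {u v B} → v ∉ B → E u v → Splittable k E u v B → Derived k (contract u v E) B →
                  Derived k E (B ∪ ⁅ v ⁆)
  derived-split {u} {v} {B} v∉B Euv sp d = derivable-mono
    (Sub.p⊂q⇒∣p∣<∣q∣ (Sub.p⊆p∪q ⁅ v ⁆ , v , Sub.q⊆p∪q B ⁅ v ⁆ (Sub.x∈⁅x⁆ v) , v∉B))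
    (inj₂ (inj₂ (u , v , B , refl , v∉B , Euv , sp , d)))

  Absorbing : Subset n → Subset n → Set
  Absorbing W B = ∀ B′ → B′ ⊆ W → Derived k E B′ → k ≤ ∣ B ∩ B′ ∣ → B′ ⊆ B

  -- Derivable sets that violate absorption are glued on until none is left. In `grow` the number
  -- `f` bounds how many vertices are still missing.
  maximal : ∀ {W B} → B ⊆ W → Derived k E B →
            ¬ ¬ (∃[ B′ ] B ⊆ B′ × B′ ⊆ W × Derived k E B′ × Absorbing W B′)
  maximal {W} {B} = grow n (ℕ.m≤n+m n ∣ B ∣)
    where
    grow : ∀ f {B} → n ≤ ∣ B ∣ ℕ.+ f → B ⊆ W → Derived k E B →
           ¬ ¬ (∃[ B′ ] B ⊆ B′ × B′ ⊆ W × Derived k E B′ × Absorbing W B′)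
    Enlarging : Subset n → Set
    Enlarging B = ∃[ B′ ] B′ ⊆ W × Derived k E B′ × k ≤ ∣ B ∩ B′ ∣ × ¬ (B′ ⊆ B)
    grow-by : ∀ f {B} → n ≤ ∣ B ∣ ℕ.+ f → B ⊆ W → Derived k E B → Dec (Enlarging B) →
              ¬ ¬ (∃[ B′ ] B ⊆ B′ × B′ ⊆ W × Derived k E B′ × Absorbing W B′)
    grow f h B⊆W d k = ¬¬-excluded-middle λ dec → grow-by f h B⊆W d dec k
    grow-by f {B} h B⊆W d (no none) k = k (B , (λ x∈ → x∈) , B⊆W , d , absorbing)
      where
      absorbing : Absorbing W B
      absorbing B′ B′⊆W d′ k≤ = decidable-stable (B′ ⊆? B) (λ B′⊈B → none (B′ , B′⊆W , d′ , k≤ , B′⊈B))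
    -- No vertex is missing, so B is everything and cannot be enlarged.
    grow-by zero {B} h B⊆W d (yes (B′ , _ , _ , _ , B′⊈B)) _ = contradiction
      (λ {x} _ → subst (x ∈_) (sym (Sub.∣p∣≡n⇒p≡⊤ (ℕ.≤-antisym (Sub.∣p∣≤n B) (subst (n ≤_) (ℕ.+-identityʳ _) h)))) Sub.∈⊤)
      B′⊈B
    grow-by (suc f) {B} h B⊆W d (yes (B′ , B′⊆W , d′ , k≤ , B′⊈B)) k =
      grow f larger (∪-least {S = B} {B′} {W} B⊆W B′⊆W) (derived-glue k≤ d d′) λ (C , ∪⊆C , rest) →
      k (C , (λ x∈ → ∪⊆C (Sub.p⊆p∪q B′ x∈)) , rest)
      where
      larger : n ≤ ∣ B ∪ B′ ∣ ℕ.+ f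
      larger = ℕ.≤-trans h (ℕ.≤-trans (ℕ.≤-reflexive (ℕ.+-suc ∣ B ∣ f)) (ℕ.+-monoˡ-≤ f
        (ℕ.≰⇒> λ ∪≤ → B′⊈B (λ x∈ → subst (_ ∈_) (sym (⊆∧≥⇒≡ (Sub.p⊆p∪q B′) ∪≤)) (Sub.q⊆p∪q B B′ x∈)))))

-- Alternating chains on tuples

⟦_⟧ : ∀ {n d} → Vec (Fin n) d → Subset n
⟦ [] ⟧     = ∅
⟦ x ∷ xs ⟧ = ⁅ x ⁆ ∪ ⟦ xs ⟧

module _ {n : ℕ} where
  ∪-swap : ∀ (S T U : Subset n) → S ∪ T ∪ U ≡ T ∪ S ∪ U
  ∪-swap S T U = trans (sym (Sub.∪-assoc S T U)) (trans (cong (_∪ U) (Sub.∪-comm S T)) (Sub.∪-assoc T S U))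

  ∈⁅⁆∪⁻ : ∀ x (S : Subset n) {y} → y ∈ ⁅ x ⁆ ∪ S → y ≡ x ⊎ y ∈ S
  ∈⁅⁆∪⁻ x S y∈ = [ inj₁ ∘ Sub.x∈⁅y⁆⇒x≡y x , inj₂ ]′ (Sub.x∈p∪q⁻ ⁅ x ⁆ S y∈)

  x∈⁅x⁆∪ : ∀ x (S : Subset n) → x ∈ ⁅ x ⁆ ∪ S
  x∈⁅x⁆∪ x S = Sub.p⊆p∪q S (Sub.x∈⁅x⁆ x)

  ∈⇒∈⁅⁆∪ : ∀ x (S : Subset n) {y} → y ∈ S → y ∈ ⁅ x ⁆ ∪ S
  ∈⇒∈⁅⁆∪ x S = Sub.q⊆p∪q ⁅ x ⁆ S

  Distinct : ∀ {d} → Vec (Fin n) d → Set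
  Distinct []       = Unit.⊤
  Distinct (x ∷ xs) = x ∉ ⟦ xs ⟧ × Distinct xs

  distinct-size : ∀ {d} (xs : Vec (Fin n) d) → Distinct xs → ∣ ⟦ xs ⟧ ∣ ≡ d
  distinct-size []       _            = Sub.∣⊥∣≡0 n
  distinct-size (x ∷ xs) (x∉xs , dxs) = trans (∣⁅x⁆∪S∣ x ⟦ xs ⟧ x∉xs) (cong suc (distinct-size xs dxs))

∧-true : ∀ {a b} → a ∧ b ≡ true → a ≡ true × b ≡ true
∧-true {true} {true} _ = refl , refl

does⇒ : ∀ {A : Set} (a? : Dec A) → does a? ≡ true → A
does⇒ (yes a) _ = a

bool-ext : ∀ {a b} → (a ≡ true → b ≡ true) → (b ≡ true → a ≡ true) → a ≡ b
bool-ext {true}  {b}     f g = sym (f refl)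
bool-ext {false} {true}  f g = g refl
bool-ext {false} {false} f g = refl

module Chains {c ℓ} (Γ : AbelianGroup c ℓ)
              (stable : ∀ x y → Stable (AbelianGroup._≈_ Γ x y)) (n : ℕ) where
  open AbelianGroup Γ public
    using (Carrier; _≈_; _∙_; ε; _⁻¹; setoid; ∙-cong; ∙-congˡ; ∙-congʳ; ⁻¹-cong; identityˡ; identityʳ; assoc; comm; inverseʳ; inverseˡ)
    renaming (refl to ≈-refl; sym to ≈-sym; trans to ≈-trans; reflexive to ≈-reflexive)
  open CommutativeMonoidSum (AbelianGroup.commutativeMonoid Γ) public
    using (sum; sum-cong-≋; ∑-distrib-+; ∑-comm; sum-replicate-zero)
  open AbelianGroupProperties Γ public using (⁻¹-∙-comm; ε⁻¹≈ε; ⁻¹-involutive)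
  open import Relation.Binary.Reasoning.Setoid setoid public

  Chainᵃ : ℕ → Set c
  Chainᵃ d = Vec (Fin n) d → Carrier

  nonzero-stable : ∀ {x} → (¬ (x ≈ ε) → x ≈ ε) → x ≈ ε
  nonzero-stable {x = x} f = stable x ε (λ h → h (f h))

  sum-ε : ∀ {K} {f : Fin K → Carrier} → (∀ i → f i ≈ ε) → sum f ≈ ε
  sum-ε {K} f≈ε = ≈-trans (sum-cong-≋ f≈ε) (sum-replicate-zero K)

  sum-single : ∀ {K} (f : Fin K → Carrier) i → (∀ j → j ≢ i → f j ≈ ε) → sum f ≈ f i
  sum-single f zero    h = ≈-trans (∙-congˡ (sum-ε (λ j → h (suc j) (λ ())))) (identityʳ _)
  sum-single f (suc i) h = ≈-trans (∙-cong (h zero (λ ())) (sum-single (f ∘ suc) i (λ j j≢i → h (suc j) (j≢i ∘ Fin.suc-injective)))) (identityˡ _)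

  sum-⁻¹ : ∀ {K} (f : Fin K → Carrier) → sum (λ i → f i ⁻¹) ≈ sum f ⁻¹
  sum-⁻¹ {zero}  f = ≈-sym ε⁻¹≈ε
  sum-⁻¹ {suc K} f = ≈-trans (∙-congˡ (sum-⁻¹ (f ∘ suc))) (⁻¹-∙-comm _ _)

  interchange : ∀ w x y z → (w ∙ x) ∙ (y ∙ z) ≈ (w ∙ y) ∙ (x ∙ z)
  interchange w x y z = begin
    (w ∙ x) ∙ (y ∙ z)  ≈⟨ assoc w x _ ⟩
    w ∙ (x ∙ (y ∙ z))  ≈⟨ ∙-congˡ (assoc x y z) ⟨
    w ∙ ((x ∙ y) ∙ z)  ≈⟨ ∙-congˡ (∙-congʳ (comm x y)) ⟩
    w ∙ ((y ∙ x) ∙ z)  ≈⟨ ∙-congˡ (assoc y x z) ⟩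
    w ∙ (y ∙ (x ∙ z))  ≈⟨ assoc w y _ ⟨
    (w ∙ y) ∙ (x ∙ z)  ∎

  -- The diagonal has to be assumed zero because Γ may have 2-torsion.
  sum-antisymmetric : ∀ {K} (f : Fin K → Fin K → Carrier) →
    (∀ i j → f i j ≈ f j i ⁻¹) → (∀ i → f i i ≈ ε) → sum (λ i → sum (f i)) ≈ ε
  sum-antisymmetric {zero}  f anti diag = ≈-refl
  sum-antisymmetric {suc K} f anti diag = begin
    (f zero zero ∙ r) ∙ sum (λ i → f (suc i) zero ∙ sum (f (suc i) ∘ suc))
      ≈⟨ ∙-cong (≈-trans (∙-congʳ (diag zero)) (identityˡ r))
           (∑-distrib-+ (λ i → f (suc i) zero) (λ i → sum (f (suc i) ∘ suc))) ⟩
    r ∙ (sum (λ i → f (suc i) zero) ∙ sum (λ i → sum (f (suc i) ∘ suc)))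
      ≈⟨ ∙-congˡ (∙-cong (≈-trans (sum-cong-≋ (λ i → anti (suc i) zero)) (sum-⁻¹ (f zero ∘ suc)))
           (sum-antisymmetric (λ i j → f (suc i) (suc j)) (λ i j → anti (suc i) (suc j)) (diag ∘ suc))) ⟩
    r ∙ (r ⁻¹ ∙ ε)  ≈⟨ ∙-congˡ (identityʳ _) ⟩
    r ∙ r ⁻¹        ≈⟨ inverseʳ r ⟩
    ε               ∎
    where r = sum (f zero ∘ suc)

  -- Only the first two entries are compared; `Alternating` repeats this after fixing the head and
  -- so reaches all adjacent entries. Vanishing on repeated entries is demanded separately because
  -- of 2-torsion.
  AlternatingHead : ∀ d → Chainᵃ (suc d) → Set ℓ
  AlternatingHead zero    f = Unit.⊤
  AlternatingHead (suc d) f = (∀ x y zs → f (x ∷ y ∷ zs) ≈ f (y ∷ x ∷ zs) ⁻¹) × (∀ x zs → f (x ∷ x ∷ zs) ≈ ε)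

  Alternating : ∀ d → Chainᵃ d → Set ℓ
  Alternating zero    f = Unit.⊤
  Alternating (suc d) f = AlternatingHead d f × (∀ x → Alternating d (f ∘ (x ∷_)))

  -- The usual boundary up to one global sign: placing the new vertex first absorbs the sign of its
  -- position.
  boundary : ∀ {d} → Chainᵃ (suc d) → Chainᵃ d
  boundary f ys = sum (λ x → f (x ∷ ys))

  Cycle : ∀ {d} → Chainᵃ (suc d) → Set ℓ
  Cycle f = ∀ ys → boundary f ys ≈ ε

  infixl 5 _↾_
  _↾_ : ∀ {d} → Chainᵃ d → (Subset n → Bool) → Chainᵃ d
  (f ↾ P) xs = if P ⟦ xs ⟧ then f xs else ε

  alternatingHead-sum : ∀ d {K} (f : Fin K → Chainᵃ (suc d)) → (∀ i → AlternatingHead d (f i)) →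
    AlternatingHead d (λ xs → sum (λ i → f i xs))
  alternatingHead-sum zero    f alt = _
  alternatingHead-sum (suc d) f alt =
    (λ x y zs → ≈-trans (sum-cong-≋ (λ i → proj₁ (alt i) x y zs)) (sum-⁻¹ (λ i → f i (y ∷ x ∷ zs)))) ,
    λ x zs → sum-ε (λ i → proj₂ (alt i) x zs)

  alternating-sum : ∀ d {K} (f : Fin K → Chainᵃ d) → (∀ i → Alternating d (f i)) →
                    Alternating d (λ xs → sum (λ i → f i xs))
  alternating-sum zero    f alt = _
  alternating-sum (suc d) f alt = alternatingHead-sum d f (proj₁ ∘ alt) ,
    λ x → alternating-sum d (λ i → f i ∘ (x ∷_)) (λ i → proj₂ (alt i) x)

  alternating-boundary : ∀ {d} {f : Chainᵃ (suc d)} → Alternating (suc d) f → Alternating d (boundary f)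
  alternating-boundary {d} {f} (_ , alt) = alternating-sum d (λ x → f ∘ (x ∷_)) alt

  if-⁻¹ : ∀ b {x y} → x ≈ y ⁻¹ → (if b then x else ε) ≈ (if b then y else ε) ⁻¹
  if-⁻¹ true  x≈y⁻¹ = x≈y⁻¹
  if-⁻¹ false _     = ≈-sym ε⁻¹≈ε

  if-ε : ∀ b {x} → x ≈ ε → (if b then x else ε) ≈ ε
  if-ε true  x≈ε = x≈ε
  if-ε false _   = ≈-refl

  if-cong : ∀ b {x y} → x ≈ y → (if b then x else ε) ≈ (if b then y else ε)
  if-cong true  x≈y = x≈y
  if-cong false _   = ≈-refl

  alternatingHead-∣ : ∀ d {f : Chainᵃ (suc d)} P → AlternatingHead d f → AlternatingHead d (f ↾ P)
  alternatingHead-∣ zero    P alt = _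
  alternatingHead-∣ (suc d) {f} P (swap , diag) =
    (λ x y zs → ≈-trans
      (≈-reflexive (cong (λ S → if P S then f (x ∷ y ∷ zs) else ε) (∪-swap ⁅ x ⁆ ⁅ y ⁆ ⟦ zs ⟧)))
      (if-⁻¹ (P ⟦ y ∷ x ∷ zs ⟧) (swap x y zs))) ,
    λ x zs → if-ε (P ⟦ x ∷ x ∷ zs ⟧) (diag x zs)

  alternating-∣ : ∀ d {f : Chainᵃ d} P → Alternating d f → Alternating d (f ↾ P)
  alternating-∣ zero    P alt = _
  alternating-∣ (suc d) P (head , alt) = alternatingHead-∣ d P head ,
    λ x → alternating-∣ d (λ S → P (⁅ x ⁆ ∪ S)) (alt x)

  alternating-repeat : ∀ {d} {f : Chainᵃ (suc d)} → Alternating (suc d) f → ∀ x zs → x ∈ ⟦ zs ⟧ → f (x ∷ zs) ≈ ε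
  alternating-repeat alt x [] x∈ = contradiction x∈ Sub.∉⊥
  alternating-repeat {suc d} {f} ((swap , diag) , alt) x (z ∷ zs) x∈ with ∈⁅⁆∪⁻ z ⟦ zs ⟧ x∈
  ... | inj₁ refl = diag x zs
  ... | inj₂ x∈zs = begin
    f (x ∷ z ∷ zs)      ≈⟨ swap x z zs ⟩
    f (z ∷ x ∷ zs) ⁻¹   ≈⟨ ⁻¹-cong (alternating-repeat (alt z) x zs x∈zs) ⟩
    ε ⁻¹                ≈⟨ ε⁻¹≈ε ⟩
    ε                   ∎

  nonzero-distinct : ∀ {d} {f : Chainᵃ d} → Alternating d f → ∀ xs → ¬ (f xs ≈ ε) → Distinct xs
  nonzero-distinct alt []       f≉ε = _
  nonzero-distinct alt (x ∷ xs) f≉ε =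
    (λ x∈xs → f≉ε (alternating-repeat alt x xs x∈xs)) , nonzero-distinct (proj₂ alt x) xs f≉ε

  nonzero-size : ∀ {d} {f : Chainᵃ d} → Alternating d f → ∀ xs → ¬ (f xs ≈ ε) → ∣ ⟦ xs ⟧ ∣ ≡ d
  nonzero-size alt xs f≉ε = distinct-size xs (nonzero-distinct alt xs f≉ε)

  -- Only vanishing is transported along the permutation, so its sign never has to be named.
  bring-front : ∀ {d} u (ys : Vec (Fin n) (suc d)) → u ∈ ⟦ ys ⟧ → Σ (Vec (Fin n) d) λ K →
    ⟦ u ∷ K ⟧ ≡ ⟦ ys ⟧ × (∀ {f} → Alternating (suc d) f → f (u ∷ K) ≈ ε → f ys ≈ ε)
  bring-front u (y ∷ ys) u∈ with ∈⁅⁆∪⁻ y ⟦ ys ⟧ u∈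
  bring-front u (y ∷ ys)      u∈ | inj₁ refl = ys , refl , λ _ h → h
  bring-front u (y ∷ [])      u∈ | inj₂ u∈ys = contradiction u∈ys Sub.∉⊥
  bring-front u (y ∷ z ∷ ys)  u∈ | inj₂ u∈ys = let K , K≡ , front = bring-front u (z ∷ ys) u∈ys in
    y ∷ K , trans (∪-swap ⁅ u ⁆ ⁅ y ⁆ ⟦ K ⟧) (cong (⁅ y ⁆ ∪_) K≡) ,
    λ { {f} ((swap , _) , alt) h → front (alt y) (begin
      f (y ∷ u ∷ K)      ≈⟨ swap y u K ⟩
      f (u ∷ y ∷ K) ⁻¹   ≈⟨ ⁻¹-cong h ⟩
      ε ⁻¹               ≈⟨ ε⁻¹≈ε ⟩
      ε                  ∎) }

  boundary-boundary : ∀ {d} {f : Chainᵃ (suc (suc d))} → Alternating (suc (suc d)) f →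
                      ∀ zs → boundary (boundary f) zs ≈ ε
  boundary-boundary {f = f} ((swap , diag) , _) zs = sum-antisymmetric (λ y x → f (x ∷ y ∷ zs))
    (λ y x → swap x y zs) (λ x → diag x zs)

  boundary-link : ∀ {d} {f : Chainᵃ (suc (suc d))} → Alternating (suc (suc d)) f →
                  ∀ v zs → boundary f (v ∷ zs) ≈ boundary (f ∘ (v ∷_)) zs ⁻¹
  boundary-link {f = f} ((swap , _) , _) v zs =
    ≈-trans (sum-cong-≋ (λ x → swap x v zs)) (sum-⁻¹ (λ x → f (v ∷ x ∷ zs)))

  ∣-true : ∀ {d} (f : Chainᵃ d) P xs → P ⟦ xs ⟧ ≡ true → (f ↾ P) xs ≈ f xs
  ∣-true f P xs e = ≈-reflexive (cong (if_then f xs else ε) e)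

  ∣-false : ∀ {d} (f : Chainᵃ d) P xs → P ⟦ xs ⟧ ≡ false → (f ↾ P) xs ≈ ε
  ∣-false f P xs e = ≈-reflexive (cong (if_then f xs else ε) e)

  ∣-nonzero : ∀ {d} (f : Chainᵃ d) P xs → ¬ ((f ↾ P) xs ≈ ε) → P ⟦ xs ⟧ ≡ true × ¬ (f xs ≈ ε)
  ∣-nonzero f P xs h with P ⟦ xs ⟧
  ... | true  = refl , h
  ... | false = contradiction ≈-refl h

  ∣-agree : ∀ {d} (f : Chainᵃ d) P Q xs → (¬ (f xs ≈ ε) → P ⟦ xs ⟧ ≡ Q ⟦ xs ⟧) → (f ↾ P) xs ≈ (f ↾ Q) xs
  ∣-agree f P Q xs h = by-cases (stable _ _) λ
    { (yes f≈ε) → ≈-trans (if-ε (P ⟦ xs ⟧) f≈ε) (≈-sym (if-ε (Q ⟦ xs ⟧) f≈ε))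
    ; (no f≉ε)  → ≈-reflexive (cong (if_then f xs else ε) (h f≉ε)) }

  -- A facet with nonzero coefficient would have to be all of N. It would then be the only facet
  -- over each of its ridges, and its coefficient would be a value of the boundary.
  small-support : ∀ {e} {f : Chainᵃ (suc e)} → Alternating (suc e) f → Cycle f → ∀ N → ∣ N ∣ ≤ suc e →
    (∀ xs → ¬ (f xs ≈ ε) → ⟦ xs ⟧ ⊆ N) → ∀ xs → f xs ≈ ε
  small-support {e} {f} alt cycle N ∣N∣≤ supp (z ∷ L) = stable _ _ λ f≉ε → f≉ε (≈-trans
    (≈-sym (sum-single (λ x → f (x ∷ L)) z λ x x≢z → stable _ _ λ fx≉ε →
      let N≡ = ⊆∧≥⇒≡ (supp (z ∷ L) f≉ε) (ℕ.≤-trans ∣N∣≤ (ℕ.≤-reflexive (sym (nonzero-size alt (z ∷ L) f≉ε))))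
      in [ x≢z , proj₁ (nonzero-distinct alt (x ∷ L) fx≉ε) ]′
           (∈⁅⁆∪⁻ z ⟦ L ⟧ (subst (x ∈_) (sym N≡) (supp (x ∷ L) fx≉ε (x∈⁅x⁆∪ x ⟦ L ⟧))))))
    (cycle L))

-- Pushforward of chains along a vertex map

module Pushforward {c ℓ} (Γ : AbelianGroup c ℓ)
                   (stable : ∀ x y → Stable (AbelianGroup._≈_ Γ x y)) (n : ℕ) (φ : Fin n → Fin n) where
  open Chains Γ stable n

  private
    image? : ∀ S y → Dec (∃[ x ] x ∈ S × φ x ≡ y)
    image? S y = Fin.any? (λ x → (x ∈? S) ×-dec (φ x Fin.≟ y))

  image : Subset n → Subset n
  image S = tabulate (λ y → does (image? S y))

  ∈-image : ∀ S {x} → x ∈ S → φ x ∈ image S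
  ∈-image S {x} x∈S = ∈-subset (image? S) (x , x∈S , refl)

  ∈-image⁻ : ∀ S {y} → y ∈ image S → ∃[ x ] x ∈ S × φ x ≡ y
  ∈-image⁻ S = ∈-subset⁻ (image? S)

  image-∪ : ∀ x S → image (⁅ x ⁆ ∪ S) ≡ ⁅ φ x ⁆ ∪ image S
  image-∪ x S = Sub.⊆-antisym
    (λ y∈ → to (∈-image⁻ (⁅ x ⁆ ∪ S) y∈))
    (λ y∈ → [ (λ y≡ → subst (_∈ image (⁅ x ⁆ ∪ S)) (sym y≡) (∈-image (⁅ x ⁆ ∪ S) (x∈⁅x⁆∪ x S)))
            , (λ y∈S → from (∈-image⁻ S y∈S)) ]′ (∈⁅⁆∪⁻ (φ x) (image S) y∈))
    where
    to : ∀ {y} → ∃[ z ] z ∈ ⁅ x ⁆ ∪ S × φ z ≡ y → y ∈ ⁅ φ x ⁆ ∪ image S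
    to (z , z∈ , refl) with ∈⁅⁆∪⁻ x S z∈
    ... | inj₁ refl = x∈⁅x⁆∪ (φ x) (image S)
    ... | inj₂ z∈S  = ∈⇒∈⁅⁆∪ (φ x) (image S) (∈-image S z∈S)
    from : ∀ {y} → ∃[ z ] z ∈ S × φ z ≡ y → y ∈ image (⁅ x ⁆ ∪ S)
    from (z , z∈S , refl) = ∈-image (⁅ x ⁆ ∪ S) (∈⇒∈⁅⁆∪ x S z∈S)

  image-∅ : image ∅ ≡ ∅
  image-∅ = Sub.⊆-antisym (λ y∈ → contradiction (proj₁ (proj₂ (∈-image⁻ ∅ y∈))) Sub.∉⊥) (λ y∈ → contradiction y∈ Sub.∉⊥)

  -- The sum over all tuples that φ sends entrywise to the given one. Tuples with two entries of
  -- equal image cancel in pairs, which is the collapse of simplices.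
  push : ∀ {d} → Chainᵃ d → Chainᵃ d
  push f []       = f []
  push f (y ∷ ys) = sum (λ x → if does (φ x Fin.≟ y) then push (f ∘ (x ∷_)) ys else ε)

  push-cong : ∀ {d} {f g : Chainᵃ d} → (∀ xs → f xs ≈ g xs) → ∀ ys → push f ys ≈ push g ys
  push-cong f≈g []       = f≈g []
  push-cong f≈g (y ∷ ys) = sum-cong-≋ (λ x → if-cong (does (φ x Fin.≟ y)) (push-cong (f≈g ∘ (x ∷_)) ys))

  push-⁻¹ : ∀ {d} (f : Chainᵃ d) ys → push (λ xs → f xs ⁻¹) ys ≈ push f ys ⁻¹
  push-⁻¹ f []       = ≈-refl
  push-⁻¹ f (y ∷ ys) = ≈-trans
    (sum-cong-≋ (λ x → if-⁻¹ (does (φ x Fin.≟ y)) (push-⁻¹ (f ∘ (x ∷_)) ys)))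
    (sum-⁻¹ (λ x → if does (φ x Fin.≟ y) then push (f ∘ (x ∷_)) ys else ε))

  push-vanish : ∀ {d} (f : Chainᵃ d) ys → (∀ xs → image ⟦ xs ⟧ ≡ ⟦ ys ⟧ → f xs ≈ ε) → push f ys ≈ ε
  push-vanish f []       h = h [] image-∅
  push-vanish f (y ∷ ys) h = sum-ε λ x → term x (φ x Fin.≟ y)
    where
    term : ∀ x (d : Dec (φ x ≡ y)) → (if does d then push (f ∘ (x ∷_)) ys else ε) ≈ ε
    term x (no _)     = ≈-refl
    term x (yes refl) = push-vanish (f ∘ (x ∷_)) ys λ xs e →
      h (x ∷ xs) (trans (image-∪ x ⟦ xs ⟧) (cong (⁅ φ x ⁆ ∪_) e))

  if-sum : ∀ b {K} (f : Fin K → Carrier) → (if b then sum f else ε) ≈ sum (λ i → if b then f i else ε)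
  if-sum true      f = ≈-refl
  if-sum false {K} f = ≈-sym (sum-ε {K} {λ _ → ε} (λ i → ≈-refl))

  push-sum : ∀ {d K} (f : Fin K → Chainᵃ d) ys →
             push (λ xs → sum (λ i → f i xs)) ys ≈ sum (λ i → push (f i) ys)
  push-sum f []       = ≈-refl
  push-sum f (y ∷ ys) = begin
    sum (λ x → if does (φ x Fin.≟ y) then push (λ xs → sum (λ i → f i (x ∷ xs))) ys else ε)
      ≈⟨ sum-cong-≋ (λ x → ≈-trans (if-cong (does (φ x Fin.≟ y)) (push-sum (λ i → f i ∘ (x ∷_)) ys))
           (if-sum (does (φ x Fin.≟ y)) (λ i → push (f i ∘ (x ∷_)) ys))) ⟩
    sum (λ x → sum (λ i → if does (φ x Fin.≟ y) then push (f i ∘ (x ∷_)) ys else ε))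
      ≈⟨ ∑-comm (λ x i → if does (φ x Fin.≟ y) then push (f i ∘ (x ∷_)) ys else ε) ⟩
    sum (λ i → push (f i) (y ∷ ys)) ∎

  push-boundary : ∀ {d} (f : Chainᵃ (suc d)) ys → boundary (push f) ys ≈ push (boundary f) ys
  push-boundary f ys = begin
    sum (λ y → sum (λ x → if does (φ x Fin.≟ y) then push (f ∘ (x ∷_)) ys else ε))
      ≈⟨ ∑-comm (λ y x → if does (φ x Fin.≟ y) then push (f ∘ (x ∷_)) ys else ε) ⟩
    sum (λ x → sum (λ y → if does (φ x Fin.≟ y) then push (f ∘ (x ∷_)) ys else ε))
      ≈⟨ sum-cong-≋ (λ x → ≈-trans
           (sum-single (λ y → if does (φ x Fin.≟ y) then push (f ∘ (x ∷_)) ys else ε) (φ x)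
             (λ y y≢φx → ≈-reflexive (cong (if_then push (f ∘ (x ∷_)) ys else ε) (dec-false (φ x Fin.≟ y) (y≢φx ∘ sym)))))
           (≈-reflexive (cong (if_then push (f ∘ (x ∷_)) ys else ε) (dec-true (φ x Fin.≟ φ x) refl)))) ⟩
    sum (λ x → push (f ∘ (x ∷_)) ys)
      ≈⟨ push-sum (λ x → f ∘ (x ∷_)) ys ⟨
    push (boundary f) ys ∎

  push-cycle : ∀ {d} {f : Chainᵃ (suc d)} → Cycle f → Cycle (push f)
  push-cycle {f = f} cycle ys = ≈-trans (push-boundary f ys) (push-vanish (boundary f) ys (λ xs _ → cycle xs))

  alternating-if : ∀ d b {f : Chainᵃ d} → Alternating d f → Alternating d (λ xs → if b then f xs else ε)
  alternating-if d true  alt = alt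
  alternating-if d false alt = alternating-sum d {0} (λ ()) (λ ())

  push-alternatingHead : ∀ d {f : Chainᵃ (suc d)} → AlternatingHead d f → AlternatingHead d (push f)
  push-alternatingHead zero    alt = _
  push-alternatingHead (suc d) {f} (swap , diag) = swap′ , diag′
    where
    A : Vec (Fin n) d → Fin n → Fin n → Carrier
    A zs x x′ = push (λ xs → f (x ∷ x′ ∷ xs)) zs
    A-swap : ∀ zs x x′ → A zs x x′ ≈ A zs x′ x ⁻¹
    A-swap zs x x′ = ≈-trans (push-cong (λ xs → swap x x′ xs) zs) (push-⁻¹ (λ xs → f (x′ ∷ x ∷ xs)) zs)
    term : Fin n → Fin n → Vec (Fin n) d → Fin n → Fin n → Carrier
    term y y′ zs x x′ = if does (φ x Fin.≟ y) then (if does (φ x′ Fin.≟ y′) then A zs x x′ else ε) else ε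
    term-swap : ∀ y y′ zs x x′ → term y y′ zs x x′ ≈ term y′ y zs x′ x ⁻¹
    term-swap y y′ zs x x′ = swap-if (does (φ x Fin.≟ y)) (does (φ x′ Fin.≟ y′))
      where
      swap-if : ∀ b b′ → (if b then (if b′ then A zs x x′ else ε) else ε) ≈ (if b′ then (if b then A zs x′ x else ε) else ε) ⁻¹
      swap-if true  true  = A-swap zs x x′
      swap-if true  false = ≈-sym ε⁻¹≈ε
      swap-if false true  = ≈-sym ε⁻¹≈ε
      swap-if false false = ≈-sym ε⁻¹≈ε
    expand : ∀ y y′ zs → push f (y ∷ y′ ∷ zs) ≈ sum (λ x → sum (term y y′ zs x))
    expand y y′ zs = sum-cong-≋ (λ x → if-sum (does (φ x Fin.≟ y)) (λ x′ → if does (φ x′ Fin.≟ y′) then A zs x x′ else ε))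
    swap′ : ∀ y y′ zs → push f (y ∷ y′ ∷ zs) ≈ push f (y′ ∷ y ∷ zs) ⁻¹
    swap′ y y′ zs = begin
      push f (y ∷ y′ ∷ zs)                             ≈⟨ expand y y′ zs ⟩
      sum (λ x → sum (λ x′ → term y y′ zs x x′))       ≈⟨ ∑-comm (term y y′ zs) ⟩
      sum (λ x′ → sum (λ x → term y y′ zs x x′))       ≈⟨ sum-cong-≋ (λ x′ → ≈-trans (sum-cong-≋ (λ x → term-swap y y′ zs x x′)) (sum-⁻¹ (term y′ y zs x′))) ⟩
      sum (λ x′ → sum (term y′ y zs x′) ⁻¹)            ≈⟨ sum-⁻¹ (λ x′ → sum (term y′ y zs x′)) ⟩
      sum (λ x′ → sum (term y′ y zs x′)) ⁻¹            ≈⟨ ⁻¹-cong (expand y′ y zs) ⟨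
      push f (y′ ∷ y ∷ zs) ⁻¹                          ∎
    diag′ : ∀ y zs → push f (y ∷ y ∷ zs) ≈ ε
    diag′ y zs = ≈-trans (expand y y zs) (sum-antisymmetric (term y y zs) (term-swap y y zs)
      (λ x → if-ε (does (φ x Fin.≟ y)) (if-ε (does (φ x Fin.≟ y)) (push-vanish _ zs (λ xs _ → diag x xs)))))

  push-alternating : ∀ d {f : Chainᵃ d} → Alternating d f → Alternating d (push f)
  push-alternating zero    alt = _
  push-alternating (suc d) {f} (head , alt) = push-alternatingHead d {f} head , λ y →
    alternating-sum d (λ x ys → if does (φ x Fin.≟ y) then push (f ∘ (x ∷_)) ys else ε)
      (λ x → alternating-if d (does (φ x Fin.≟ y)) (push-alternating d {f ∘ (x ∷_)} (alt x)))

  push-∣ : ∀ {d} (f : Chainᵃ d) P ys → (push f ↾ P) ys ≈ push (f ↾ (λ S → P (image S))) ys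
  push-∣ f P []       = ≈-reflexive (cong (λ S → if P S then f [] else ε) (sym image-∅))
  push-∣ f P (y ∷ ys) = ≈-trans (if-sum (P ⟦ y ∷ ys ⟧) (λ x → if does (φ x Fin.≟ y) then push (f ∘ (x ∷_)) ys else ε)) (sum-cong-≋ (λ x → term x (φ x Fin.≟ y)))
    where
    term : ∀ x (d : Dec (φ x ≡ y)) →
      (if P ⟦ y ∷ ys ⟧ then (if does d then push (f ∘ (x ∷_)) ys else ε) else ε) ≈
      (if does d then push (f ∘ (x ∷_) ↾ (λ S → P (image (⁅ x ⁆ ∪ S)))) ys else ε)
    term x (no _)     = if-ε (P ⟦ y ∷ ys ⟧) ≈-refl
    term x (yes refl) = ≈-trans (push-∣ (f ∘ (x ∷_)) (λ S → P (⁅ φ x ⁆ ∪ S)) ys)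
      (push-cong (λ xs → ≈-reflexive (cong (λ S → if P S then f (x ∷ xs) else ε) (sym (image-∪ x ⟦ xs ⟧)))) ys)

-- Contraction of an edge and lifting of cycles

module Contraction {c ℓ} (Γ : AbelianGroup c ℓ)
                   (stable : ∀ x y → Stable (AbelianGroup._≈_ Γ x y)) (n : ℕ) (u v : Fin n) (u≢v : u ≢ v) where
  open Chains Γ stable n public

  φ : Fin n → Fin n
  φ x = if does (x Fin.≟ v) then u else x

  open Pushforward Γ stable n φ public

  φ-v : φ v ≡ u
  φ-v = cong (if_then u else v) (dec-true (v Fin.≟ v) refl)

  φ-≢ : ∀ {x} → x ≢ v → φ x ≡ x
  φ-≢ {x} x≢v = cong (if_then u else x) (dec-false (x Fin.≟ v) x≢v)

  push-fixed : ∀ {d} (f : Chainᵃ d) ys → u ∉ ⟦ ys ⟧ → v ∉ ⟦ ys ⟧ → push f ys ≈ f ys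
  push-fixed f []       u∉ v∉ = ≈-refl
  push-fixed f (y ∷ ys) u∉ v∉ = ≈-trans
    (sum-single (λ x → if does (φ x Fin.≟ y) then push (f ∘ (x ∷_)) ys else ε) y (λ x x≢y → ≈-reflexive (cong (if_then push (f ∘ (x ∷_)) ys else ε) (dec-false (φ x Fin.≟ y) (φx≢y x x≢y (x Fin.≟ v))))))
    (≈-trans (≈-reflexive (cong (if_then push (f ∘ (y ∷_)) ys else ε) (dec-true (φ y Fin.≟ y) (φ-≢ y≢v))))
      (push-fixed (f ∘ (y ∷_)) ys (u∉ ∘ ∈⇒∈⁅⁆∪ y ⟦ ys ⟧) (v∉ ∘ ∈⇒∈⁅⁆∪ y ⟦ ys ⟧)))
    where
    y≢v : y ≢ v
    y≢v refl = v∉ (x∈⁅x⁆∪ y ⟦ ys ⟧)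
    φx≢y : ∀ x → x ≢ y → Dec (x ≡ v) → φ x ≢ y
    φx≢y x x≢y (yes refl) e = u∉ (subst (_∈ ⟦ y ∷ ys ⟧) (trans (sym e) φ-v) (x∈⁅x⁆∪ y ⟦ ys ⟧))
    φx≢y x x≢y (no x≢v)   e = x≢y (trans (sym (φ-≢ x≢v)) e)

  push-merged : ∀ {d} (f : Chainᵃ (suc d)) K → u ∉ ⟦ K ⟧ → v ∉ ⟦ K ⟧ →
                push f (u ∷ K) ≈ f (u ∷ K) ∙ f (v ∷ K)
  push-merged f K u∉ v∉ = begin
    sum (λ x → if does (φ x Fin.≟ u) then A x else ε)
      ≈⟨ sum-cong-≋ (λ x → split x (x Fin.≟ u) (x Fin.≟ v)) ⟩
    sum (λ x → (if does (x Fin.≟ u) then A x else ε) ∙ (if does (x Fin.≟ v) then A x else ε))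
      ≈⟨ ∑-distrib-+ (λ x → if does (x Fin.≟ u) then A x else ε) (λ x → if does (x Fin.≟ v) then A x else ε) ⟩
    sum (λ x → if does (x Fin.≟ u) then A x else ε) ∙ sum (λ x → if does (x Fin.≟ v) then A x else ε)
      ≈⟨ ∙-cong (select u) (select v) ⟩
    A u ∙ A v
      ≈⟨ ∙-cong (push-fixed (f ∘ (u ∷_)) K u∉ v∉) (push-fixed (f ∘ (v ∷_)) K u∉ v∉) ⟩
    f (u ∷ K) ∙ f (v ∷ K) ∎
    where
    A : Fin n → Carrier
    A x = push (f ∘ (x ∷_)) K
    select : ∀ w → sum (λ x → if does (x Fin.≟ w) then A x else ε) ≈ A w
    select w = ≈-trans
      (sum-single (λ x → if does (x Fin.≟ w) then A x else ε) w (λ x x≢w → ≈-reflexive (cong (if_then A x else ε) (dec-false (x Fin.≟ w) x≢w))))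
      (≈-reflexive (cong (if_then A w else ε) (dec-true (w Fin.≟ w) refl)))
    split : ∀ x (d : Dec (x ≡ u)) (e : Dec (x ≡ v)) →
      (if does (φ x Fin.≟ u) then A x else ε) ≈ (if does d then A x else ε) ∙ (if does e then A x else ε)
    split x (yes x≡u) (yes x≡v) = contradiction (trans (sym x≡u) x≡v) u≢v
    split x (yes refl) (no x≢v) = ≈-trans (≈-reflexive (cong (if_then A x else ε) (dec-true (φ x Fin.≟ x) (φ-≢ x≢v)))) (≈-sym (identityʳ _))
    split x (no _) (yes refl)   = ≈-trans (≈-reflexive (cong (if_then A x else ε) (dec-true (φ x Fin.≟ u) φ-v))) (≈-sym (identityˡ _))
    split x (no x≢u) (no x≢v)   = ≈-trans (≈-reflexive (cong (if_then A x else ε) (dec-false (φ x Fin.≟ u) (λ e → x≢u (trans (sym (φ-≢ x≢v)) e))))) (≈-sym (identityˡ _))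

  apart : Subset n → Bool
  apart S = not (does (u ∈? S) ∧ does (v ∈? S))

  apart-u : ∀ {S} → u ∉ S → apart S ≡ true
  apart-u {S} u∉S = cong (λ b → not (b ∧ does (v ∈? S))) (dec-false (u ∈? S) u∉S)

  apart-v : ∀ {S} → v ∉ S → apart S ≡ true
  apart-v {S} v∉S = cong not (trans (cong (does (u ∈? S) ∧_) (dec-false (v ∈? S) v∉S)) (Bool.∧-zeroʳ _))

  together : ∀ {S} → u ∈ S → v ∈ S → apart S ≡ false
  together {S} u∈S v∈S = cong₂ (λ b c → not (b ∧ c)) (dec-true (u ∈? S) u∈S) (dec-true (v ∈? S) v∈S)

  apart⇒ : ∀ {S} → apart S ≡ true → ¬ (u ∈ S × v ∈ S)
  apart⇒ e (u∈S , v∈S) = contradiction (trans (sym e) (together u∈S v∈S)) (λ ())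

  -- Lifts a part of the contracted cycle back to f. Facets containing both u and v collapse and are
  -- left out. The boundary of what remains vanishes at ridges with both or neither of u and v; at
  -- uK and vK its values are opposite, and nothing more can be said.
  module Lift {d} (f : Chainᵃ (suc (suc d))) (alt : Alternating (suc (suc d)) f) (P : Subset n → Bool)
              (cycle : Cycle (push f ↾ P)) where
    liftedSet : Subset n → Bool
    liftedSet S = P (image S) ∧ apart S

    lifted : Chainᵃ (suc (suc d))
    lifted = f ↾ liftedSet

    lifted-alternating : Alternating (suc (suc d)) lifted
    lifted-alternating = alternating-∣ (suc (suc d)) {f} liftedSet alt

    private
      h : Chainᵃ (suc (suc d))
      h = f ↾ (λ S → P (image S))

      push-∂h : ∀ ys → push (boundary h) ys ≈ ε
      push-∂h ys = begin
        push (boundary h) ys     ≈⟨ push-boundary h ys ⟨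
        boundary (push h) ys     ≈⟨ sum-cong-≋ (λ y → push-∣ f P (y ∷ ys)) ⟨
        boundary (push f ↾ P) ys ≈⟨ cycle ys ⟩
        ε                        ∎

      h≈lifted : ∀ xs → apart ⟦ xs ⟧ ≡ true → h xs ≈ lifted xs
      h≈lifted xs e = ≈-reflexive (cong (if_then f xs else ε)
        (sym (trans (cong (P (image ⟦ xs ⟧) ∧_) e) (Bool.∧-identityʳ _))))

    lifted-together : ∀ xs → u ∈ ⟦ xs ⟧ → v ∈ ⟦ xs ⟧ → lifted xs ≈ ε
    lifted-together xs u∈ v∈ = ∣-false f liftedSet xs
      (trans (cong (P (image ⟦ xs ⟧) ∧_) (together u∈ v∈)) (Bool.∧-zeroʳ _))

    ∂lifted-together : ∀ ys → u ∈ ⟦ ys ⟧ → v ∈ ⟦ ys ⟧ → boundary lifted ys ≈ ε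
    ∂lifted-together ys u∈ v∈ = sum-ε (λ x → lifted-together (x ∷ ys) (∈⇒∈⁅⁆∪ x ⟦ ys ⟧ u∈) (∈⇒∈⁅⁆∪ x ⟦ ys ⟧ v∈))

    ∂lifted-neither : ∀ ys → u ∉ ⟦ ys ⟧ → v ∉ ⟦ ys ⟧ → boundary lifted ys ≈ ε
    ∂lifted-neither ys u∉ v∉ = begin
      boundary lifted ys     ≈⟨ sum-cong-≋ (λ x → h≈lifted (x ∷ ys) (x-apart x (x Fin.≟ u))) ⟨
      boundary h ys          ≈⟨ push-fixed (boundary h) ys u∉ v∉ ⟨
      push (boundary h) ys   ≈⟨ push-∂h ys ⟩
      ε                      ∎
      where
      x-apart : ∀ x → Dec (x ≡ u) → apart ⟦ x ∷ ys ⟧ ≡ true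
      x-apart x (yes refl) = apart-v ([ u≢v ∘ sym , v∉ ]′ ∘ ∈⁅⁆∪⁻ x ⟦ ys ⟧)
      x-apart x (no x≢u)   = apart-u ([ x≢u ∘ sym , u∉ ]′ ∘ ∈⁅⁆∪⁻ x ⟦ ys ⟧)

    private
      select : ∀ (w : Fin n) z → sum (λ x → if does (x Fin.≟ w) then z else ε) ≈ z
      select w z = ≈-trans
        (sum-single (λ x → if does (x Fin.≟ w) then z else ε) w (λ x x≢w → ≈-reflexive (cong (if_then z else ε) (dec-false (x Fin.≟ w) x≢w))))
        (≈-reflexive (cong (if_then z else ε) (dec-true (w Fin.≟ w) refl)))

      -- Passing from h to its part lifted loses the single term with both u and v.
      ∂h : ∀ w w′ K → (∀ {S} → w ∉ S → apart S ≡ true) → (lifted (w ∷ w′ ∷ K) ≈ ε) →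
           w ∉ ⟦ K ⟧ → w ≢ w′ → boundary h (w′ ∷ K) ≈ boundary lifted (w′ ∷ K) ∙ h (w ∷ w′ ∷ K)
      ∂h w w′ K ap tog w∉K w≢w′ = begin
        boundary h (w′ ∷ K)
          ≈⟨ sum-cong-≋ (λ x → term x (x Fin.≟ w)) ⟩
        sum (λ x → lifted (x ∷ w′ ∷ K) ∙ (if does (x Fin.≟ w) then h (w ∷ w′ ∷ K) else ε))
          ≈⟨ ∑-distrib-+ (λ x → lifted (x ∷ w′ ∷ K)) (λ x → if does (x Fin.≟ w) then h (w ∷ w′ ∷ K) else ε) ⟩
        boundary lifted (w′ ∷ K) ∙ sum (λ x → if does (x Fin.≟ w) then h (w ∷ w′ ∷ K) else ε)
          ≈⟨ ∙-congˡ (select w (h (w ∷ w′ ∷ K))) ⟩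
        boundary lifted (w′ ∷ K) ∙ h (w ∷ w′ ∷ K) ∎
        where
        term : ∀ x (e : Dec (x ≡ w)) → h (x ∷ w′ ∷ K) ≈ lifted (x ∷ w′ ∷ K) ∙ (if does e then h (w ∷ w′ ∷ K) else ε)
        term x (yes refl) = ≈-sym (≈-trans (∙-congʳ tog) (identityˡ _))
        term x (no x≢w)   = ≈-trans (h≈lifted (x ∷ w′ ∷ K) (ap λ w∈ →
          [ x≢w ∘ sym , (λ w∈′ → [ w≢w′ , w∉K ]′ (∈⁅⁆∪⁻ w′ ⟦ K ⟧ w∈′)) ]′ (∈⁅⁆∪⁻ x ⟦ w′ ∷ K ⟧ w∈)))
          (≈-sym (identityʳ _))

    ∂lifted-opposite : ∀ K → u ∉ ⟦ K ⟧ → v ∉ ⟦ K ⟧ →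
      boundary lifted (u ∷ K) ∙ boundary lifted (v ∷ K) ≈ ε
    ∂lifted-opposite K u∉ v∉ = begin
      a ∙ b                                ≈⟨ identityʳ _ ⟨
      (a ∙ b) ∙ ε                          ≈⟨ ∙-congˡ (≈-trans (∙-congʳ (proj₁ (proj₁ h-alt) v u K)) (inverseˡ _)) ⟨
      (a ∙ b) ∙ (h (v ∷ u ∷ K) ∙ h (u ∷ v ∷ K)) ≈⟨ interchange _ _ _ _ ⟩
      (a ∙ h (v ∷ u ∷ K)) ∙ (b ∙ h (u ∷ v ∷ K)) ≈⟨ ∙-cong
        (∂h v u K apart-v (lifted-together (v ∷ u ∷ K) (∈⇒∈⁅⁆∪ v ⟦ u ∷ K ⟧ (x∈⁅x⁆∪ u ⟦ K ⟧)) (x∈⁅x⁆∪ v ⟦ u ∷ K ⟧)) v∉ (u≢v ∘ sym))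
        (∂h u v K apart-u (lifted-together (u ∷ v ∷ K) (x∈⁅x⁆∪ u ⟦ v ∷ K ⟧) (∈⇒∈⁅⁆∪ u ⟦ v ∷ K ⟧ (x∈⁅x⁆∪ v ⟦ K ⟧))) u∉ u≢v) ⟨
      boundary h (u ∷ K) ∙ boundary h (v ∷ K)   ≈⟨ push-merged (boundary h) K u∉ v∉ ⟨
      push (boundary h) (u ∷ K)            ≈⟨ push-∂h (u ∷ K) ⟩
      ε                                    ∎
      where
      a = boundary lifted (u ∷ K)
      b = boundary lifted (v ∷ K)
      h-alt : Alternating (suc (suc d)) h
      h-alt = alternating-∣ (suc (suc d)) {f} (λ S → P (image S)) alt

-- Fogelsanger's induction on cycles

module SpanningSets {c ℓ} (Γ : AbelianGroup c ℓ)
                    (stable : ∀ x y → Stable (AbelianGroup._≈_ Γ x y)) (n e : ℕ) where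
  open Chains Γ stable n

  private
    d : ℕ
    d = suc (suc (suc e))

  -- E may have more edges than the support of f. This is needed after a contraction: facets may
  -- cancel, while the edges they brought remain available for derivations.
  Supported : Edges n → Subset n → Chainᵃ d → Set ℓ
  Supported E W f = ∀ xs → ¬ (f xs ≈ ε) → Clique E ⟦ xs ⟧ × ⟦ xs ⟧ ⊆ W

  Saturated : Edges n → Subset n → (Subset n → Bool) → Set
  Saturated E W P = ∀ B → B ⊆ W → Derived d E B → ∀ S T → S ⊆ B → T ⊆ B →
    ∣ S ∣ ≡ d → ∣ T ∣ ≡ d → P S ≡ true → P T ≡ true

  Minimal : Chainᵃ d → Set ℓ
  Minimal f = ∀ Q → Cycle (f ↾ Q) → ∀ xs → ¬ (f xs ≈ ε) → Q ⟦ xs ⟧ ≡ true →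
    ∀ ys → ¬ (f ys ≈ ε) → Q ⟦ ys ⟧ ≡ true

  SaturatedCycles : ℕ → Set (Level.suc 0ℓ Level.⊔ c Level.⊔ ℓ)
  SaturatedCycles m = ∀ (E : Edges n) → (∀ i j → Dec (E i j)) → ∀ W → ∣ W ∣ ≤ m →
    ∀ (f : Chainᵃ d) → Alternating d f → Cycle f → Supported E W f →
    ∀ P → Saturated E W P → Cycle (f ↾ P)

  Spanned : Edges n → Subset n → Chainᵃ d → Set ℓ
  Spanned E W f = ∃[ B ] B ⊆ W × Derived d E B × (∀ ys → ¬ (f ys ≈ ε) → ⟦ ys ⟧ ⊆ B)

  MinimalCyclesSpanned : ℕ → Set (Level.suc 0ℓ Level.⊔ c Level.⊔ ℓ)
  MinimalCyclesSpanned m = ∀ (E : Edges n) → (∀ i j → Dec (E i j)) → ∀ W → ∣ W ∣ ≤ m →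
    ∀ (f : Chainᵃ d) → Alternating d f → Cycle f → Supported E W f → Minimal f →
    ∀ xs → ¬ (f xs ≈ ε) → ¬ ¬ Spanned E W f

  -- A d-set inside both B and B′ already gives them d common vertices, so B swallows B′.
  absorbing⇒saturated : ∀ {E W B} → Absorbing {k = d} {E} W B → Saturated E W (λ S → does (S ⊆? B))
  absorbing⇒saturated {B = B} absorb B′ B′⊆W d′ S T S⊆ T⊆ ∣S∣ ∣T∣ PS = dec-true (T ⊆? B) λ x∈ →
    absorb B′ B′⊆W d′ (subst (_≤ ∣ B ∩ B′ ∣) ∣S∣ (Sub.p⊆q⇒∣p∣≤∣q∣ (∩-greatest {S = B} {B′} {S} (does⇒ (S ⊆? B) PS) S⊆))) (T⊆ x∈)

  module ContractEdge {m : ℕ} (IH : SaturatedCycles m) (E : Edges n) (E? : ∀ i j → Dec (E i j))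
    (W : Subset n) (∣W∣≤ : ∣ W ∣ ≤ suc m) (f : Chainᵃ d) (alt : Alternating d f) (cycle : Cycle f)
    (supp : Supported E W f) (minimal : Minimal f)
    (u v : Fin n) (K₀ : Vec (Fin n) (suc e)) (f₀ : ¬ (f (u ∷ v ∷ K₀) ≈ ε)) (u≢v : u ≢ v) where
    open Contraction Γ stable n u v u≢v
      using (φ; φ-v; φ-≢; image; ∈-image; ∈-image⁻; image-∪; image-∅; push; push-vanish; push-alternating; push-cycle; apart; apart-u; apart-v; apart⇒; module Lift)

    F₀ : Subset n
    F₀ = ⟦ u ∷ v ∷ K₀ ⟧

    u∈F₀ : u ∈ F₀
    u∈F₀ = x∈⁅x⁆∪ u ⟦ v ∷ K₀ ⟧

    v∈F₀ : v ∈ F₀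
    v∈F₀ = ∈⇒∈⁅⁆∪ u ⟦ v ∷ K₀ ⟧ (x∈⁅x⁆∪ v ⟦ K₀ ⟧)

    Euv : E u v
    Euv = proj₁ (supp _ f₀) u v u∈F₀ v∈F₀ u≢v

    u∈W : u ∈ W
    u∈W = proj₂ (supp _ f₀) u∈F₀

    v∈W : v ∈ W
    v∈W = proj₂ (supp _ f₀) v∈F₀

    E′ : Edges n
    E′ = contract u v E

    E′? : ∀ i j → Dec (E′ i j)
    E′? = contract? E?

    W′ : Subset n
    W′ = W ∩ ∁ ⁅ v ⁆

    ∈W′ : ∀ {x} → x ∈ W → x ≢ v → x ∈ W′
    ∈W′ x∈W x≢v = Sub.x∈p∩q⁺ (x∈W , Sub.x∉p⇒x∈∁p (x≢v ∘ Sub.x∈⁅y⁆⇒x≡y v))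

    ∈W : ∀ {x} → x ∈ W′ → x ∈ W
    ∈W x∈ = proj₁ (Sub.x∈p∩q⁻ W (∁ ⁅ v ⁆) x∈)

    v∉W′ : v ∉ W′
    v∉W′ v∈ = Sub.x∈∁p⇒x∉p (proj₂ (Sub.x∈p∩q⁻ W (∁ ⁅ v ⁆) v∈)) (Sub.x∈⁅x⁆ v)

    ∣W′∣≤ : ∣ W′ ∣ ≤ m
    ∣W′∣≤ = ℕ.≤-pred (ℕ.≤-trans (Sub.p⊂q⇒∣p∣<∣q∣ ((λ x∈ → ∈W x∈) , v , v∈W , v∉W′)) ∣W∣≤)

    φ-∈ : ∀ {S x} → x ∈ S → x ≢ v → x ∈ image S
    φ-∈ {S} x∈S x≢v = subst (_∈ image S) (φ-≢ x≢v) (∈-image S x∈S)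

    image-clique : ∀ {S} → Clique E S → Clique E′ (image S)
    image-clique {S} clique i j i∈ j∈ i≢j with ∈-image⁻ S i∈ | ∈-image⁻ S j∈
    ... | x , x∈ , refl | y , y∈ , refl = edge x y x∈ y∈ i≢j (x Fin.≟ v) (y Fin.≟ v)
      where
      edge : ∀ x y → x ∈ S → y ∈ S → φ x ≢ φ y → Dec (x ≡ v) → Dec (y ≡ v) → E′ (φ x) (φ y)
      edge x y x∈ y∈ ne (yes refl) (yes refl) = contradiction refl ne
      edge x y x∈ y∈ ne (yes refl) (no y≢v) =
        inj₂ (inj₁ (φ-v , subst (E v) (sym (φ-≢ y≢v)) (clique v y x∈ y∈ (y≢v ∘ sym))))
      edge x y x∈ y∈ ne (no x≢v) (yes refl) =
        inj₂ (inj₂ (φ-v , subst (λ z → E z v) (sym (φ-≢ x≢v)) (clique x v x∈ y∈ x≢v)))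
      edge x y x∈ y∈ ne (no x≢v) (no y≢v) =
        inj₁ (subst (λ z → E z (φ y)) (sym (φ-≢ x≢v)) (subst (E x) (sym (φ-≢ y≢v)) (clique x y x∈ y∈ (ne ∘ cong φ))))

    image-⊆ : ∀ {S} → S ⊆ W → image S ⊆ W′
    image-⊆ {S} S⊆W i∈ with ∈-image⁻ S i∈
    ... | x , x∈ , refl = in-W′ (x Fin.≟ v)
      where
      in-W′ : Dec (x ≡ v) → φ x ∈ W′
      in-W′ (yes refl) = subst (_∈ W′) (sym φ-v) (∈W′ u∈W u≢v)
      in-W′ (no x≢v)   = subst (_∈ W′) (sym (φ-≢ x≢v)) (∈W′ (S⊆W x∈) x≢v)

    image-size : ∀ {d} (xs : Vec (Fin n) d) → Distinct xs → ¬ (u ∈ ⟦ xs ⟧ × v ∈ ⟦ xs ⟧) → ∣ image ⟦ xs ⟧ ∣ ≡ d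
    image-size []       _            _  = trans (cong ∣_∣ image-∅) (Sub.∣⊥∣≡0 n)
    image-size (x ∷ xs) (x∉xs , dxs) ap = trans (cong ∣_∣ (image-∪ x ⟦ xs ⟧)) (trans
      (∣⁅x⁆∪S∣ (φ x) (image ⟦ xs ⟧) fresh)
      (cong suc (image-size xs dxs (λ (u∈ , v∈) → ap (∈⇒∈⁅⁆∪ x ⟦ xs ⟧ u∈ , ∈⇒∈⁅⁆∪ x ⟦ xs ⟧ v∈)))))
      where
      clash : ∀ y → y ∈ ⟦ xs ⟧ → φ y ≡ φ x → Dec (x ≡ v) → Dec (y ≡ v) → Empty.⊥
      clash y y∈ e (yes refl) (yes refl) = x∉xs y∈
      clash y y∈ e (yes refl) (no y≢v) = ap (∈⇒∈⁅⁆∪ x ⟦ xs ⟧ (subst (_∈ ⟦ xs ⟧) (trans (sym (φ-≢ y≢v)) (trans e φ-v)) y∈) , x∈⁅x⁆∪ x ⟦ xs ⟧)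
      clash y y∈ e (no x≢v) (yes refl) = ap (subst (_∈ ⟦ x ∷ xs ⟧) (trans (sym (φ-≢ x≢v)) (trans (sym e) φ-v)) (x∈⁅x⁆∪ x ⟦ xs ⟧) , ∈⇒∈⁅⁆∪ x ⟦ xs ⟧ y∈)
      clash y y∈ e (no x≢v) (no y≢v) = x∉xs (subst (_∈ ⟦ xs ⟧) (trans (sym (φ-≢ y≢v)) (trans e (φ-≢ x≢v))) y∈)
      fresh : φ x ∉ image ⟦ xs ⟧
      fresh φx∈ = let y , y∈ , e = ∈-image⁻ ⟦ xs ⟧ φx∈ in clash y y∈ e (x Fin.≟ v) (y Fin.≟ v)

    push-supported : Supported E′ W′ (push f)
    push-supported ys nz = decidable-stable (clique? E′? ⟦ ys ⟧ ×-dec (⟦ ys ⟧ ⊆? W′)) λ ¬h →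
      nz (push-vanish f ys λ xs im≡ → nonzero-stable λ f≉ε → contradiction
        (subst (λ S → Clique E′ S × S ⊆ W′) im≡ (image-clique (proj₁ (supp xs f≉ε)) , image-⊆ (proj₂ (supp xs f≉ε)))) ¬h)

    push-saturated : ∀ P → Saturated E′ W′ P → Cycle (push f ↾ P)
    push-saturated = IH E′ E′? W′ ∣W′∣≤ (push f) (push-alternating d {f} alt) (push-cycle {f = f} cycle) push-supported

    -- The contraction keeps each facet F that does not contain uv in a
    -- rigid set B′ that lifts back to B′ ∪ {v}: otherwise u and v have too
    -- few common neighbours in B′ to support the boundary of the part of f
    -- lying over B′, which would be a proper subcycle.
    Lifting : Subset n → Subset n → Set
    Lifting F B′ = B′ ⊆ W′ × Derived d E′ B′ × image F ⊆ B′ × Splittable d E u v B′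

    module Cluster (xs : Vec (Fin n) d) (fxs : ¬ (f xs ≈ ε)) (ap : ¬ (u ∈ ⟦ xs ⟧ × v ∈ ⟦ xs ⟧))
      (B′ : Subset n) (im⊆ : image ⟦ xs ⟧ ⊆ B′) (B′⊆ : B′ ⊆ W′) (der : Derived d E′ B′)
      (absorb : Absorbing {k = d} {E′} W′ B′) where

      neighbour? : ∀ x → Dec (x ∈ B′ × x ≢ u × E u x × E v x)
      neighbour? x = (x ∈? B′) ×-dec ¬? (x Fin.≟ u) ×-dec E? u x ×-dec E? v x

      N : Subset n
      N = tabulate (λ x → does (neighbour? x))

      open Lift f alt (λ S → does (S ⊆? B′)) (push-saturated _ (absorbing⇒saturated {B = B′} absorb))

      lifted-facet : ∀ {ys} → ¬ (lifted ys ≈ ε) → Clique E ⟦ ys ⟧ × image ⟦ ys ⟧ ⊆ B′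
      lifted-facet {ys} nz with ∣-nonzero f liftedSet ys nz
      ... | P-ys , f-ys = proj₁ (supp ys f-ys) , does⇒ (image ⟦ ys ⟧ ⊆? B′) (proj₁ (∧-true P-ys))

      -- Up to sign the boundary of `lifted` at the ridges `u ∷ K`, that is, its failure to be a
      -- cycle. Being itself a boundary it is a cycle, of tuples of length d - 2; that this length
      -- is positive uses d ≥ 3.
      link : Chainᵃ (suc e)
      link = boundary (lifted ∘ (u ∷_))

      link-alternating : Alternating (suc e) link
      link-alternating = alternating-boundary {f = lifted ∘ (u ∷_)} (proj₂ lifted-alternating u)

      boundary≈link : ∀ K → boundary lifted (u ∷ K) ≈ link K ⁻¹
      boundary≈link = boundary-link {f = lifted} lifted-alternating u

      boundary-facet : ∀ w K → ¬ (boundary lifted (w ∷ K) ≈ ε) →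
        ∀ {x} → x ∈ ⟦ K ⟧ → x ≢ w → x ≢ v → ¬ ¬ (E w x × x ∈ B′)
      boundary-facet w K nz {x} x∈K x≢w x≢v k = nz (sum-ε λ z → nonzero-stable λ g≉ε →
        let clique , im⊆B′ = lifted-facet {z ∷ w ∷ K} g≉ε
            x∈F = ∈⇒∈⁅⁆∪ z ⟦ w ∷ K ⟧ (∈⇒∈⁅⁆∪ w ⟦ K ⟧ x∈K)
        in contradiction (clique w x (∈⇒∈⁅⁆∪ z ⟦ w ∷ K ⟧ (x∈⁅x⁆∪ w ⟦ K ⟧)) x∈F (x≢w ∘ sym) , im⊆B′ (φ-∈ x∈F x≢v)) k)

      -- If the defect at uK is nonzero, so is the opposite one at vK. Hence facets of `lifted`
      -- contain uK and vK, and cliques on them make every vertex of K a neighbour of both u and v.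
      link-support : ∀ K → ¬ (link K ≈ ε) → ⟦ K ⟧ ⊆ N
      link-support K nz {x} x∈K = ∈-subset neighbour? (decidable-stable (neighbour? x) λ k →
          boundary-facet u K ∂u≉ε x∈K (≢u x∈K) (≢v x∈K) λ (Eux , x∈B′) →
          boundary-facet v K ∂v≉ε x∈K (≢v x∈K) (≢v x∈K) λ (Evx , _) →
          k (x∈B′ , ≢u x∈K , Eux , Evx))
        where
        u∉K : u ∉ ⟦ K ⟧
        u∉K u∈K = nz (sum-ε λ z → alternating-repeat {f = lifted} lifted-alternating u (z ∷ K) (∈⇒∈⁅⁆∪ z ⟦ K ⟧ u∈K))
        v∉K : v ∉ ⟦ K ⟧
        v∉K v∈K = nz (sum-ε λ z → lifted-together (u ∷ z ∷ K) (x∈⁅x⁆∪ u ⟦ z ∷ K ⟧) (∈⇒∈⁅⁆∪ u ⟦ z ∷ K ⟧ (∈⇒∈⁅⁆∪ z ⟦ K ⟧ v∈K)))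
        ≢u : ∀ {x} → x ∈ ⟦ K ⟧ → x ≢ u
        ≢u x∈K refl = u∉K x∈K
        ≢v : ∀ {x} → x ∈ ⟦ K ⟧ → x ≢ v
        ≢v x∈K refl = v∉K x∈K
        ∂u≉ε : ¬ (boundary lifted (u ∷ K) ≈ ε)
        ∂u≉ε h = nz (≈-trans (≈-sym (⁻¹-involutive _)) (≈-trans (⁻¹-cong (≈-trans (≈-sym (boundary≈link K)) h)) ε⁻¹≈ε))
        ∂v≉ε : ¬ (boundary lifted (v ∷ K) ≈ ε)
        ∂v≉ε h = ∂u≉ε (≈-trans (≈-sym (≈-trans (∙-congˡ h) (identityʳ _))) (∂lifted-opposite K u∉K v∉K))

      few-neighbours : ¬ (u ∈ B′ × d ≤ suc ∣ N ∣) → ∀ K → link K ≈ ε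
      few-neighbours few K = on-u (u ∈? B′)
        where
        on-u : Dec (u ∈ B′) → link K ≈ ε
        on-u (no u∉B′) = sum-ε λ z → nonzero-stable λ g≉ε → contradiction
          (proj₂ (lifted-facet {u ∷ z ∷ K} g≉ε) (φ-∈ (x∈⁅x⁆∪ u ⟦ z ∷ K ⟧) u≢v)) u∉B′
        -- Failing `d ≤ suc |N|` means `|N| ≤ d - 2`, one vertex too few for a nonzero cycle of
        -- tuples of length d - 2.
        on-u (yes u∈B′) = small-support {f = link} link-alternating
          (boundary-boundary {f = lifted ∘ (u ∷_)} (proj₂ lifted-alternating u)) N
          (ℕ.≤-pred (ℕ.≤-pred (ℕ.≰⇒> λ d≤ → few (u∈B′ , d≤)))) link-support K

      few-neighbours⇒cycle : ¬ (u ∈ B′ × d ≤ suc ∣ N ∣) → Cycle lifted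
      few-neighbours⇒cycle few ys = on-uv (u ∈? ⟦ ys ⟧) (v ∈? ⟦ ys ⟧)
        where
        ∂alt : Alternating (suc (suc e)) (boundary lifted)
        ∂alt = alternating-boundary {f = lifted} lifted-alternating
        at-u : ∀ K → boundary lifted (u ∷ K) ≈ ε
        at-u K = ≈-trans (boundary≈link K) (≈-trans (⁻¹-cong (few-neighbours few K)) ε⁻¹≈ε)
        at-v : ∀ K → u ∉ ⟦ K ⟧ → Dec (v ∈ ⟦ K ⟧) → boundary lifted (v ∷ K) ≈ ε
        at-v K u∉K (yes v∈K) = alternating-repeat {f = boundary lifted} ∂alt v K v∈K
        at-v K u∉K (no v∉K)  = ≈-trans (≈-sym (≈-trans (∙-congʳ (at-u K)) (identityˡ _))) (∂lifted-opposite K u∉K v∉K)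
        on-uv : Dec (u ∈ ⟦ ys ⟧) → Dec (v ∈ ⟦ ys ⟧) → boundary lifted ys ≈ ε
        on-uv (yes u∈) (yes v∈) = ∂lifted-together ys u∈ v∈
        on-uv (no u∉)  (no v∉)  = ∂lifted-neither ys u∉ v∉
        on-uv (yes u∈) (no v∉)  = let K , _ , front = bring-front u ys u∈ in front {boundary lifted} ∂alt (at-u K)
        on-uv (no u∉)  (yes v∈) = let K , K≡ , front = bring-front v ys v∈ in
          front {boundary lifted} ∂alt (at-v K (λ u∈K → u∉ (subst (u ∈_) K≡ (∈⇒∈⁅⁆∪ v ⟦ K ⟧ u∈K))) (v ∈? ⟦ K ⟧))

      splittable : Splittable d E u v B′
      splittable = conclude ((u ∈? B′) ×-dec (d ℕ.≤? suc ∣ N ∣))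
        where
        ∈B′∪v : ⟦ xs ⟧ ⊆ B′ ∪ ⁅ v ⁆
        ∈B′∪v {x} x∈ = on-v (x Fin.≟ v)
          where
          on-v : Dec (x ≡ v) → x ∈ B′ ∪ ⁅ v ⁆
          on-v (yes refl) = Sub.q⊆p∪q B′ ⁅ v ⁆ (Sub.x∈⁅x⁆ v)
          on-v (no x≢v)   = Sub.p⊆p∪q ⁅ v ⁆ (im⊆ (φ-∈ x∈ x≢v))
        conclude : Dec (u ∈ B′ × d ≤ suc ∣ N ∣) → Splittable d E u v B′
        conclude (yes (u∈B′ , d≤)) = u∈B′ ,
          (N , (λ x∈ → proj₁ (∈-subset⁻ neighbour? x∈)) , d≤ ,
            (λ u∈N → proj₁ (proj₂ (∈-subset⁻ neighbour? u∈N)) refl) ,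
            (λ x x∈ → proj₂ (proj₂ (∈-subset⁻ neighbour? x∈)))) ,
          -- The facet `xs` itself serves as the pinning clique.
          (⟦ xs ⟧ , nonzero-size {f = f} alt xs fxs , proj₁ (supp xs fxs) , ∈B′∪v , ap)
        -- The subcycle `lifted` contains `xs`, so minimality would put every facet into
        -- `liftedSet`; but F₀ contains both u and v.
        conclude (no few) = contradiction (u∈F₀ , v∈F₀) (apart⇒ (proj₂ (∧-true
          (minimal liftedSet (few-neighbours⇒cycle few) xs fxs
            (cong₂ _∧_ (dec-true (image ⟦ xs ⟧ ⊆? B′) im⊆) xs-apart) (u ∷ v ∷ K₀) f₀))))
          where
          xs-apart : apart ⟦ xs ⟧ ≡ true
          xs-apart with u ∈? ⟦ xs ⟧
          ... | no  _  = refl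
          ... | yes u∈ with v ∈? ⟦ xs ⟧
          ...   | no  _  = refl
          ...   | yes v∈ = contradiction (u∈ , v∈) ap

    lifting : ∀ xs → ¬ (f xs ≈ ε) → ¬ (u ∈ ⟦ xs ⟧ × v ∈ ⟦ xs ⟧) → ¬ ¬ ∃ (Lifting ⟦ xs ⟧)
    lifting xs fxs ap k = maximal {k = d} {E′} {W′} {image ⟦ xs ⟧} (image-⊆ (proj₂ (supp xs fxs)))
      (derived-clique (image-size xs (nonzero-distinct {f = f} alt xs fxs) ap) (image-clique (proj₁ (supp xs fxs))))
      λ (B′ , im⊆ , B′⊆ , der , absorb) →
        k (B′ , B′⊆ , der , im⊆ , Cluster.splittable xs fxs ap B′ im⊆ B′⊆ der absorb)

    -- The facets inside the maximal derivable set B form a cycle. Ridges are told apart by how many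
    -- of u and v they contain: with exactly one, B absorbs the lifted sets directly; with none, the
    -- induction hypothesis is used; those with both follow from the rest.
    module Spanning (B : Subset n) (F₀⊆B : F₀ ⊆ B) (B⊆W : B ⊆ W) (absorb : Absorbing {k = d} {E} W B) where

      Lifted : Subset n → Set
      Lifted B′ = B′ ⊆ W′ × Derived d E′ B′ × Splittable d E u v B′

      lift-derived : ∀ {B′} → Lifted B′ → Derived d E (B′ ∪ ⁅ v ⁆)
      lift-derived (B′⊆ , der , sp) = derived-split (λ v∈ → v∉W′ (B′⊆ v∈)) Euv sp der

      lift-absorbed : ∀ {B′ S} → Lifted B′ → S ⊆ B → S ⊆ B′ ∪ ⁅ v ⁆ → d ≤ ∣ S ∣ → B′ ∪ ⁅ v ⁆ ⊆ B
      lift-absorbed {B′} {S} lft S⊆B S⊆ d≤ = absorb (B′ ∪ ⁅ v ⁆)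
        (∪-least {S = B′} {⁅ v ⁆} {W} (λ x∈ → ∈W (proj₁ lft x∈)) (⁅⁆⊆ {S = W} v∈W))
        (lift-derived lft) (ℕ.≤-trans d≤ (Sub.p⊆q⇒∣p∣≤∣q∣ (∩-greatest {S = B} {B′ ∪ ⁅ v ⁆} {S} S⊆B S⊆)))

      image⊆⇒⊆ : ∀ {S B′} → image S ⊆ B′ → S ⊆ B′ ∪ ⁅ v ⁆
      image⊆⇒⊆ {S} {B′} im⊆ {x} x∈ = on-v (x Fin.≟ v)
        where
        on-v : Dec (x ≡ v) → x ∈ B′ ∪ ⁅ v ⁆
        on-v (yes refl) = Sub.q⊆p∪q B′ ⁅ v ⁆ (Sub.x∈⁅x⁆ v)
        on-v (no x≢v)   = Sub.p⊆p∪q ⁅ v ⁆ (im⊆ (φ-∈ x∈ x≢v))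

      inB : Subset n → Bool
      inB S = does (S ⊆? B)

      g : Chainᵃ d
      g = f ↾ inB

      facet-stable : ∀ {S} → (¬ (S ⊆ B) → Empty.⊥) → S ⊆ B
      facet-stable {S} = decidable-stable (S ⊆? B)

      -- A facet through a ridge with exactly one of u and v lies in B as
      -- soon as the ridge does: its lifting contains the ridge, u and v.
      one-sided : ∀ w ys → w ∈ B → w ∉ ⟦ ys ⟧ →
        (∀ {B′} → u ∈ B′ → w ∈ B′ ∪ ⁅ v ⁆) →
        (∀ x → x ≢ w → ¬ (u ∈ ⟦ x ∷ ys ⟧ × v ∈ ⟦ x ∷ ys ⟧)) → boundary g ys ≈ ε
      one-sided w ys w∈B w∉ys w∈lift ap = by-cases {A = ∃[ x ] ¬ (f (x ∷ ys) ≈ ε) × ⟦ x ∷ ys ⟧ ⊆ B} (stable _ _) λ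
        { (yes (x , fx , x⊆B)) → ≈-trans (sum-cong-≋ (λ z → all-in x fx x⊆B z)) (cycle ys)
        ; (no none) → sum-ε (λ z → nonzero-stable λ gz → contradiction
            (z , proj₂ (∣-nonzero f inB (z ∷ ys) gz) ,
              (λ {_} → does⇒ (⟦ z ∷ ys ⟧ ⊆? B) (proj₁ (∣-nonzero f inB (z ∷ ys) gz)))) none) }
        where
        all-in : ∀ x → ¬ (f (x ∷ ys) ≈ ε) → ⟦ x ∷ ys ⟧ ⊆ B → ∀ z → g (z ∷ ys) ≈ f (z ∷ ys)
        all-in x fx x⊆B z = by-cases (stable _ _) λ
          { (yes fz≈ε) → ≈-trans (if-ε (inB ⟦ z ∷ ys ⟧) fz≈ε) (≈-sym fz≈ε)
          ; (no fz≉ε)  → ∣-true f inB (z ∷ ys) (dec-true (⟦ z ∷ ys ⟧ ⊆? B) (λ {_} → facet fz≉ε)) }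
          where
          ys⊆B : ⟦ ys ⟧ ⊆ B
          ys⊆B y∈ = x⊆B (∈⇒∈⁅⁆∪ x ⟦ ys ⟧ y∈)
          wys⊆B : ⟦ w ∷ ys ⟧ ⊆ B
          wys⊆B = ∪-least {S = ⁅ w ⁆} {⟦ ys ⟧} {B} (⁅⁆⊆ {S = B} w∈B) ys⊆B
          facet : ¬ (f (z ∷ ys) ≈ ε) → ⟦ z ∷ ys ⟧ ⊆ B
          facet fz = on-w (z Fin.≟ w)
            where
            on-w : Dec (z ≡ w) → ⟦ z ∷ ys ⟧ ⊆ B
            on-w (yes z≡w) = subst (λ z → ⟦ z ∷ ys ⟧ ⊆ B) (sym z≡w) wys⊆B
            on-w (no z≢w)  = facet-stable {⟦ z ∷ ys ⟧} λ ¬⊆ → lifting (z ∷ ys) fz (ap z z≢w) λ (B′ , B′⊆ , der , im⊆ , sp) →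
              let z⊆ = image⊆⇒⊆ {⟦ z ∷ ys ⟧} {B′} im⊆
                  lift⊆B = lift-absorbed {B′} {⟦ w ∷ ys ⟧} (B′⊆ , der , sp) wys⊆B
                    (∪-least {S = ⁅ w ⁆} {⟦ ys ⟧} {B′ ∪ ⁅ v ⁆} (⁅⁆⊆ {S = B′ ∪ ⁅ v ⁆} (w∈lift (proj₁ sp))) (λ y∈ → z⊆ (∈⇒∈⁅⁆∪ z ⟦ ys ⟧ y∈)))
                    (ℕ.≤-reflexive (sym (distinct-size (w ∷ ys) (w∉ys , proj₂ (nonzero-distinct {f = f} alt (z ∷ ys) fz)))))
              in ¬⊆ (λ x∈ → lift⊆B (z⊆ x∈))

      -- The counterpart, in the contraction, of lying inside B: the set is contained in a derivable
      -- set of the contraction whose lift lies in B.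
      Covered : Subset n → Set
      Covered S = ∃[ B′ ] Lifted B′ × S ⊆ B′ × B′ ∪ ⁅ v ⁆ ⊆ B

      splittable-mono : ∀ {B₁ B₂} → B₁ ⊆ B₂ → Splittable d E u v B₁ → Splittable d E u v B₂
      splittable-mono {B₁} {B₂} ⊆₂ (u∈ , (N , N⊆ , rest) , (F , size , clique , F⊆ , ap)) =
        ⊆₂ u∈ , (N , (λ x∈ → ⊆₂ (N⊆ x∈)) , rest) , (F , size , clique , F⊆′ , ap)
        where
        F⊆′ : F ⊆ B₂ ∪ ⁅ v ⁆
        F⊆′ x∈ = [ (λ h → Sub.p⊆p∪q ⁅ v ⁆ (⊆₂ h)) , Sub.q⊆p∪q B₂ ⁅ v ⁆ ]′ (Sub.x∈p∪q⁻ B₁ ⁅ v ⁆ (F⊆ x∈))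

      -- If S lies in both B₁ and B₂, these can be glued. The union is still splittable because the
      -- data for B₁ serve again, and its lift shares S with B, so B absorbs it.
      covered-saturated : (covered? : ∀ S → Dec (Covered S)) → Saturated E′ W′ (λ S → does (covered? S))
      covered-saturated covered? B₂ B₂⊆ der₂ S T S⊆ T⊆ ∣S∣ ∣T∣ cov with does⇒ (covered? S) cov
      ... | B₁ , (B₁⊆ , der₁ , sp₁) , S⊆B₁ , B₁v⊆B = dec-true (covered? T)
        (U , U-lifted , (λ x∈ → Sub.q⊆p∪q B₁ B₂ (T⊆ x∈)) , λ x∈ → lift-absorbed {U} {S} U-lifted
          (λ x∈ → B₁v⊆B (Sub.p⊆p∪q ⁅ v ⁆ (S⊆B₁ x∈)))
          (λ x∈ → Sub.p⊆p∪q ⁅ v ⁆ (Sub.p⊆p∪q B₂ (S⊆B₁ x∈)))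
          (ℕ.≤-reflexive (sym ∣S∣)) x∈)
        where
        U = B₁ ∪ B₂
        U-lifted : Lifted U
        U-lifted = ∪-least {S = B₁} {B₂} {W′} B₁⊆ B₂⊆ ,
          derived-glue {B₁ = B₁} {B₂} (subst (_≤ ∣ B₁ ∩ B₂ ∣) ∣S∣ (Sub.p⊆q⇒∣p∣≤∣q∣ (∩-greatest {S = B₁} {B₂} {S} S⊆B₁ S⊆))) der₁ der₂ ,
          splittable-mono {B₁} {U} (Sub.p⊆p∪q B₂) sp₁

      -- Every facet over such a ridge avoids u or v, so by `lifting` it lies in B exactly when its
      -- image is covered. Near this ridge g thus agrees with a lift of a cycle from the
      -- contraction, whose boundary vanishes here.
      neither : ∀ ys → u ∉ ⟦ ys ⟧ → v ∉ ⟦ ys ⟧ → boundary g ys ≈ ε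
      neither ys u∉ v∉ = stable _ _ λ ∂g≉ε → ¬¬-∀Subset (λ S → ¬¬-excluded-middle {A = Covered S}) λ covered? →
        ∂g≉ε (with-covered covered?)
        where
        with-covered : (∀ S → Dec (Covered S)) → boundary g ys ≈ ε
        with-covered covered? = ≈-trans (sum-cong-≋ (λ x → ∣-agree f inB liftedSet (x ∷ ys) (agree x))) (∂lifted-neither ys u∉ v∉)
          where
          open Lift f alt (λ S → does (covered? S)) (push-saturated _ (covered-saturated covered?))
          x-apart : ∀ x → Dec (x ≡ u) → apart ⟦ x ∷ ys ⟧ ≡ true
          x-apart x (yes refl) = apart-v ([ u≢v ∘ sym , v∉ ]′ ∘ ∈⁅⁆∪⁻ x ⟦ ys ⟧)
          x-apart x (no x≢u)   = apart-u ([ x≢u ∘ sym , u∉ ]′ ∘ ∈⁅⁆∪⁻ x ⟦ ys ⟧)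
          agree : ∀ x → ¬ (f (x ∷ ys) ≈ ε) → inB ⟦ x ∷ ys ⟧ ≡ liftedSet ⟦ x ∷ ys ⟧
          agree x fx = bool-ext
            (λ F⊆B → cong₂ _∧_
              (dec-true (covered? (image F)) (decidable-stable (covered? (image F)) λ k →
                lifting (x ∷ ys) fx (apart⇒ (x-apart x (x Fin.≟ u))) λ (B′ , B′⊆ , der , im⊆ , sp) →
                  k (B′ , (B′⊆ , der , sp) , im⊆ , λ x∈ → lift-absorbed {B′} {F} (B′⊆ , der , sp)
                    (does⇒ (F ⊆? B) F⊆B) (image⊆⇒⊆ {F} {B′} im⊆)
                    (ℕ.≤-reflexive (sym (nonzero-size {f = f} alt (x ∷ ys) fx))) x∈)))
              (x-apart x (x Fin.≟ u)))
            (λ cov → dec-true (F ⊆? B) λ x∈ → from-covered (does⇒ (covered? (image F)) (proj₁ (∧-true cov))) x∈)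
            where
            F = ⟦ x ∷ ys ⟧
            from-covered : Covered (image F) → F ⊆ B
            from-covered (B′ , _ , im⊆ , B′v⊆B) x∈ = B′v⊆B (image⊆⇒⊆ {F} {B′} im⊆ x∈)

      not-both : ∀ ys → Dec (u ∈ ⟦ ys ⟧) → Dec (v ∈ ⟦ ys ⟧) → ¬ (u ∈ ⟦ ys ⟧ × v ∈ ⟦ ys ⟧) → boundary g ys ≈ ε
      not-both ys (yes u∈) (yes v∈) ap = contradiction (u∈ , v∈) ap
      not-both ys (no u∉)  (no v∉)  ap = neither ys u∉ v∉
      not-both ys (yes u∈) (no v∉)  ap = one-sided v ys (F₀⊆B v∈F₀) v∉ (λ {B′} _ → Sub.q⊆p∪q B′ ⁅ v ⁆ (Sub.x∈⁅x⁆ v))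
        (λ x x≢v (_ , v∈) → [ x≢v ∘ sym , v∉ ]′ (∈⁅⁆∪⁻ x ⟦ ys ⟧ v∈))
      not-both ys (no u∉)  (yes v∈) ap = one-sided u ys (F₀⊆B u∈F₀) u∉ (λ {B′} u∈B′ → Sub.p⊆p∪q ⁅ v ⁆ u∈B′)
        (λ x x≢u (u∈ , _) → [ x≢u ∘ sym , u∉ ]′ (∈⁅⁆∪⁻ x ⟦ ys ⟧ u∈))

      -- On ridges uvL the boundary vanishes because ∂∂ = 0 and it already
      -- vanishes on all other ridges.
      g-cycle : Cycle g
      g-cycle ys = on-uv (u ∈? ⟦ ys ⟧) (v ∈? ⟦ ys ⟧)
        where
        g-alt : Alternating d g
        g-alt = alternating-∣ d {f} inB alt
        ∂alt : Alternating (suc (suc e)) (boundary g)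
        ∂alt = alternating-boundary {f = g} g-alt
        at-v : ∀ K → Dec (v ∈ ⟦ K ⟧) → boundary g (v ∷ K) ≈ ε
        at-v K (yes v∈K) = alternating-repeat {f = boundary g} ∂alt v K v∈K
        at-v K (no v∉K)  = ≈-trans
          (≈-sym (sum-single (λ x → boundary g (x ∷ K)) v (λ x x≢v → not-both (x ∷ K) (u ∈? ⟦ x ∷ K ⟧) (v ∈? ⟦ x ∷ K ⟧)
            (λ (_ , v∈) → [ x≢v ∘ sym , v∉K ]′ (∈⁅⁆∪⁻ x ⟦ K ⟧ v∈)))))
          (boundary-boundary {f = g} g-alt K)
        on-uv : Dec (u ∈ ⟦ ys ⟧) → Dec (v ∈ ⟦ ys ⟧) → boundary g ys ≈ ε
        on-uv (yes u∈) (yes v∈) = let K , _ , front = bring-front v ys v∈ in front {boundary g} ∂alt (at-v K (v ∈? ⟦ K ⟧))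
        on-uv (no u∉)  v∈?      = not-both ys (no u∉) v∈? (λ (u∈ , _) → u∉ u∈)
        on-uv (yes u∈) (no v∉)  = not-both ys (yes u∈) (no v∉) (λ (_ , v∈) → v∉ v∈)

      spans : ∀ ys → ¬ (f ys ≈ ε) → ⟦ ys ⟧ ⊆ B
      spans ys fys = does⇒ (⟦ ys ⟧ ⊆? B)
        (minimal inB g-cycle (u ∷ v ∷ K₀) f₀ (dec-true (F₀ ⊆? B) (λ {_} → F₀⊆B)) ys fys)

    spanned : ¬ ¬ Spanned E W f
    spanned k = maximal {k = d} {E} {W} {F₀} (proj₂ (supp _ f₀))
      (derived-clique (nonzero-size {f = f} alt _ f₀) (proj₁ (supp _ f₀)))
      λ (B , F₀⊆B , B⊆W , der , absorb) → k (B , B⊆W , der , Spanning.spans B F₀⊆B B⊆W absorb)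

  saturated⇒spanned : ∀ {m} → SaturatedCycles m → MinimalCyclesSpanned (suc m)
  saturated⇒spanned IH E E? W ∣W∣≤ f alt cycle supp minimal (u ∷ v ∷ K) nz =
    ContractEdge.spanned IH E E? W ∣W∣≤ f alt cycle supp minimal u v K nz
      λ { refl → nz (proj₂ (proj₁ alt) u K) }

  spanned-zero : MinimalCyclesSpanned 0
  spanned-zero E E? W ∣W∣≤0 f alt cycle supp minimal (x ∷ xs) nz = contradiction
    (ℕ.≤-trans (Sub.p⊆q⇒∣p∣≤∣q∣ (⁅⁆⊆ {S = W} (proj₂ (supp _ nz) (x∈⁅x⁆∪ x ⟦ xs ⟧)))) ∣W∣≤0)
    (subst (λ s → ¬ (s ≤ 0)) (sym (Sub.∣⁅x⁆∣≡1 x)) λ ())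

  private
    count : ∀ {n} → (Subset n → Bool) → ℕ
    count {zero}  P = if P [] then 1 else 0
    count {suc n} P = count (P ∘ (inside ∷_)) ℕ.+ count (P ∘ (outside ∷_))

    count-mono : ∀ {n} {P Q : Subset n → Bool} → (∀ S → P S ≡ true → Q S ≡ true) → count P ≤ count Q
    count-mono {zero} {P} {Q} P⇒Q with P [] | Q [] | P⇒Q []
    ... | false | _     | _ = z≤n
    ... | true  | true  | _ = ℕ.≤-refl
    ... | true  | false | h = contradiction (h refl) λ ()
    count-mono {suc n} P⇒Q = ℕ.+-mono-≤ (count-mono (P⇒Q ∘ (inside ∷_))) (count-mono (P⇒Q ∘ (outside ∷_)))

    count-< : ∀ {n} {P Q : Subset n → Bool} → (∀ S → P S ≡ true → Q S ≡ true) →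
              ∀ S → Q S ≡ true → P S ≡ false → count P < count Q
    count-< {zero} {P} {Q} P⇒Q [] Q≡ P≡ with P [] | Q []
    count-< {zero} P⇒Q [] refl refl | false | true = s≤s z≤n
    count-< {suc n} P⇒Q (inside  ∷ S) Q≡ P≡ = ℕ.+-mono-<-≤ (count-< (P⇒Q ∘ (inside ∷_)) S Q≡ P≡) (count-mono (P⇒Q ∘ (outside ∷_)))
    count-< {suc n} P⇒Q (outside ∷ S) Q≡ P≡ = ℕ.+-mono-≤-< (count-mono (P⇒Q ∘ (inside ∷_))) (count-< (P⇒Q ∘ (outside ∷_)) S Q≡ P≡)

  ∣-∣ : ∀ {d} (f : Chainᵃ d) (P Q : Subset n → Bool) xs → (f ↾ P ↾ Q) xs ≈ (f ↾ (λ S → P S ∧ Q S)) xs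
  ∣-∣ f P Q xs with P ⟦ xs ⟧ | Q ⟦ xs ⟧
  ... | true  | true  = ≈-refl
  ... | true  | false = ≈-refl
  ... | false | true  = ≈-refl
  ... | false | false = ≈-refl

  ∣-complement : ∀ {d} (f : Chainᵃ d) (P Q : Subset n → Bool) xs →
    (f ↾ P) xs ≈ (f ↾ (λ S → P S ∧ Q S)) xs ∙ (f ↾ (λ S → P S ∧ not (Q S))) xs
  ∣-complement f P Q xs with P ⟦ xs ⟧ | Q ⟦ xs ⟧
  ... | true  | true  = ≈-sym (identityʳ _)
  ... | true  | false = ≈-sym (identityˡ _)
  ... | false | true  = ≈-sym (identityʳ _)
  ... | false | false = ≈-sym (identityʳ _)

  boundary-cong : ∀ {d} {f g : Chainᵃ (suc d)} → (∀ xs → f xs ≈ g xs) → ∀ ys → boundary f ys ≈ boundary g ys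
  boundary-cong f≈g ys = sum-cong-≋ (λ x → f≈g (x ∷ ys))

  boundary-complement : ∀ {d} (f : Chainᵃ (suc d)) (P Q : Subset n → Bool) ys →
    boundary (f ↾ P) ys ≈ boundary (f ↾ (λ S → P S ∧ Q S)) ys ∙ boundary (f ↾ (λ S → P S ∧ not (Q S))) ys
  boundary-complement f P Q ys = ≈-trans (sum-cong-≋ (λ x → ∣-complement f P Q (x ∷ ys)))
    (∑-distrib-+ (λ x → (f ↾ (λ S → P S ∧ Q S)) (x ∷ ys)) (λ x → (f ↾ (λ S → P S ∧ not (Q S))) (x ∷ ys)))

  -- Decomposes f into minimal cycles, on each of which P is constant.
  module Decompose {m : ℕ} (spanned : MinimalCyclesSpanned m) (E : Edges n) (E? : ∀ i j → Dec (E i j))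
    (W : Subset n) (∣W∣≤ : ∣ W ∣ ≤ m) (f : Chainᵃ d) (alt : Alternating d f)
    (supp : Supported E W f) (P : Subset n → Bool) (saturated : Saturated E W P) where

    -- The tuples `xs` and `ys` need not carry a nonzero coefficient. They show that R cuts Q into
    -- two smaller families, and the size of the family is the measure of the recursion.
    Divisible : (Subset n → Bool) → Set ℓ
    Divisible Q = ∃[ R ] Cycle (f ↾ Q ↾ R) × Σ (Vec (Fin n) d) λ xs → Σ (Vec (Fin n) d) λ ys →
      (Q ⟦ xs ⟧ ≡ true × R ⟦ xs ⟧ ≡ true) × (Q ⟦ ys ⟧ ≡ true × R ⟦ ys ⟧ ≡ false)

    indivisible⇒minimal : ∀ Q → ¬ Divisible Q → Minimal (f ↾ Q)
    indivisible⇒minimal Q indiv R cyc xs fxs Rxs ys fys = on-R (R ⟦ ys ⟧) refl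
      where
      on-R : ∀ b → R ⟦ ys ⟧ ≡ b → R ⟦ ys ⟧ ≡ true
      on-R true  e = e
      on-R false e = contradiction (R , cyc , xs , ys ,
        (proj₁ (∣-nonzero f Q xs fxs) , Rxs) , (proj₁ (∣-nonzero f Q ys fys) , e)) indiv

    minimal-case : ∀ Q → Cycle (f ↾ Q) → Minimal (f ↾ Q) → Cycle (f ↾ Q ↾ P)
    minimal-case Q cyc minimal ys = by-cases {A = ∃[ xs ] ¬ ((f ↾ Q) xs ≈ ε) × P ⟦ xs ⟧ ≡ true} (stable _ _) λ
      { (no none) → sum-ε (λ x → nonzero-stable (λ h → let e , fx = ∣-nonzero (f ↾ Q) P (x ∷ ys) h in
          contradiction (x ∷ ys , fx , e) none))
      ; (yes (xs , fxs , Pxs)) → stable _ _ λ k →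
          spanned E E? W ∣W∣≤ (f ↾ Q) (alternating-∣ d {f} Q alt) cyc Q-supp minimal xs fxs
            λ (B , B⊆W , der , B⊇) → k (≈-trans (boundary-cong {f = f ↾ Q ↾ P} {f ↾ Q} (λ zs → constant xs fxs Pxs B B⊆W der B⊇ zs) ys) (cyc ys)) }
      where
      Q-supp : Supported E W (f ↾ Q)
      Q-supp xs h = supp xs (proj₂ (∣-nonzero f Q xs h))
      constant : ∀ xs → ¬ ((f ↾ Q) xs ≈ ε) → P ⟦ xs ⟧ ≡ true → ∀ B → B ⊆ W → Derived d E B →
        (∀ ys → ¬ ((f ↾ Q) ys ≈ ε) → ⟦ ys ⟧ ⊆ B) → ∀ zs → (f ↾ Q ↾ P) zs ≈ (f ↾ Q) zs
      constant xs fxs Pxs B B⊆W der B⊇ zs = by-cases (stable _ _) λ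
        { (yes z≈ε) → ≈-trans (if-ε (P ⟦ zs ⟧) z≈ε) (≈-sym z≈ε)
        ; (no z≉ε) → ∣-true (f ↾ Q) P zs (saturated B B⊆W der ⟦ xs ⟧ ⟦ zs ⟧ (B⊇ xs fxs) (B⊇ zs z≉ε) (size xs fxs) (size zs z≉ε) Pxs) }
        where
        size : ∀ xs → ¬ ((f ↾ Q) xs ≈ ε) → ∣ ⟦ xs ⟧ ∣ ≡ d
        size = nonzero-size {f = f ↾ Q} (alternating-∣ d {f} Q alt)

    decompose : ∀ N Q → count Q < N → Cycle (f ↾ Q) → Cycle (f ↾ Q ↾ P)
    decompose (suc N) Q (s≤s count≤) cyc ys = by-cases {A = Divisible Q} (stable _ _) λ
      { (no indiv) → minimal-case Q cyc (indivisible⇒minimal Q indiv) ys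
      ; (yes (R , cycR , xs , zs , (Qxs , Rxs) , (Qzs , Rzs))) →
        let Q₁ = λ S → Q S ∧ R S
            Q₂ = λ S → Q S ∧ not (R S)
            cyc₁ : Cycle (f ↾ Q₁)
            cyc₁ ys = ≈-trans (≈-sym (boundary-cong {f = f ↾ Q ↾ R} {f ↾ Q₁} (∣-∣ f Q R) ys)) (cycR ys)
            cyc₂ : Cycle (f ↾ Q₂)
            cyc₂ ys = begin
              boundary (f ↾ Q₂) ys                          ≈⟨ identityˡ _ ⟨
              ε ∙ boundary (f ↾ Q₂) ys                      ≈⟨ ∙-congʳ (cyc₁ ys) ⟨
              boundary (f ↾ Q₁) ys ∙ boundary (f ↾ Q₂) ys   ≈⟨ boundary-complement f Q R ys ⟨
              boundary (f ↾ Q) ys                           ≈⟨ cyc ys ⟩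
              ε                                             ∎
            less₁ = ℕ.≤-trans (count-< {P = Q₁} {Q} (λ S h → proj₁ (∧-true h)) ⟦ zs ⟧ Qzs (cong₂ _∧_ Qzs Rzs)) count≤
            less₂ = ℕ.≤-trans (count-< {P = Q₂} {Q} (λ S h → proj₁ (∧-true h)) ⟦ xs ⟧ Qxs (cong₂ (λ a b → a ∧ not b) Qxs Rxs)) count≤
        in begin
          boundary (f ↾ Q ↾ P) ys
            ≈⟨ boundary-cong {f = f ↾ Q ↾ P} {λ zs → (f ↾ Q₁ ↾ P) zs ∙ (f ↾ Q₂ ↾ P) zs} (split R) ys ⟩
          sum (λ x → (f ↾ Q₁ ↾ P) (x ∷ ys) ∙ (f ↾ Q₂ ↾ P) (x ∷ ys))
            ≈⟨ ∑-distrib-+ (λ x → (f ↾ Q₁ ↾ P) (x ∷ ys)) (λ x → (f ↾ Q₂ ↾ P) (x ∷ ys)) ⟩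
          boundary (f ↾ Q₁ ↾ P) ys ∙ boundary (f ↾ Q₂ ↾ P) ys
            ≈⟨ ∙-cong (decompose N Q₁ less₁ cyc₁ ys) (decompose N Q₂ less₂ cyc₂ ys) ⟩
          ε ∙ ε
            ≈⟨ identityˡ ε ⟩
          ε ∎ }
      where
      split : ∀ (R : Subset n → Bool) zs → (f ↾ Q ↾ P) zs ≈ (f ↾ (λ S → Q S ∧ R S) ↾ P) zs ∙ (f ↾ (λ S → Q S ∧ not (R S)) ↾ P) zs
      split R zs with P ⟦ zs ⟧
      ... | true  = ∣-complement f Q R zs
      ... | false = ≈-sym (identityˡ ε)

  spanned⇒saturated : ∀ {m} → MinimalCyclesSpanned m → SaturatedCycles m
  spanned⇒saturated spanned E E? W ∣W∣≤ f alt cycle supp P saturated =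
    Decompose.decompose spanned E E? W ∣W∣≤ f alt supp P saturated _ (λ _ → true) ℕ.≤-refl cycle

  saturatedCycles : ∀ m → SaturatedCycles m
  saturatedCycles zero    = spanned⇒saturated spanned-zero
  saturatedCycles (suc m) = spanned⇒saturated (saturated⇒spanned (saturatedCycles m))

-- Real velocities

pointwise⇒≈ℝ : ∀ {x y} → (∀ n → seq x n ≡ seq y n) → x ≈ℝ y
pointwise⇒≈ℝ {x} {y} eq ε 0<ε = 0 , λ n _ → subst (ℚ._< ε)
  (sym (trans (cong (λ q → ℚ.∣ q ℚ.- seq y n ∣) (eq n)) (cong ℚ.∣_∣ (ℚ.+-inverseʳ (seq y n))))) 0<ε

private
  half : ∀ {ε} → 0ℚ ℚ.< ε → 0ℚ ℚ.< ½ ℚ.* ε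
  half {ε} 0<ε = subst (ℚ._< ½ ℚ.* ε) (ℚ.*-zeroʳ ½) (ℚ.*-monoʳ-<-pos ½ 0<ε)

  two-halves : ∀ ε → ½ ℚ.* ε ℚ.+ ½ ℚ.* ε ≡ ε
  two-halves ε = trans (sym (ℚ.*-distribʳ-+ ε ½ ½)) (ℚ.*-identityˡ ε)

  null-sum : ∀ (x y z : ℕ → ℚ) → (∀ n → z n ≡ x n ℚ.+ y n) →
    (∀ ε → 0ℚ ℚ.< ε → Eventually (λ n → ℚ.∣ x n ∣ ℚ.< ε)) →
    (∀ ε → 0ℚ ℚ.< ε → Eventually (λ n → ℚ.∣ y n ∣ ℚ.< ε)) →
    ∀ ε → 0ℚ ℚ.< ε → Eventually (λ n → ℚ.∣ z n ∣ ℚ.< ε)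
  null-sum x y z z≡ hx hy ε 0<ε = eventually-map
    (λ n (hx , hy) → ℚ.≤-<-trans
      (ℚ.≤-trans (ℚ.≤-reflexive (cong ℚ.∣_∣ (z≡ n))) (ℚ.∣p+q∣≤∣p∣+∣q∣ (x n) (y n)))
      (subst (ℚ.∣ x n ∣ ℚ.+ ℚ.∣ y n ∣ ℚ.<_) (two-halves ε) (ℚ.+-mono-< hx hy)))
    (eventually-× (hx _ (half 0<ε)) (hy _ (half 0<ε)))

≈ℝ-sym : ∀ {x y} → x ≈ℝ y → y ≈ℝ x
≈ℝ-sym {x} {y} h ε 0<ε = eventually-map (λ n → subst (ℚ._< ε) (trans (sym (ℚ.∣-p∣≡∣p∣ (seq x n ℚ.- seq y n)))
  (cong ℚ.∣_∣ (solve 2 (λ a b → :- (a :- b) := b :- a) refl (seq x n) (seq y n))))) (h ε 0<ε)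
  where open +-*-Solver

≈ℝ-trans : ∀ {x y z} → x ≈ℝ y → y ≈ℝ z → x ≈ℝ z
≈ℝ-trans {x} {y} {z} = null-sum _ _ _
  (λ n → solve 3 (λ a b c → a :- c := (a :- b) :+ (b :- c)) refl (seq x n) (seq y n) (seq z n))
  where open +-*-Solver

+ℝ-cong : ∀ {x x′ y y′} → x ≈ℝ x′ → y ≈ℝ y′ → (x +ℝ y) ≈ℝ (x′ +ℝ y′)
+ℝ-cong {x} {x′} {y} {y′} = null-sum _ _ _
  (λ n → solve 4 (λ a a′ b b′ → (a :+ b) :- (a′ :+ b′) := (a :- a′) :+ (b :- b′)) refl (seq x n) (seq x′ n) (seq y n) (seq y′ n))
  where open +-*-Solver

-ℝ-cong : ∀ {x y} → x ≈ℝ y → (-ℝ x) ≈ℝ (-ℝ y)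
-ℝ-cong {x} {y} h ε 0<ε = eventually-map (λ n → subst (ℚ._< ε) (trans (sym (ℚ.∣-p∣≡∣p∣ (seq x n ℚ.- seq y n)))
  (cong ℚ.∣_∣ (solve 2 (λ a b → :- (a :- b) := :- a :- :- b) refl (seq x n) (seq y n))))) (h ε 0<ε)
  where open +-*-Solver

fromℚ-*-cong : ∀ {q r x y} → q ≡ r → x ≈ℝ y → (fromℚ q *ℝ x) ≈ℝ (fromℚ r *ℝ y)
fromℚ-*-cong {q} {_} {x} {y} refl h with q ℚ.≟ 0ℚ
... | yes refl = pointwise⇒≈ℝ {fromℚ 0ℚ *ℝ x} {fromℚ 0ℚ *ℝ y} (λ n → trans (ℚ.*-zeroˡ (seq x n)) (sym (ℚ.*-zeroˡ (seq y n))))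
... | no  q≢0  = λ ε 0<ε → eventually-map (λ n hn → subst (ℚ._< ε) (scaled n)
    (subst (ℚ.∣ q ∣ ℚ.* ℚ.∣ seq x n ℚ.- seq y n ∣ ℚ.<_) (cancel ε) (ℚ.*-monoʳ-<-pos ℚ.∣ q ∣ hn)))
  (h (ℚ.1/ ℚ.∣ q ∣ ℚ.* ε) (subst (ℚ._< ℚ.1/ ℚ.∣ q ∣ ℚ.* ε) (ℚ.*-zeroʳ (ℚ.1/ ℚ.∣ q ∣)) (ℚ.*-monoʳ-<-pos (ℚ.1/ ℚ.∣ q ∣) 0<ε)))
  where
  open +-*-Solver
  instance
    ∣q∣-positive : ℚ.Positive ℚ.∣ q ∣
    ∣q∣-positive = ℚ.positive (ℚ.≰⇒> (λ ∣q∣≤0 → q≢0 (ℚ.∣p∣≡0⇒p≡0 q (ℚ.≤-antisym ∣q∣≤0 (ℚ.0≤∣p∣ q)))))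
    ∣q∣-nonZero : ℚ.NonZero ℚ.∣ q ∣
    ∣q∣-nonZero = ℚ.pos⇒nonZero ℚ.∣ q ∣
    1/∣q∣-positive : ℚ.Positive (ℚ.1/ ℚ.∣ q ∣)
    1/∣q∣-positive = ℚ.1/pos⇒pos ℚ.∣ q ∣
  cancel : ∀ ε → ℚ.∣ q ∣ ℚ.* (ℚ.1/ ℚ.∣ q ∣ ℚ.* ε) ≡ ε
  cancel ε = trans (sym (ℚ.*-assoc ℚ.∣ q ∣ (ℚ.1/ ℚ.∣ q ∣) ε)) (trans (cong (ℚ._* ε) (ℚ.*-inverseʳ ℚ.∣ q ∣)) (ℚ.*-identityˡ ε))
  scaled : ∀ n → ℚ.∣ q ∣ ℚ.* ℚ.∣ seq x n ℚ.- seq y n ∣ ≡ ℚ.∣ q ℚ.* seq x n ℚ.- q ℚ.* seq y n ∣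
  scaled n = trans (sym (ℚ.∣p*q∣≡∣p∣*∣q∣ q (seq x n ℚ.- seq y n)))
    (cong ℚ.∣_∣ (solve 3 (λ q a b → q :* (a :- b) := q :* a :- q :* b) refl q (seq x n) (seq y n)))

ℝ-module : LeftModule ℚ.+-*-ring 0ℓ 0ℓ
ℝ-module = record
  { Carrierᴹ = ℝ
  ; _≈ᴹ_ = _≈ℝ_
  ; _+ᴹ_ = _+ℝ_
  ; _*ₗ_ = λ q x → fromℚ q *ℝ x
  ; 0ᴹ = 0ℝ
  ; -ᴹ_ = -ℝ_
  ; isLeftModule = record
    { isLeftSemimodule = record
      { +ᴹ-isCommutativeMonoid = record
        { isMonoid = record
          { isSemigroup = record
            { isMagma = record
              { isEquivalence = record
                { refl = λ {x} → pointwise⇒≈ℝ {x} {x} (λ _ → refl)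
                ; sym = λ {x} {y} → ≈ℝ-sym {x} {y}
                ; trans = λ {x} {y} {z} → ≈ℝ-trans {x} {y} {z} }
              ; ∙-cong = λ {x} {x′} {y} {y′} → +ℝ-cong {x} {x′} {y} {y′} }
            ; assoc = λ x y z → pointwise⇒≈ℝ {(x +ℝ y) +ℝ z} {x +ℝ (y +ℝ z)} (λ n → ℚ.+-assoc (seq x n) (seq y n) (seq z n)) }
          ; identity = (λ x → pointwise⇒≈ℝ {0ℝ +ℝ x} {x} (λ n → ℚ.+-identityˡ (seq x n))) ,
                       (λ x → pointwise⇒≈ℝ {x +ℝ 0ℝ} {x} (λ n → ℚ.+-identityʳ (seq x n))) }
        ; comm = λ x y → pointwise⇒≈ℝ {x +ℝ y} {y +ℝ x} (λ n → ℚ.+-comm (seq x n) (seq y n)) }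
      ; isPreleftSemimodule = record
        { *ₗ-cong = λ {q} {r} {x} {y} → fromℚ-*-cong {q} {r} {x} {y}
        ; *ₗ-zeroˡ = λ x → pointwise⇒≈ℝ {fromℚ 0ℚ *ℝ x} {0ℝ} (λ n → ℚ.*-zeroˡ (seq x n))
        ; *ₗ-distribʳ = λ x q r → pointwise⇒≈ℝ {fromℚ (q ℚ.+ r) *ℝ x} {(fromℚ q *ℝ x) +ℝ (fromℚ r *ℝ x)} (λ n → ℚ.*-distribʳ-+ (seq x n) q r)
        ; *ₗ-identityˡ = λ x → pointwise⇒≈ℝ {fromℚ 1ℚ *ℝ x} {x} (λ n → ℚ.*-identityˡ (seq x n))
        ; *ₗ-assoc = λ q r x → pointwise⇒≈ℝ {fromℚ (q ℚ.* r) *ℝ x} {fromℚ q *ℝ (fromℚ r *ℝ x)} (λ n → ℚ.*-assoc q r (seq x n))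
        ; *ₗ-zeroʳ = λ q → pointwise⇒≈ℝ {fromℚ q *ℝ 0ℝ} {0ℝ} (λ n → ℚ.*-zeroʳ q)
        ; *ₗ-distribˡ = λ q x y → pointwise⇒≈ℝ {fromℚ q *ℝ (x +ℝ y)} {(fromℚ q *ℝ x) +ℝ (fromℚ q *ℝ y)} (λ n → ℚ.*-distribˡ-+ q (seq x n) (seq y n)) } }
    ; -ᴹ‿cong = λ {x} {y} → -ℝ-cong {x} {y}
    ; -ᴹ‿inverse = (λ x → pointwise⇒≈ℝ {(-ℝ x) +ℝ x} {0ℝ} (λ n → ℚ.+-inverseˡ (seq x n))) ,
                   (λ x → pointwise⇒≈ℝ {x +ℝ (-ℝ x)} {0ℝ} (λ n → ℚ.+-inverseʳ (seq x n))) } }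

∈-irrelevant : ∀ {n} {i : Fin n} {S : Subset n} (p q : i ∈ S) → p ≡ q
∈-irrelevant here      here      = refl
∈-irrelevant (there p) (there q) = cong there (∈-irrelevant p q)

module _ {n : ℕ} (G : Graph n) where
  open Graph G

  edges : Edges n
  edges i j = E (⁅ i ⁆ ∪ ⁅ j ⁆)

  rigidOn⇒rigid : ∀ {k} (p : Placement n k) → Motions.RigidOn ℝ-module edges V p → Rigid G k
  rigidOn⇒rigid {k} p rigid = at , λ ṗ motion →
    trivial ṗ (rigid (extend ṗ) (extend-motion ṗ motion))
    where
    open Linear ℝ-module
    open Motions ℝ-module {n} {k}
    extend-at : (Vertex → ℝ^ k) → ∀ i → Dec (i ∈ V) → Fin k → ℝ
    extend-at ṗ i (yes i∈V) a = ṗ (i , i∈V) a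
    extend-at ṗ i (no  _)   a = 0ℝ
    extend : (Vertex → ℝ^ k) → Velocities
    extend ṗ i a = extend-at ṗ i (i ∈? V) a
    extend-∈ : ∀ ṗ i (i∈V : i ∈ V) a → extend ṗ i a ≈ᴹ ṗ (i , i∈V) a
    extend-∈ ṗ i i∈V a = on-V (i ∈? V)
      where
      on-V : ∀ d → extend-at ṗ i d a ≈ᴹ ṗ (i , i∈V) a
      on-V (yes h) = ≈ᴹ-reflexive (cong (λ h → ṗ (i , h) a) (∈-irrelevant h i∈V))
      on-V (no ¬h) = contradiction i∈V ¬h
    at : Vertex → ℝ^ k
    at (i , _) a = fromℚ (p i a)
    dot-cong : ∀ (f : Fin k → ℝ) (x y : ℝ^ k) → (∀ a → f a ≈ℝ (x a *ℝ y a)) → sum f ≈ℝ (x · y)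
    dot-cong f x y h = sum-cong-≋ {_} {f} {λ a → x a *ℝ y a} h
    trivial : ∀ ṗ → TrivialOn V p (extend ṗ) → Trivial G at ṗ
    trivial ṗ (S , t , skew , m≈) = S , t , skew , λ u a →
      ≈ℝ-trans {ṗ u a} {affine S t p (proj₁ u) a} {(S a · at u) +ℝ t a}
        (≈ℝ-trans {ṗ u a} {extend ṗ (proj₁ u) a} {affine S t p (proj₁ u) a}
          (≈ℝ-sym {extend ṗ (proj₁ u) a} {ṗ u a} (extend-∈ ṗ (proj₁ u) (proj₂ u) a)) (m≈ (proj₁ u) (proj₂ u) a))
        (+ℝ-cong {⟪ p (proj₁ u) , S a ⟫} {S a · at u} {t a} {t a}
          (dot-cong (λ b → p (proj₁ u) b *ₗ S a b) (S a) (at u) (λ b →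
            pointwise⇒≈ℝ {p (proj₁ u) b *ₗ S a b} {S a b *ℝ at u b} (λ n → ℚ.*-comm (p (proj₁ u) b) (seq (S a b) n))))
          (pointwise⇒≈ℝ {t a} {t a} (λ _ → refl)))
    extend-motion : ∀ ṗ → InfinitesimalMotion G at ṗ → Motion edges V p (extend ṗ)
    extend-motion ṗ motion i j i∈V j∈V e = ≈ᴹ-trans
      {⟪ (λ a → p i a ℚ.- p j a) , (λ a → extend ṗ i a -ᴹ extend ṗ j a) ⟫} {(at u -ᵛ at v) · (ṗ u -ᵛ ṗ v)} {0ℝ}
      (dot-cong (λ a → (p i a ℚ.- p j a) *ₗ (extend ṗ i a -ᴹ extend ṗ j a)) (at u -ᵛ at v) (ṗ u -ᵛ ṗ v) term)
      (motion u v e)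
      where
      u v : Vertex
      u = i , i∈V
      v = j , j∈V
      term : ∀ a → ((p i a ℚ.- p j a) *ₗ (extend ṗ i a -ᴹ extend ṗ j a)) ≈ℝ ((at u -ᵛ at v) a *ℝ (ṗ u -ᵛ ṗ v) a)
      term a = ≈ℝ-trans {(p i a ℚ.- p j a) *ₗ (extend ṗ i a -ᴹ extend ṗ j a)} {(p i a ℚ.- p j a) *ₗ (ṗ u a -ᴹ ṗ v a)} {(at u -ᵛ at v) a *ℝ (ṗ u -ᵛ ṗ v) a}
        (fromℚ-*-cong {p i a ℚ.- p j a} {p i a ℚ.- p j a} {extend ṗ i a -ᴹ extend ṗ j a} {ṗ u a -ᴹ ṗ v a} refl
          (+ℝ-cong {extend ṗ i a} {ṗ u a} { -ℝ extend ṗ j a} { -ℝ ṗ v a}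
            (extend-∈ ṗ i i∈V a) (-ℝ-cong {extend ṗ j a} {ṗ v a} (extend-∈ ṗ j j∈V a))))
        (pointwise⇒≈ℝ {(p i a ℚ.- p j a) *ₗ (ṗ u a -ᴹ ṗ v a)} {(at u -ᵛ at v) a *ℝ (ṗ u -ᵛ ṗ v) a} (λ _ → refl))

  -- Pinned rigidity passes from ℚ to ℝ because it is triviality of a kernel; the unpinning is then
  -- done over ℝ at the same rational placement.
  derived⇒rigid : ∀ {k} → (∀ i j → Dec (edges i j)) → Derived (suc k) edges V → Rigid G (suc k)
  derived⇒rigid {k} E? derived = realise (derivable⇒anchored ∣ V ∣ E? V derived)
    where
    realise : Anchored (suc k) edges V → Rigid G (suc k)
    realise (a , inj , a∈ , clique , pr) =
      place (Generic.point (generic-× generalPosition-generic (pinRigid-generic E? V a pr)))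
      where
      place : ∃ (λ p → GeneralPosition p × Motions.PinRigid ℚ-module edges V a p) → Rigid G (suc k)
      place (p , gp , pinned) = rigidOn⇒rigid p
        (Motions.unpin ℝ-module p gp a inj a∈ clique (pinRigid-ℚ⇒M E? V a ℝ-module p pinned))

-- From chains on sets to alternating chains on tuples

module _ {n : ℕ} where
  ∈⟦⟧ : ∀ {m} (v : Vec (Fin n) m) f → lookup v f ∈ ⟦ v ⟧
  ∈⟦⟧ (x ∷ v) zero    = x∈⁅x⁆∪ x ⟦ v ⟧
  ∈⟦⟧ (x ∷ v) (suc f) = ∈⇒∈⁅⁆∪ x ⟦ v ⟧ (∈⟦⟧ v f)

  ∈⟦⟧⁻ : ∀ {m} (v : Vec (Fin n) m) {x} → x ∈ ⟦ v ⟧ → ∃[ f ] lookup v f ≡ x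
  ∈⟦⟧⁻ []      x∈ = contradiction x∈ Sub.∉⊥
  ∈⟦⟧⁻ (y ∷ v) x∈ = [ (λ x≡y → zero , sym x≡y) , (λ x∈v → let f , e = ∈⟦⟧⁻ v x∈v in suc f , e) ]′
    (∈⁅⁆∪⁻ y ⟦ v ⟧ x∈)

  injective⇒distinct : ∀ {m} (v : Vec (Fin n) m) → Injectiveᵛ v → Distinct v
  injective⇒distinct []      inj = _
  injective⇒distinct (x ∷ v) inj =
    (λ x∈v → let f , e = ∈⟦⟧⁻ v x∈v in Fin.0≢1+n (inj zero (suc f) (sym e))) ,
    injective⇒distinct v (λ f g e → Fin.suc-injective (inj (suc f) (suc g) e))

  listing : ∀ (S : Subset n) {m} → ∣ S ∣ ≡ m → Σ (Vec (Fin n) m) λ v → ⟦ v ⟧ ≡ S × Distinct v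
  listing S refl = let v , inj , v∈ , onto = enumerate S in v ,
    Sub.⊆-antisym (λ x∈ → let f , e = ∈⟦⟧⁻ v x∈ in subst (_∈ S) e (v∈ f))
                  (λ x∈ → let f , e = onto _ x∈ in subst (_∈ ⟦ v ⟧) e (∈⟦⟧ v f)) ,
    injective⇒distinct v inj

  ⟦++⟧ : ∀ {l m} (v : Vec (Fin n) l) (w : Vec (Fin n) m) → ⟦ v Vec.++ w ⟧ ≡ ⟦ v ⟧ ∪ ⟦ w ⟧
  ⟦++⟧ []      w = sym (Sub.∪-identityˡ ⟦ w ⟧)
  ⟦++⟧ (x ∷ v) w = trans (cong (⁅ x ⁆ ∪_) (⟦++⟧ v w)) (sym (Sub.∪-assoc ⁅ x ⁆ ⟦ v ⟧ ⟦ w ⟧))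

  distinct-++ : ∀ {l m} (v : Vec (Fin n) l) (w : Vec (Fin n) m) → Distinct v → Distinct w →
                (∀ {x} → x ∈ ⟦ v ⟧ → x ∉ ⟦ w ⟧) → Distinct (v Vec.++ w)
  distinct-++ []      w _          dw _        = dw
  distinct-++ (x ∷ v) w (x∉v , dv) dw disjoint =
    (λ x∈ → [ x∉v , disjoint (x∈⁅x⁆∪ x ⟦ v ⟧) ]′ (Sub.x∈p∪q⁻ ⟦ v ⟧ ⟦ w ⟧ (subst (x ∈_) (⟦++⟧ v w) x∈))) ,
    distinct-++ v w dv dw (λ y∈v → disjoint (∈⇒∈⁅⁆∪ x ⟦ v ⟧ y∈v))

  ∈-below : ∀ {x y : Fin n} → x Fin.< y → x ∈ below y
  ∈-below {y = y} = ∈-subset (λ u → u Fin.<? y)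

  ∈-below⁻ : ∀ {x y : Fin n} → x ∈ below y → x Fin.< y
  ∈-below⁻ {y = y} = ∈-subset⁻ (λ u → u Fin.<? y)

  ∣below∣-< : ∀ {x y} {S : Subset n} → y ∉ S → y Fin.< x → ∣ (⁅ y ⁆ ∪ S) ∩ below x ∣ ≡ suc ∣ S ∩ below x ∣
  ∣below∣-< {x} {y} {S} y∉S y<x = trans
    (cong ∣_∣ (Sub.⊆-antisym {i = (⁅ y ⁆ ∪ S) ∩ below x} {⁅ y ⁆ ∪ (S ∩ below x)}
      (λ z∈ → let z∈₁ , z∈₂ = Sub.x∈p∩q⁻ (⁅ y ⁆ ∪ S) (below x) z∈ in
        [ (λ z≡y → subst (_∈ ⁅ y ⁆ ∪ (S ∩ below x)) (sym z≡y) (x∈⁅x⁆∪ y _))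
        , (λ z∈S → ∈⇒∈⁅⁆∪ y _ (Sub.x∈p∩q⁺ (z∈S , z∈₂))) ]′ (∈⁅⁆∪⁻ y S z∈₁))
      (λ z∈ → [ (λ z≡y → subst (_∈ (⁅ y ⁆ ∪ S) ∩ below x) (sym z≡y) (Sub.x∈p∩q⁺ (x∈⁅x⁆∪ y S , ∈-below y<x)))
        , (λ z∈∩ → let z∈S , z∈b = Sub.x∈p∩q⁻ S (below x) z∈∩ in Sub.x∈p∩q⁺ (∈⇒∈⁅⁆∪ y S z∈S , z∈b)) ]′
        (∈⁅⁆∪⁻ y (S ∩ below x) z∈))))
    (∣⁅x⁆∪S∣ y (S ∩ below x) (λ y∈ → y∉S (proj₁ (Sub.x∈p∩q⁻ S (below x) y∈))))

  below-≮ : ∀ {x y} (S : Subset n) → ¬ (y Fin.< x) → (⁅ y ⁆ ∪ S) ∩ below x ≡ S ∩ below x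
  below-≮ {x} {y} S y≮x = Sub.⊆-antisym {i = (⁅ y ⁆ ∪ S) ∩ below x} {S ∩ below x}
    (λ z∈ → let z∈₁ , z∈₂ = Sub.x∈p∩q⁻ (⁅ y ⁆ ∪ S) (below x) z∈ in
      [ (λ z≡y → contradiction (∈-below⁻ (subst (_∈ below x) z≡y z∈₂)) y≮x)
      , (λ z∈S → Sub.x∈p∩q⁺ (z∈S , z∈₂)) ]′ (∈⁅⁆∪⁻ y S z∈₁))
    (λ z∈ → let z∈S , z∈b = Sub.x∈p∩q⁻ S (below x) z∈ in Sub.x∈p∩q⁺ (∈⇒∈⁅⁆∪ y S z∈S , z∈b))

-- Interior products and slices of chains

rank : ∀ {n} → Fin n → Subset n → ℕ
rank x S = ∣ S ∩ below x ∣

module Tuples {c ℓ} (Γ : AbelianGroup c ℓ)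
              (stable : ∀ x y → Stable (AbelianGroup._≈_ Γ x y)) (n : ℕ) where
  open Chains Γ stable n

  Coefficients : Set c
  Coefficients = Subset n → Carrier

  σ : ℕ → Carrier → Carrier
  σ = -1^_•_ Γ

  σ-cong : ∀ j {a b} → a ≈ b → σ j a ≈ σ j b
  σ-cong zero    a≈b = a≈b
  σ-cong (suc j) a≈b = ⁻¹-cong (σ-cong j a≈b)

  σ-ε : ∀ j → σ j ε ≈ ε
  σ-ε zero    = ≈-refl
  σ-ε (suc j) = ≈-trans (⁻¹-cong (σ-ε j)) ε⁻¹≈ε

  σ-⁻¹ : ∀ j a → σ j (a ⁻¹) ≈ σ j a ⁻¹
  σ-⁻¹ zero    a = ≈-refl
  σ-⁻¹ (suc j) a = ⁻¹-cong (σ-⁻¹ j a)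

  σ-∙ : ∀ j a b → σ j (a ∙ b) ≈ σ j a ∙ σ j b
  σ-∙ zero    a b = ≈-refl
  σ-∙ (suc j) a b = ≈-trans (⁻¹-cong (σ-∙ j a b)) (≈-sym (⁻¹-∙-comm _ _))

  σ-sum : ∀ j {K} (f : Fin K → Carrier) → σ j (sum f) ≈ sum (λ i → σ j (f i))
  σ-sum j {zero}  f = σ-ε j
  σ-sum j {suc K} f = ≈-trans (σ-∙ j _ _) (∙-congˡ (σ-sum j (f ∘ suc)))

  σ-comm : ∀ i j a → σ i (σ j a) ≈ σ j (σ i a)
  σ-comm zero    j a = ≈-refl
  σ-comm (suc i) j a = ≈-trans (⁻¹-cong (σ-comm i j a)) (≈-sym (σ-⁻¹ j (σ i a)))

  σ≈ε : ∀ j {a} → σ j a ≈ ε → a ≈ ε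
  σ≈ε zero    h = h
  σ≈ε (suc j) h = σ≈ε j (≈-trans (≈-sym (⁻¹-involutive _)) (≈-trans (⁻¹-cong h) ε⁻¹≈ε))

  -- Interior products anticommute, so evaluating a chain on a tuple by
  -- iterating them gives an alternating function without permutation signs.
  interior : Fin n → Coefficients → Coefficients
  interior x C S = if does (x ∈? S) then ε else σ (rank x S) (C (⁅ x ⁆ ∪ S))

  interior-∈ : ∀ {x} C {S} → x ∈ S → interior x C S ≈ ε
  interior-∈ {x} C {S} x∈S = ≈-reflexive (cong (if_then ε else σ (rank x S) (C (⁅ x ⁆ ∪ S))) (dec-true (x ∈? S) x∈S))

  interior-∉ : ∀ {x} C {S} → x ∉ S → interior x C S ≈ σ (rank x S) (C (⁅ x ⁆ ∪ S))
  interior-∉ {x} C {S} x∉S = ≈-reflexive (cong (if_then ε else σ (rank x S) (C (⁅ x ⁆ ∪ S))) (dec-false (x ∈? S) x∉S))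

  interior-vanish : ∀ x C S → (x ∉ S → C (⁅ x ⁆ ∪ S) ≈ ε) → interior x C S ≈ ε
  interior-vanish x C S h = on-∈ (x ∈? S)
    where
    on-∈ : Dec (x ∈ S) → interior x C S ≈ ε
    on-∈ (yes x∈S) = interior-∈ C x∈S
    on-∈ (no x∉S)  = ≈-trans (interior-∉ C x∉S) (≈-trans (σ-cong (rank x S) (h x∉S)) (σ-ε (rank x S)))

  interior-cong : ∀ x {C D} → (∀ S → C S ≈ D S) → ∀ S → interior x C S ≈ interior x D S
  interior-cong x C≈D S with x ∈? S
  ... | yes _ = ≈-refl
  ... | no  _ = σ-cong (rank x S) (C≈D _)

  interior-⁻¹ : ∀ x C S → interior x (λ S → C S ⁻¹) S ≈ interior x C S ⁻¹
  interior-⁻¹ x C S with x ∈? S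
  ... | yes _ = ≈-sym ε⁻¹≈ε
  ... | no  _ = σ-⁻¹ (rank x S) (C (⁅ x ⁆ ∪ S))

  interior-sum : ∀ x {K} (C : Fin K → Coefficients) S →
    interior x (λ S → sum (λ i → C i S)) S ≈ sum (λ i → interior x (C i) S)
  interior-sum x {K} C S with x ∈? S
  ... | yes _ = ≈-sym (sum-ε {K} {λ _ → ε} (λ _ → ≈-refl))
  ... | no  _ = σ-sum (rank x S) (λ i → C i (⁅ x ⁆ ∪ S))

  interior-anticommute : ∀ {x y} → x ≢ y → ∀ C S → interior y (interior x C) S ≈ interior x (interior y C) S ⁻¹
  interior-anticommute {x} {y} x≢y C S = on-∈ (x ∈? S) (y ∈? S)
    where
    to-ε⁻¹ : ∀ {a b} → a ≈ ε → b ≈ ε → a ≈ b ⁻¹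
    to-ε⁻¹ a≈ε b≈ε = ≈-trans a≈ε (≈-sym (≈-trans (⁻¹-cong b≈ε) ε⁻¹≈ε))
    D = C (⁅ x ⁆ ∪ ⁅ y ⁆ ∪ S)
    expand : ∀ {x y} C → x ≢ y → x ∉ S → y ∉ S → interior y (interior x C) S ≈
      σ (rank y S) (σ (rank x (⁅ y ⁆ ∪ S)) (C (⁅ x ⁆ ∪ ⁅ y ⁆ ∪ S)))
    expand {x} {y} C x≢y x∉S y∉S = ≈-trans (interior-∉ (interior x C) y∉S)
      (σ-cong (rank y S) (interior-∉ C ([ x≢y , x∉S ]′ ∘ ∈⁅⁆∪⁻ y S)))
    signs : x ∉ S → y ∉ S → Tri (x Fin.< y) (x ≡ y) (y Fin.< x) →
      σ (rank y S) (σ (rank x (⁅ y ⁆ ∪ S)) D) ≈ σ (rank x S) (σ (rank y (⁅ x ⁆ ∪ S)) D) ⁻¹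
    signs x∉S y∉S (tri≈ _ x≡y _) = contradiction x≡y x≢y
    signs x∉S y∉S (tri> x≮y _ y<x) = begin
      σ a (σ (rank x (⁅ y ⁆ ∪ S)) D)      ≡⟨ cong (λ j → σ a (σ j D)) (∣below∣-< y∉S y<x) ⟩
      σ a (σ b D ⁻¹)                           ≈⟨ σ-⁻¹ a (σ b D) ⟩
      σ a (σ b D) ⁻¹                           ≈⟨ ⁻¹-cong (σ-comm a b D) ⟩
      σ b (σ a D) ⁻¹                           ≡⟨ cong (λ T → σ b (σ ∣ T ∣ D) ⁻¹) (below-≮ S x≮y) ⟨
      σ b (σ (rank y (⁅ x ⁆ ∪ S)) D) ⁻¹   ∎
      where
      a = rank y S
      b = rank x S
    signs x∉S y∉S (tri< x<y _ y≮x) = begin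
      σ a (σ (rank x (⁅ y ⁆ ∪ S)) D)      ≡⟨ cong (λ T → σ a (σ ∣ T ∣ D)) (below-≮ S y≮x) ⟩
      σ a (σ b D)                              ≈⟨ σ-comm a b D ⟩
      σ b (σ a D)                              ≈⟨ ⁻¹-involutive _ ⟨
      σ b (σ a D) ⁻¹ ⁻¹                        ≈⟨ ⁻¹-cong (σ-⁻¹ b (σ a D)) ⟨
      σ b (σ a D ⁻¹) ⁻¹                        ≡⟨ cong (λ j → σ b (σ j D) ⁻¹) (∣below∣-< x∉S x<y) ⟨
      σ b (σ (rank y (⁅ x ⁆ ∪ S)) D) ⁻¹   ∎
      where
      a = rank y S
      b = rank x S
    on-∈ : Dec (x ∈ S) → Dec (y ∈ S) → interior y (interior x C) S ≈ interior x (interior y C) S ⁻¹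
    on-∈ (yes x∈S) _ = to-ε⁻¹ (interior-vanish y (interior x C) S (λ _ → interior-∈ C (∈⇒∈⁅⁆∪ y S x∈S)))
                              (interior-∈ (interior y C) x∈S)
    on-∈ (no _) (yes y∈S) = to-ε⁻¹ (interior-∈ (interior x C) y∈S)
      (interior-vanish x (interior y C) S (λ _ → interior-∈ C (∈⇒∈⁅⁆∪ x S y∈S)))
    on-∈ (no x∉S) (no y∉S) = begin
      interior y (interior x C) S
        ≈⟨ expand C x≢y x∉S y∉S ⟩
      σ (rank y S) (σ (rank x (⁅ y ⁆ ∪ S)) D)
        ≈⟨ signs x∉S y∉S (Fin.<-cmp x y) ⟩
      σ (rank x S) (σ (rank y (⁅ x ⁆ ∪ S)) D) ⁻¹
        ≡⟨ cong (λ T → σ (rank x S) (σ (rank y (⁅ x ⁆ ∪ S)) (C T)) ⁻¹) (∪-swap ⁅ x ⁆ ⁅ y ⁆ S) ⟩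
      σ (rank x S) (σ (rank y (⁅ x ⁆ ∪ S)) (C (⁅ y ⁆ ∪ ⁅ x ⁆ ∪ S))) ⁻¹
        ≈⟨ ⁻¹-cong (expand C (x≢y ∘ sym) y∉S x∉S) ⟨
      interior x (interior y C) S ⁻¹ ∎

  onTuples : ∀ {m} → Coefficients → Vec (Fin n) m → Carrier
  onTuples C []       = C ∅
  onTuples C (x ∷ xs) = onTuples (interior x C) xs

  onTuples-cong : ∀ {m C D} (xs : Vec (Fin n) m) → (∀ S → C S ≈ D S) → onTuples C xs ≈ onTuples D xs
  onTuples-cong []       C≈D = C≈D ∅
  onTuples-cong (x ∷ xs) C≈D = onTuples-cong xs (interior-cong x C≈D)

  onTuples-⁻¹ : ∀ {m} C (xs : Vec (Fin n) m) → onTuples (λ S → C S ⁻¹) xs ≈ onTuples C xs ⁻¹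
  onTuples-⁻¹ C []       = ≈-refl
  onTuples-⁻¹ C (x ∷ xs) = ≈-trans (onTuples-cong xs (interior-⁻¹ x C)) (onTuples-⁻¹ (interior x C) xs)

  onTuples-sum : ∀ {m K} (C : Fin K → Coefficients) (xs : Vec (Fin n) m) →
    onTuples (λ S → sum (λ i → C i S)) xs ≈ sum (λ i → onTuples (C i) xs)
  onTuples-sum C []       = ≈-refl
  onTuples-sum C (x ∷ xs) = ≈-trans (onTuples-cong xs (interior-sum x C)) (onTuples-sum (λ i → interior x (C i)) xs)

  onTuples-vanish : ∀ {m} C (xs : Vec (Fin n) m) → C ⟦ xs ⟧ ≈ ε → onTuples C xs ≈ ε
  onTuples-vanish C []       h = h
  onTuples-vanish C (x ∷ xs) h = onTuples-vanish (interior x C) xs (interior-vanish x C ⟦ xs ⟧ (λ _ → h))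

  onTuples-detects : ∀ {m} C (xs : Vec (Fin n) m) → Distinct xs → onTuples C xs ≈ ε → C ⟦ xs ⟧ ≈ ε
  onTuples-detects C []       _            h = h
  onTuples-detects C (x ∷ xs) (x∉xs , dxs) h = σ≈ε (rank x ⟦ xs ⟧)
    (≈-trans (≈-sym (interior-∉ C x∉xs)) (onTuples-detects (interior x C) xs dxs h))

  restrict : Coefficients → (Subset n → Bool) → Coefficients
  restrict C P S = if P S then C S else ε

  interior-restrict : ∀ x C P S → interior x (restrict C P) S ≈ restrict (interior x C) (λ S → P (⁅ x ⁆ ∪ S)) S
  interior-restrict x C P S with x ∈? S | P (⁅ x ⁆ ∪ S)
  ... | yes _ | true  = ≈-refl
  ... | yes _ | false = ≈-refl
  ... | no  _ | true  = ≈-refl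
  ... | no  _ | false = σ-ε (rank x S)

  onTuples-restrict : ∀ {m} C P (xs : Vec (Fin n) m) → onTuples (restrict C P) xs ≈ (onTuples C ↾ P) xs
  onTuples-restrict C P []       = ≈-refl
  onTuples-restrict C P (x ∷ xs) = ≈-trans (onTuples-cong xs (interior-restrict x C P))
    (onTuples-restrict (interior x C) (λ S → P (⁅ x ⁆ ∪ S)) xs)

  ∂ˢ : Coefficients → Coefficients
  ∂ˢ C S = sum (λ x → interior x C S)

  ∂-onTuples : ∀ {m} C (xs : Vec (Fin n) m) → sum (λ x → onTuples C (x ∷ xs)) ≈ onTuples (∂ˢ C) xs
  ∂-onTuples C xs = ≈-sym (onTuples-sum (λ x → interior x C) xs)

  -- The fixed vertices stand at the end of the tuple, where the boundary, a sum over the first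
  -- entry, does not touch them; slices of cycles are therefore cycles.
  module Slice {m} (ys : Vec (Fin n) m) where
    slice : ∀ k → Coefficients → Chainᵃ k
    slice k C zs = onTuples C (zs Vec.++ ys)

    slice-alternating : ∀ k C → Alternating k (slice k C)
    slice-alternating zero          C = _
    slice-alternating (suc zero)    C = _ , λ x → slice-alternating zero (interior x C)
    slice-alternating (suc (suc k)) C =
      ((λ x y zs → swap x y zs (x Fin.≟ y)) , diag) , λ x → slice-alternating (suc k) (interior x C)
      where
      diag : ∀ x zs → slice (suc (suc k)) C (x ∷ x ∷ zs) ≈ ε
      diag x zs = onTuples-vanish (interior x (interior x C)) (zs Vec.++ ys)
        (interior-vanish x (interior x C) ⟦ zs Vec.++ ys ⟧ (λ _ → interior-∈ C (x∈⁅x⁆∪ x ⟦ zs Vec.++ ys ⟧)))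
      swap : ∀ x y zs → Dec (x ≡ y) → slice (suc (suc k)) C (x ∷ y ∷ zs) ≈ slice (suc (suc k)) C (y ∷ x ∷ zs) ⁻¹
      swap x _ zs (yes refl) = ≈-trans (diag x zs) (≈-sym (≈-trans (⁻¹-cong (diag x zs)) ε⁻¹≈ε))
      swap x y zs (no x≢y)   = ≈-trans (onTuples-cong (zs Vec.++ ys) (interior-anticommute x≢y C))
        (onTuples-⁻¹ (interior x (interior y C)) (zs Vec.++ ys))

    slice-cycle : ∀ k C → (∀ S → ∂ˢ C S ≈ ε) → Cycle (slice (suc k) C)
    slice-cycle k C cycle zs = ≈-trans (∂-onTuples C (zs Vec.++ ys))
      (onTuples-vanish (∂ˢ C) (zs Vec.++ ys) (cycle ⟦ zs Vec.++ ys ⟧))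

  open Chain

  -- The inverse is the one extra sign that arises because `position` counts from 1 and `rank` from
  -- 0.
  ∂≈∂ˢ⁻¹ : ∀ {d} (x : Chain Γ n d) S → ∂ Γ x S ≈ ∂ˢ (coeff x) S ⁻¹
  ∂≈∂ˢ⁻¹ x S = ≈-trans (sum-cong-≋ term) (sum-⁻¹ (λ v → interior v (coeff x) S))
    where
    term : ∀ v → (if does (v ∈? S) then ε else σ (position v (S ∪ ⁅ v ⁆)) (coeff x (S ∪ ⁅ v ⁆))) ≈ interior v (coeff x) S ⁻¹
    term v with v ∈? S
    ... | yes _ = ≈-sym ε⁻¹≈ε
    ... | no  _ = ≈-reflexive (trans
      (cong (λ T → σ (position v T) (coeff x T)) (Sub.∪-comm S ⁅ v ⁆))
      (cong (λ T → σ (suc ∣ T ∣) (coeff x (⁅ v ⁆ ∪ S))) (below-≮ {x = v} {v} S (ℕ.<-irrefl refl))))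

  restrictChain : ∀ {d} → Chain Γ n d → (Subset n → Bool) → Chain Γ n d
  restrictChain x P = record
    { coeff  = restrict (coeff x) P
    ; vanish = λ F ∣F∣≢d → if-ε (P F) (vanish x F ∣F∣≢d) }

  -- If every facet has k vertices in W, the complex induced on W is spanned
  -- by one derivable set B: the part of the cycle whose facets meet W
  -- inside a maximal B is a cycle.  At a ridge meeting W in k - 1 vertices
  -- this is the result on k-tuples for the slice with the vertices outside
  -- W held fixed; at any other ridge Y all facets meet W in Y ∩ W.
  module Induced {d} (x : Chain Γ n d) (cycle : IsCycle Γ x) (e : ℕ) (W : Subset n)
    (E : Edges n) (E? : ∀ i j → Dec (E i j))
    (facet : ∀ F → ¬ (coeff x F ≈ ε) → ∣ F ∩ W ∣ ≡ suc (suc (suc e)) × Clique E (F ∩ W))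
    (minimal : ∀ P → IsCycle Γ (restrictChain x P) → ∀ F → ¬ (coeff x F ≈ ε) → P F ≡ true →
               ∀ F′ → ¬ (coeff x F′ ≈ ε) → P F′ ≡ true) where
    open SpanningSets Γ stable n e

    private
      k : ℕ
      k = suc (suc (suc e))

      C : Coefficients
      C = coeff x

    ∂ˢ-zero : ∀ S → ∂ˢ C S ≈ ε
    ∂ˢ-zero S = ≈-trans (≈-sym (⁻¹-involutive _)) (≈-trans (⁻¹-cong (≈-trans (≈-sym (∂≈∂ˢ⁻¹ x S)) (cycle S))) ε⁻¹≈ε)

    module _ (B : Subset n) (absorb : Absorbing {k = k} {E} W B) where
      inB meetsB : Subset n → Bool
      inB S = does (S ⊆? B)
      meetsB F = inB (F ∩ W)

      ∂ˢ-restricted : ∀ Y → Dec (∣ Y ∩ W ∣ ≡ suc (suc e)) → ∂ˢ (restrict C meetsB) Y ≈ ε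
      ∂ˢ-restricted Y (no ∣Y∩W∣≢) = ≈-trans (sum-cong-≋ term) (constant (meetsB Y))
        where
        constant : ∀ b → sum (λ v → if b then interior v C Y else ε) ≈ ε
        constant true  = ∂ˢ-zero Y
        constant false = sum-ε {n} {λ _ → ε} (λ _ → ≈-refl)
        avoids : ∀ v → v ∉ Y → ¬ (C (⁅ v ⁆ ∪ Y) ≈ ε) → v ∉ W
        avoids v v∉Y nz v∈W = ∣Y∩W∣≢ (ℕ.suc-injective (trans
          (sym (∣⁅x⁆∪S∣ v (Y ∩ W) (λ v∈ → v∉Y (proj₁ (Sub.x∈p∩q⁻ Y W v∈)))))
          (trans (cong ∣_∣ (Sub.⊆-antisym {i = ⁅ v ⁆ ∪ (Y ∩ W)} {(⁅ v ⁆ ∪ Y) ∩ W}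
            (λ z∈ → [ (λ z≡v → subst (_∈ (⁅ v ⁆ ∪ Y) ∩ W) (sym z≡v) (Sub.x∈p∩q⁺ (x∈⁅x⁆∪ v Y , v∈W)))
              , (λ z∈∩ → let z∈Y , z∈W = Sub.x∈p∩q⁻ Y W z∈∩ in Sub.x∈p∩q⁺ (∈⇒∈⁅⁆∪ v Y z∈Y , z∈W)) ]′ (∈⁅⁆∪⁻ v (Y ∩ W) z∈))
            (λ z∈ → let z∈F , z∈W = Sub.x∈p∩q⁻ (⁅ v ⁆ ∪ Y) W z∈ in
              [ (λ z≡v → subst (_∈ ⁅ v ⁆ ∪ (Y ∩ W)) (sym z≡v) (x∈⁅x⁆∪ v (Y ∩ W)))
              , (λ z∈Y → ∈⇒∈⁅⁆∪ v (Y ∩ W) (Sub.x∈p∩q⁺ (z∈Y , z∈W))) ]′ (∈⁅⁆∪⁻ v Y z∈F))))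
            (proj₁ (facet (⁅ v ⁆ ∪ Y) nz)))))
        same-trace : ∀ v → v ∉ W → (⁅ v ⁆ ∪ Y) ∩ W ≡ Y ∩ W
        same-trace v v∉W = Sub.⊆-antisym {i = (⁅ v ⁆ ∪ Y) ∩ W} {Y ∩ W}
          (λ z∈ → let z∈F , z∈W = Sub.x∈p∩q⁻ (⁅ v ⁆ ∪ Y) W z∈ in
            [ (λ z≡v → contradiction (subst (_∈ W) z≡v z∈W) v∉W) , (λ z∈Y → Sub.x∈p∩q⁺ (z∈Y , z∈W)) ]′ (∈⁅⁆∪⁻ v Y z∈F))
          (λ z∈ → let z∈Y , z∈W = Sub.x∈p∩q⁻ Y W z∈ in Sub.x∈p∩q⁺ (∈⇒∈⁅⁆∪ v Y z∈Y , z∈W))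
        term : ∀ v → interior v (restrict C meetsB) Y ≈ (if meetsB Y then interior v C Y else ε)
        term v = on-∈ (v ∈? Y)
          where
          F = ⁅ v ⁆ ∪ Y
          on-∈ : Dec (v ∈ Y) → interior v (restrict C meetsB) Y ≈ (if meetsB Y then interior v C Y else ε)
          on-∈ (yes v∈Y) = ≈-trans (interior-∈ (restrict C meetsB) v∈Y) (≈-sym (if-ε (meetsB Y) (interior-∈ C v∈Y)))
          on-∈ (no v∉Y)  = by-cases {A = C F ≈ ε} (stable _ _) λ
            { (yes CF≈ε) → ≈-trans (interior-vanish v (restrict C meetsB) Y (λ _ → if-ε (meetsB F) CF≈ε))
                (≈-sym (if-ε (meetsB Y) (interior-vanish v C Y (λ _ → CF≈ε))))
            ; (no CF≉ε) → ≈-trans (interior-restrict v C meetsB Y)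
                (≈-reflexive (cong (λ T → if inB T then interior v C Y else ε) (same-trace v (avoids v v∉Y CF≉ε)))) }
      ∂ˢ-restricted Y (yes ∣Y∩W∣≡) = on-listings (listing (Y ∩ W) ∣Y∩W∣≡) (listing (Y ∩ ∁ W) refl)
        where
        on-listings : (Σ (Vec (Fin n) (suc (suc e))) λ a → ⟦ a ⟧ ≡ Y ∩ W × Distinct a) →
          (Σ (Vec (Fin n) ∣ Y ∩ ∁ W ∣) λ b → ⟦ b ⟧ ≡ Y ∩ ∁ W × Distinct b) → ∂ˢ (restrict C meetsB) Y ≈ ε
        on-listings (a , a≡ , da) (b , b≡ , db) = subst (λ S → ∂ˢ (restrict C meetsB) S ≈ ε) ab≡Y
          (onTuples-detects (∂ˢ (restrict C meetsB)) (a Vec.++ b)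
            (distinct-++ a b da db (λ x∈a x∈b → b-outside x∈b (proj₂ (Sub.x∈p∩q⁻ Y W (subst (_ ∈_) a≡ x∈a)))))
            (begin
              onTuples (∂ˢ (restrict C meetsB)) (a Vec.++ b)              ≈⟨ ∂-onTuples (restrict C meetsB) (a Vec.++ b) ⟨
              sum (λ v → onTuples (restrict C meetsB) (v ∷ a Vec.++ b))   ≈⟨ sum-cong-≋ (λ v → onTuples-restrict C meetsB (v ∷ a Vec.++ b)) ⟩
              sum (λ v → (onTuples C ↾ meetsB) (v ∷ a Vec.++ b))          ≈⟨ sum-cong-≋ (λ v → agree (v ∷ a)) ⟩
              boundary (g ↾ inB) a                                        ≈⟨ saturatedCycles ∣ W ∣ E E? W ℕ.≤-refl g (slice-alternating k C)
                                                                               (slice-cycle (suc (suc e)) C ∂ˢ-zero) g-supported inB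
                                                                               (absorbing⇒saturated {B = B} absorb) a ⟩
              ε                                                           ∎))
          where
          open Slice b
          g : Chainᵃ k
          g = slice k C
          b-outside : ∀ {v} → v ∈ ⟦ b ⟧ → v ∉ W
          b-outside v∈b = Sub.x∈∁p⇒x∉p (proj₂ (Sub.x∈p∩q⁻ Y (∁ W) (subst (_ ∈_) b≡ v∈b)))
          ab≡Y : ⟦ a Vec.++ b ⟧ ≡ Y
          ab≡Y = trans (⟦++⟧ a b) (trans (cong₂ _∪_ a≡ b≡) (trans (sym (Sub.∩-distribˡ-∪ Y W (∁ W)))
            (trans (cong (Y ∩_) (Sub.p∪∁p≡⊤ W)) (Sub.∩-identityʳ Y))))
          g-facet : ∀ zs → ¬ (g zs ≈ ε) → ¬ (C ⟦ zs Vec.++ b ⟧ ≈ ε)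
          g-facet zs nz h = nz (onTuples-vanish C (zs Vec.++ b) h)
          trace : ∀ zs → ¬ (g zs ≈ ε) → ⟦ zs Vec.++ b ⟧ ∩ W ≡ ⟦ zs ⟧
          trace zs nz = ⊆∧≥⇒≡ (λ v∈ → let v∈F , v∈W = Sub.x∈p∩q⁻ ⟦ zs Vec.++ b ⟧ W v∈ in
              [ (λ v∈zs → v∈zs) , (λ v∈b → contradiction v∈W (b-outside v∈b)) ]′
                (Sub.x∈p∪q⁻ ⟦ zs ⟧ ⟦ b ⟧ (subst (_ ∈_) (⟦++⟧ zs b) v∈F)))
            (ℕ.≤-reflexive (trans (nonzero-size {f = g} (slice-alternating k C) zs nz)
              (sym (proj₁ (facet _ (g-facet zs nz))))))
          g-supported : Supported E W g
          g-supported zs nz = subst (λ S → Clique E S × S ⊆ W) (trace zs nz)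
            (proj₂ (facet _ (g-facet zs nz)) , Sub.p∩q⊆q ⟦ zs Vec.++ b ⟧ W)
          agree : ∀ zs → (onTuples C ↾ meetsB) (zs Vec.++ b) ≈ (g ↾ inB) zs
          agree zs = by-cases {A = g zs ≈ ε} (stable _ _) λ
            { (yes gz≈ε) → ≈-trans (if-ε (meetsB ⟦ zs Vec.++ b ⟧) gz≈ε) (≈-sym (if-ε (inB ⟦ zs ⟧) gz≈ε))
            ; (no gz≉ε)  → ≈-reflexive (cong (λ T → if inB T then g zs else ε) (trace zs gz≉ε)) }

      restricted-cycle : IsCycle Γ (restrictChain x meetsB)
      restricted-cycle Y = ≈-trans (∂≈∂ˢ⁻¹ (restrictChain x meetsB) Y)
        (≈-trans (⁻¹-cong (∂ˢ-restricted Y (∣ Y ∩ W ∣ ℕ.≟ suc (suc e)))) ε⁻¹≈ε)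

    spanning : ∀ F₀ → ¬ (C F₀ ≈ ε) →
      ¬ ¬ (∃[ B ] B ⊆ W × Derived k E B × (∀ F → ¬ (C F ≈ ε) → F ∩ W ⊆ B))
    spanning F₀ nz K = maximal {k = k} {E} {W} {F₀ ∩ W} (Sub.p∩q⊆q F₀ W)
      (derived-clique (proj₁ (facet F₀ nz)) (proj₂ (facet F₀ nz)))
      λ (B , F₀⊆B , B⊆W , der , absorb) → K (B , B⊆W , der , λ F nzF → does⇒ (F ∩ W ⊆? B)
        (minimal (meetsB B absorb) (restricted-cycle B absorb) F₀ nz (dec-true (F₀ ∩ W ⊆? B) (λ {_} → F₀⊆B)) F nzF))

-- Equality up to double negation

-- Doubly negating the equality of Γ makes classical case distinctions on the
-- vanishing of coefficients available.
stableGroup : ∀ {c ℓ} → AbelianGroup c ℓ → AbelianGroup c ℓ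
stableGroup Γ = record
  { Carrier = Carrier
  ; _≈_ = λ x y → ¬ ¬ (x ≈ y)
  ; _∙_ = _∙_
  ; ε = ε
  ; _⁻¹ = _⁻¹
  ; isAbelianGroup = record
    { isGroup = record
      { isMonoid = record
        { isSemigroup = record
          { isMagma = record
            { isEquivalence = record
              { refl = λ k → k ≈-refl
              ; sym = λ p k → p λ h → k (≈-sym h)
              ; trans = λ p q k → p λ h → q λ h′ → k (≈-trans h h′) }
            ; ∙-cong = λ p q k → p λ h → q λ h′ → k (∙-cong h h′) }
          ; assoc = λ x y z k → k (assoc x y z) }
        ; identity = (λ x k → k (identityˡ x)) , (λ x k → k (identityʳ x)) }
      ; inverse = (λ x k → k (inverseˡ x)) , (λ x k → k (inverseʳ x))
      ; ⁻¹-cong = λ p k → p λ h → k (⁻¹-cong h) }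
    ; comm = λ x y k → k (comm x y) } }
  where open AbelianGroup Γ renaming (refl to ≈-refl; sym to ≈-sym; trans to ≈-trans)

stableGroup-stable : ∀ {c ℓ} (Γ : AbelianGroup c ℓ) → ∀ x y → Stable (AbelianGroup._≈_ (stableGroup Γ) x y)
stableGroup-stable Γ x y h k = h λ p → p k

stableGroup-sign : ∀ {c ℓ} (Γ : AbelianGroup c ℓ) j a → -1^_•_ (stableGroup Γ) j a ≡ -1^_•_ Γ j a
stableGroup-sign Γ zero    a = refl
stableGroup-sign Γ (suc j) a = cong (AbelianGroup._⁻¹ Γ) (stableGroup-sign Γ j a)

stableGroup-∂ : ∀ {c ℓ} (Γ : AbelianGroup c ℓ) {n d} (x : Chain Γ n d) (x′ : Chain (stableGroup Γ) n d) →
  (∀ F → Chain.coeff x′ F ≡ Chain.coeff x F) → ∀ G → ∂ (stableGroup Γ) x′ G ≡ ∂ Γ x G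
stableGroup-∂ Γ x x′ same G = CommutativeMonoidSum.sum-cong-≗ (AbelianGroup.commutativeMonoid Γ) λ v →
  cong (if_then_else_ (does (v ∈? G)) (AbelianGroup.ε Γ))
    (trans (stableGroup-sign Γ (position v (G ∪ ⁅ v ⁆)) (Chain.coeff x′ (G ∪ ⁅ v ⁆)))
      (cong (-1^_•_ Γ (position v (G ∪ ⁅ v ⁆))) (same (G ∪ ⁅ v ⁆))))

-- Colours and rank-selected subcomplexes

∣∩∣+∣∩∁∣ : ∀ {n} (S W : Subset n) → ∣ S ∩ W ∣ ℕ.+ ∣ S ∩ ∁ W ∣ ≡ ∣ S ∣
∣∩∣+∣∩∁∣ []            []            = refl
∣∩∣+∣∩∁∣ (inside  ∷ S) (inside  ∷ W) = cong suc (∣∩∣+∣∩∁∣ S W)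
∣∩∣+∣∩∁∣ (inside  ∷ S) (outside ∷ W) = trans (ℕ.+-suc _ _) (cong suc (∣∩∣+∣∩∁∣ S W))
∣∩∣+∣∩∁∣ (outside ∷ S) (_       ∷ W) = ∣∩∣+∣∩∁∣ S W

injective-on⇒≤ : ∀ {m n} (S : Subset m) (T : Subset n) (f : Fin m → Fin n) →
  (∀ x → x ∈ S → f x ∈ T) → (∀ x y → x ∈ S → y ∈ S → f x ≡ f y → x ≡ y) → ∣ S ∣ ≤ ∣ T ∣
injective-on⇒≤ S T f f∈ f-inj with enumerate S | enumerate T
... | v , v-inj , v∈ , _ | w , _ , _ , onto = Fin.injective⇒≤ {f = index} λ {i} {j} e →
  v-inj i j (f-inj _ _ (v∈ i) (v∈ j) (trans (sym (proj₂ (hit i))) (trans (cong (lookup w) e) (proj₂ (hit j)))))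
  where
  hit : ∀ i → ∃[ j ] lookup w j ≡ f (lookup v i)
  hit i = onto (f (lookup v i)) (f∈ _ (v∈ i))
  index : Fin ∣ S ∣ → Fin ∣ T ∣
  index i = proj₁ (hit i)

∣S∣≤1⇒≡ : ∀ {n} (S : Subset n) → ∣ S ∣ ≤ 1 → ∀ x y → x ∈ S → y ∈ S → x ≡ y
∣S∣≤1⇒≡ S ∣S∣≤1 x y x∈ y∈ = decidable-stable (x Fin.≟ y) λ x≢y → ℕ.<⇒≱ (ℕ.≤-refl {2}) (ℕ.≤-trans
  (ℕ.≤-reflexive (sym (trans (∣⁅x⁆∪S∣ x ⁅ y ⁆ (x≢y ∘ Sub.x∈⁅y⁆⇒x≡y y)) (cong suc (Sub.∣⁅x⁆∣≡1 y)))))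
  (ℕ.≤-trans (Sub.p⊆q⇒∣p∣≤∣q∣ (∪-least {S = ⁅ x ⁆} {⁅ y ⁆} {S} (⁅⁆⊆ {S = S} x∈) (⁅⁆⊆ {S = S} y∈))) ∣S∣≤1))

module RankSelection {n d : ℕ} (Δ : SimplicialComplex n) (κ : SimplicialComplex.Vertex Δ → Fin (suc d))
                     (proper : IsProperColoring Δ κ) where
  open SimplicialComplex Δ

  lookup-preimage : ∀ T v (v∈ : v ∈ vertices) → lookup (preimage Δ κ T) v ≡ lookup T (κ (v , v∈))
  lookup-preimage T v v∈ = trans (Vec.lookup∘tabulate _ v) (on-∈ (v ∈? vertices))
    where
    on-∈ : ∀ d → Preimage.member Δ κ T v d ≡ lookup T (κ (v , v∈))
    on-∈ (yes h) = cong (λ h → lookup T (κ (v , h))) (∈-irrelevant h v∈)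
    on-∈ (no ¬h) = contradiction v∈ ¬h

  ∈-preimage : ∀ T v (v∈ : v ∈ vertices) → κ (v , v∈) ∈ T → v ∈ preimage Δ κ T
  ∈-preimage T v v∈ h = Vec.lookup⇒[]= v _ (trans (lookup-preimage T v v∈) (Vec.[]=⇒lookup h))

  ∈-preimage⁻ : ∀ T v (v∈ : v ∈ vertices) → v ∈ preimage Δ κ T → κ (v , v∈) ∈ T
  ∈-preimage⁻ T v v∈ h = Vec.lookup⇒[]= _ T (trans (sym (lookup-preimage T v v∈)) (Vec.[]=⇒lookup h))

  colour-at : ∀ v → Dec (v ∈ vertices) → Fin (suc d)
  colour-at v (yes v∈) = κ (v , v∈)
  colour-at v (no _)   = zero

  -- Off the vertex set the value is junk.
  colour : Fin n → Fin (suc d)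
  colour v = colour-at v (v ∈? vertices)

  colour-κ : ∀ v (v∈ : v ∈ vertices) → colour v ≡ κ (v , v∈)
  colour-κ v v∈ = on-∈ (v ∈? vertices)
    where
    on-∈ : ∀ d → colour-at v d ≡ κ (v , v∈)
    on-∈ (yes h) = cong (λ h → κ (v , h)) (∈-irrelevant h v∈)
    on-∈ (no ¬h) = contradiction v∈ ¬h

  module _ (T : Subset (suc d)) where
    Δᵀ : SimplicialComplex n
    Δᵀ = rankSelected Δ κ T

    W : Subset n
    W = Graph.V (graph Δᵀ)

    E? : ∀ i j → Dec (edges (graph Δᵀ) i j)
    E? i j = SimplicialComplex.face? Δᵀ (⁅ i ⁆ ∪ ⁅ j ⁆) ×-dec (∣ ⁅ i ⁆ ∪ ⁅ j ⁆ ∣ ℕ.≟ 2)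

    ∈W⁻ : ∀ {v} → v ∈ W → Face ⁅ v ⁆ × v ∈ preimage Δ κ T
    ∈W⁻ {v} v∈W = let face , ⊆pre = ∈-subset⁻ (λ v → SimplicialComplex.face? Δᵀ ⁅ v ⁆) v∈W in
      face , ⊆pre (Sub.x∈⁅x⁆ v)

    module _ {F : Subset n} (face : Face F) where
      F⊆V : ∀ {v} → v ∈ F → v ∈ vertices
      F⊆V = face⊆vertices face

      ∈W : ∀ {v} → v ∈ F → colour v ∈ T → v ∈ W
      ∈W {v} v∈F c∈T = ∈-subset (λ v → SimplicialComplex.face? Δᵀ ⁅ v ⁆)
        (down-closed (⁅⁆⊆ {S = F} v∈F) face ,
         ⁅⁆⊆ {S = preimage Δ κ T} (∈-preimage T v (F⊆V v∈F) (subst (_∈ T) (colour-κ v (F⊆V v∈F)) c∈T)))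

      colour-∈T : ∀ {v} → v ∈ F → v ∈ W → colour v ∈ T
      colour-∈T {v} v∈F v∈W = subst (_∈ T) (sym (colour-κ v (F⊆V v∈F))) (∈-preimage⁻ T v (F⊆V v∈F) (proj₂ (∈W⁻ v∈W)))

      colour-injective : ∀ x y → x ∈ F → y ∈ F → colour x ≡ colour y → x ≡ y
      colour-injective x y x∈ y∈ e = ∣S∣≤1⇒≡ (F ∩ preimage Δ κ ⁅ colour y ⁆) (proper F face (colour y)) x y
        (Sub.x∈p∩q⁺ (x∈ , monochrome x∈ e)) (Sub.x∈p∩q⁺ (y∈ , monochrome y∈ refl))
        where
        monochrome : ∀ {z} → z ∈ F → colour z ≡ colour y → z ∈ preimage Δ κ ⁅ colour y ⁆
        monochrome {z} z∈ e = ∈-preimage ⁅ colour y ⁆ z (F⊆V z∈)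
          (subst (_∈ ⁅ colour y ⁆) (trans (sym e) (colour-κ z (F⊆V z∈))) (Sub.x∈⁅x⁆ (colour y)))

      -- Colours are distinct on F, which bounds the part in W by the colours in T and the part
      -- outside by the remaining ones. Both bounds are attained, as they add up to the size of F.
      facet-size : ∣ F ∣ ≡ suc d → ∣ F ∩ W ∣ ≡ ∣ T ∣
      facet-size ∣F∣≡ = ℕ.≤-antisym inside≤ (ℕ.+-cancelʳ-≤ (suc d ℕ.∸ ∣ T ∣) ∣ T ∣ ∣ F ∩ W ∣ (begin
        ∣ T ∣ ℕ.+ (suc d ℕ.∸ ∣ T ∣)        ≡⟨ ℕ.m+[n∸m]≡n (Sub.∣p∣≤n T) ⟩
        suc d                              ≡⟨ ∣F∣≡ ⟨
        ∣ F ∣                              ≡⟨ ∣∩∣+∣∩∁∣ F W ⟨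
        ∣ F ∩ W ∣ ℕ.+ ∣ F ∩ ∁ W ∣          ≤⟨ ℕ.+-monoʳ-≤ ∣ F ∩ W ∣ outside≤ ⟩
        ∣ F ∩ W ∣ ℕ.+ (suc d ℕ.∸ ∣ T ∣)    ∎))
        where
        open ℕ.≤-Reasoning
        inside≤ : ∣ F ∩ W ∣ ≤ ∣ T ∣
        inside≤ = injective-on⇒≤ (F ∩ W) T colour
          (λ v v∈ → let v∈F , v∈W = Sub.x∈p∩q⁻ F W v∈ in colour-∈T v∈F v∈W)
          (λ x y x∈ y∈ → colour-injective x y (proj₁ (Sub.x∈p∩q⁻ F W x∈)) (proj₁ (Sub.x∈p∩q⁻ F W y∈)))
        outside≤ : ∣ F ∩ ∁ W ∣ ≤ suc d ℕ.∸ ∣ T ∣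
        outside≤ = subst (∣ F ∩ ∁ W ∣ ≤_) (Sub.∣∁p∣≡n∸∣p∣ T) (injective-on⇒≤ (F ∩ ∁ W) (∁ T) colour
          (λ v v∈ → let v∈F , v∈∁W = Sub.x∈p∩q⁻ F (∁ W) v∈ in
            Sub.x∉p⇒x∈∁p (λ c∈T → Sub.x∈∁p⇒x∉p v∈∁W (∈W v∈F c∈T)))
          (λ x y x∈ y∈ → colour-injective x y (proj₁ (Sub.x∈p∩q⁻ F (∁ W) x∈)) (proj₁ (Sub.x∈p∩q⁻ F (∁ W) y∈))))

      facet-clique : Clique (edges (graph Δᵀ)) (F ∩ W)
      facet-clique i j i∈ j∈ i≢j =
        let i∈F , i∈W = Sub.x∈p∩q⁻ F W i∈
            j∈F , j∈W = Sub.x∈p∩q⁻ F W j∈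
        in (down-closed (∪-least {S = ⁅ i ⁆} {⁅ j ⁆} {F} (⁅⁆⊆ {S = F} i∈F) (⁅⁆⊆ {S = F} j∈F)) face ,
            (λ x∈ → ∪-least {S = ⁅ i ⁆} {⁅ j ⁆} {preimage Δ κ T} (⁅⁆⊆ {S = preimage Δ κ T} (proj₂ (∈W⁻ i∈W)))
                      (⁅⁆⊆ {S = preimage Δ κ T} (proj₂ (∈W⁻ j∈W))) x∈)) ,
           trans (∣⁅x⁆∪S∣ i ⁅ j ⁆ (i≢j ∘ Sub.x∈⁅y⁆⇒x≡y j)) (cong suc (Sub.∣⁅x⁆∣≡1 j))

    simplex-derived : ∀ F → ∣ F ∣ ≡ suc d → Face F → (∀ {G} → Face G → G ⊆ F) →
                      Derived ∣ T ∣ (edges (graph Δᵀ)) W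
    simplex-derived F ∣F∣≡ face ⊆F = derived-clique (trans (cong ∣_∣ (sym F∩W≡W)) (facet-size face ∣F∣≡))
      (subst (Clique (edges (graph Δᵀ))) F∩W≡W (facet-clique face))
      where
      F∩W≡W : F ∩ W ≡ W
      F∩W≡W = Sub.⊆-antisym {i = F ∩ W} {W} (Sub.p∩q⊆q F W)
        (λ {v} v∈W → Sub.x∈p∩q⁺ (⊆F (proj₁ (∈W⁻ v∈W)) (Sub.x∈⁅x⁆ v) , v∈W))

    module _ {c ℓ} (Γ : AbelianGroup c ℓ) (x : Chain Γ n (suc d)) (cycle : IsMinimalCycle Γ x)
             (faces⊆ : ∀ {G} → Face G → ⟨ supp Γ x ⟩ G) (⊆faces : ∀ {G} → ⟨ supp Γ x ⟩ G → Face G)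
             (e : ℕ) (∣T∣≡ : ∣ T ∣ ≡ suc (suc (suc e))) where
      open AbelianGroup Γ using (_≈_; ε) renaming (refl to ≈-refl; sym to ≈-sym; trans to ≈-trans; reflexive to ≈-reflexive)
      open Chain

      private
        Γ′ : AbelianGroup c ℓ
        Γ′ = stableGroup Γ

        x′ : Chain Γ′ n (suc d)
        x′ = record { coeff = coeff x ; vanish = λ F ∣F∣≢ k → k (vanish x F ∣F∣≢) }

        open Tuples Γ′ (stableGroup-stable Γ) n using (restrictChain; module Induced)

      support-face : ∀ F → ¬ (coeff x F ≈ ε) → Face F × ∣ F ∣ ≡ suc d
      support-face F nz = ⊆faces (F , nz , (λ v∈ → v∈)) ,
        decidable-stable (∣ F ∣ ℕ.≟ suc d) (λ ∣F∣≢ → nz (vanish x F ∣F∣≢))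

      part : (Subset n → Bool) → Chain Γ n (suc d)
      part P = record
        { coeff  = λ F → if P F then coeff x F else ε
        ; vanish = λ F ∣F∣≢ → part-vanish (P F) (vanish x F ∣F∣≢) }
        where
        part-vanish : ∀ b {a} → a ≈ ε → (if b then a else ε) ≈ ε
        part-vanish true  a≈ε = a≈ε
        part-vanish false _   = ≈-refl

      -- Minimality is a statement about the original equality, while the cycle condition arrives
      -- doubly negated at each set. As there are finitely many sets and the conclusion is a Boolean
      -- equation, the negations can be collected and discharged.
      part-minimal : ∀ P → IsCycle Γ′ (restrictChain x′ P) → ∀ F → ¬ (coeff x F ≈ ε) → P F ≡ true →
                     ∀ F′ → ¬ (coeff x F′ ≈ ε) → P F′ ≡ true
      part-minimal P cyc F nz PF F′ nz′ = decidable-stable (P F′ Bool.≟ true) λ ¬PF′ → ¬¬-∀Subset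
          (λ G k → cyc G (λ h → k (subst (_≈ ε) (stableGroup-∂ Γ (part P) (restrictChain x′ P) (λ _ → refl) G) h))) λ cyc →
        [ (λ same → nz′ (≈-trans (≈-sym (same F′)) (≈-reflexive (cong (if_then coeff x F′ else ε) (Bool.¬-not ¬PF′)))))
        , (λ none → nz (≈-trans (≈-reflexive (sym (cong (if_then coeff x F else ε) PF))) (none F))) ]′
          (proj₂ cycle (part P) subchain cyc)
        where
        choice : ∀ b {a} → (if b then a else ε) ≈ ε ⊎ (if b then a else ε) ≈ a
        choice true  = inj₂ ≈-refl
        choice false = inj₁ ≈-refl
        subchain : _SubchainOf_ Γ (part P) x
        subchain F = choice (P F)

      -- The spanning set contains the T-part of every facet. Every vertex of W lies in a facet, so
      -- the set is W itself, and decidability of `Derived` removes the double negation.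
      cycle-derived : ∃ (supp Γ x) → Derived (suc (suc (suc e))) (edges (graph Δᵀ)) W
      cycle-derived (F₀ , nz₀) = decidable-stable (derived? E? W) λ k →
        Induced.spanning x′ (λ G k → k (subst (_≈ ε) (sym (stableGroup-∂ Γ x x′ (λ _ → refl) G)) (proj₁ cycle G))) e W (edges (graph Δᵀ)) E?
          (λ F nz → let face , ∣F∣≡ = support-face F (down nz) in trans (facet-size face ∣F∣≡) ∣T∣≡ , facet-clique face)
          (λ P cyc F nz PF F′ nz′ → part-minimal P cyc F (down nz) PF F′ (down nz′)) F₀ (λ h → h nz₀)
          λ (B , B⊆W , derived , spans) → k (subst (Derived _ _) (Sub.⊆-antisym {i = B} {W} B⊆W (W⊆B spans)) derived)
        where
        down : ∀ {A : Set ℓ} → ¬ (¬ ¬ A) → ¬ A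
        down h a = h λ k → k a
        W⊆B : ∀ {B} → (∀ F → ¬ ¬ ¬ (coeff x F ≈ ε) → F ∩ W ⊆ B) → W ⊆ B
        W⊆B spans {v} v∈W = let F , nz , v⊆F = faces⊆ (proj₁ (∈W⁻ v∈W)) in
          spans F (λ h → h nz) (Sub.x∈p∩q⁺ (v⊆F (Sub.x∈⁅x⁆ v) , v∈W))

theorem4p1 : ∀ {c ℓ : Level} (Γ : AbelianGroup c ℓ) {n : ℕ} (d : ℕ) → 3 ≤ d →
    (Δ : SimplicialComplex n) → IsMinimalCycleComplex Γ d Δ →
    (κ : SimplicialComplex.Vertex Δ → Fin d) → IsProperColoring Δ κ →
    (T : Subset d) → 3 ≤ ∣ T ∣ →
    Rigid (graph (rankSelected Δ κ T)) ∣ T ∣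
theorem4p1 Γ {n} (suc d) _ Δ ((facet , _) , cases) κ proper T 3≤∣T∣ = at-size ∣ T ∣ refl 3≤∣T∣
  where
  open RankSelection Δ κ proper
  open SimplicialComplex using (Face)
  derived : ∀ e → ∣ T ∣ ≡ suc (suc (suc e)) → Derived (suc (suc (suc e))) (edges (graph (Δᵀ T))) (W T)
  derived e ∣T∣≡ = [ from-simplex , from-cycle ]′ cases
    where
    from-simplex : ∃[ F ] ∣ F ∣ ≡ suc d × Face Δ ≐ ⟨ ｛ F ｝ ⟩ → Derived (suc (suc (suc e))) (edges (graph (Δᵀ T))) (W T)
    from-simplex (F , ∣F∣≡ , faces⊆ , ⊆faces) = subst (λ t → Derived t (edges (graph (Δᵀ T))) (W T)) ∣T∣≡
      (simplex-derived T F ∣F∣≡ (⊆faces (F , refl , (λ x∈ → x∈)))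
        (λ G-face x∈ → let _ , F≡ , G⊆ = faces⊆ G-face in subst (_ ∈_) (sym F≡) (G⊆ x∈)))
    from-cycle : ∃[ x ] ¬ IsZero Γ {n} {suc d} x × IsMinimalCycle Γ x × Face Δ ≐ ⟨ supp Γ x ⟩ →
      Derived (suc (suc (suc e))) (edges (graph (Δᵀ T))) (W T)
    from-cycle (x , _ , cycle , faces⊆ , ⊆faces) =
      -- A face of size d lies under a set of the support, which makes a nonzero coefficient
      -- explicit.
      let F , F-face , _ = facet
          G , nz , _ = faces⊆ F-face
      in cycle-derived T Γ x cycle faces⊆ ⊆faces e ∣T∣≡ (G , nz)
  at-size : ∀ t → ∣ T ∣ ≡ t → 3 ≤ t → Rigid (graph (rankSelected Δ κ T)) ∣ T ∣
  at-size (suc (suc (suc e))) ∣T∣≡ (s≤s (s≤s (s≤s _))) =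
    subst (Rigid (graph (Δᵀ T))) (sym ∣T∣≡) (derived⇒rigid (graph (Δᵀ T)) (E? T) (derived e ∣T∣≡))
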